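{- Let $n\ge 5$ and $m$ be integers and let $\mathcal{G}_{g_1}(n,m)$ be the set of all unicyclic graphs on $n$ vertices with matching number $m$ whose girth is odd. Let $G_3^1=G_3(0,0;0,0;m-2,n-2m+1)$ and $G_3^2=G_3(0,1;0,1;m-3,n-2m+1)$. Then: (1) If $m=2$, then $\varphi_i(G)\ge \varphi_i(G_3^1)$ for every $G\in\mathcal{G}_{g_1}(n,m)$ and every $i=0,1,\dots,n$. (2) If $n-m\le 3$, $6\le n\le 12$ and $m\ge 3$, then $\varphi_i(G)\ge \varphi_i(G_3^2)$ for every $G\in\mathcal{G}_{g_1}(n,m)$ and every $i=0,1,\dots,n$. (3) If $m\ge 3$ and either $n-m>3$ or $n>12$, then $G_3^1$ and $G_3^2$ are the two extremal graphs with minimal signless Laplacian coefficients in $\mathcal{G}_{g_1}(n,m)$: for every $G\in\mathcal{G}_{g_1}(n,m)$ there is $H\in\{G_3^1,G_3^2\}$ with $\varphi_i(G)\ge\varphi_i(H)$ for all $i=0,1,\dots,n$; moreover $G_3^1$ and $G_3^2$ are not comparable, i.e. neither satisfies $\varphi_i(\cdot)\le \varphi_i(\cdot)$ for all $i$ with respect to the other.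
   Context: A unicyclic graph is a simple connected graph containing exactly one cycle; its girth is the length of that cycle. The matching number of a graph is the maximum number of edges in a matching. For a graph $G$ on $n$ vertices let $Q(G)=D(G)+A(G)$ be its signless Laplacian matrix ($D(G)$ the diagonal matrix of vertex degrees, $A(G)$ the adjacency matrix), and write $\det(xI-Q(G))=\sum_{i=0}^{n}(-1)^i\varphi_i(G)x^{n-i}$; the numbers $\varphi_i(G)$ are the signless Laplacian coefficients. For $g\ge 3$ and nonnegative integers $s_j,t_j$, $G_g(s_1,t_1;s_2,t_2;\dots;s_g,t_g)$ denotes the connected unicyclic graph obtained from a cycle $u_1u_2\cdots u_gu_1$ by attaching, at each vertex $u_j$, $s_j$ pendent paths of length $2$ (paths $u_j a b$ with new vertices $a,b$, $b$ of degree 1) and $t_j$ pendent edges. -}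

module Defs where

open import Data.Nat as ℕ using (ℕ; zero; suc; _≤_; _<_; _≡ᵇ_)
open import Data.Bool using (Bool; true; false; if_then_else_; _∧_; _∨_)
open import Data.Fin using (Fin; toℕ; punchIn) renaming (zero to fzero; suc to fsuc)
open import Data.Integer as ℤ using (ℤ; +_; -_)
open import Data.List using (List; []; _∷_; _++_; length; concatMap; foldr)
open import Data.List.Relation.Unary.All using (All)
open import Data.List.Relation.Unary.Unique.Propositional using (Unique)
open import Data.Product using (Σ; ∃; _×_; _,_; proj₁)
open import Data.Sum using (_⊎_)
open import Relation.Binary.PropositionalEquality using (_≡_)

Adj : ℕ → Set
Adj n = Fin n → Fin n → Bool

IsSimple : ∀ {n} → Adj n → Set
IsSimple {n} G = (∀ u v → G u v ≡ G v u) × (∀ u → G u u ≡ false)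

data Reach {n} (G : Adj n) : Fin n → Fin n → Set where
  here : ∀ {u} → Reach G u u
  step : ∀ {u v w} → G u v ≡ true → Reach G v w → Reach G u w

IsConnected : ∀ {n} → Adj n → Set
IsConnected {n} G = ∀ (u v : Fin n) → Reach G u v

Consec : ∀ {k} → Fin k → Fin k → Set
Consec {k} i j = (suc (toℕ i) ≡ toℕ j) ⊎ ((suc (toℕ i) ≡ k) × (toℕ j ≡ 0))

record Cycle {n} (G : Adj n) : Set where
  field
    k'   : ℕ
    vtx  : Fin (3 ℕ.+ k') → Fin n
    inj  : ∀ i j → vtx i ≡ vtx j → i ≡ j
    adj  : ∀ i j → Consec i j → G (vtx i) (vtx j) ≡ true

cycleLength : ∀ {n} {G : Adj n} → Cycle G → ℕ
cycleLength C = 3 ℕ.+ Cycle.k' C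

CycleEdge : ∀ {n} {G : Adj n} → Cycle G → Fin n → Fin n → Set
CycleEdge C u v = Σ (Fin (3 ℕ.+ Cycle.k' C)) λ i → Σ (Fin (3 ℕ.+ Cycle.k' C)) λ j →
  Consec i j × ((Cycle.vtx C i ≡ u × Cycle.vtx C j ≡ v) ⊎ (Cycle.vtx C i ≡ v × Cycle.vtx C j ≡ u))

SameCycle : ∀ {n} {G : Adj n} → Cycle G → Cycle G → Set
SameCycle {n} C D = ∀ (u v : Fin n) → (CycleEdge C u v → CycleEdge D u v) × (CycleEdge D u v → CycleEdge C u v)

IsUnicyclic : ∀ {n} → Adj n → Set
IsUnicyclic G = IsSimple G × IsConnected G × (Σ (Cycle G) λ C → ∀ (D : Cycle G) → SameCycle C D)

HasGirth : ∀ {n} → Adj n → ℕ → Set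
HasGirth G g = Σ (Cycle G) λ C → (cycleLength C ≡ g) × (∀ (D : Cycle G) → g ≤ cycleLength D)

Odd : ℕ → Set
Odd g = ∃ λ k → g ≡ suc (2 ℕ.* k)

endpoints : ∀ {n} → List (Fin n × Fin n) → List (Fin n)
endpoints = concatMap (λ { (u , v) → u ∷ v ∷ [] })

IsMatching : ∀ {n} → Adj n → List (Fin n × Fin n) → Set
IsMatching G M = All (λ { (u , v) → G u v ≡ true }) M × Unique (endpoints M)

HasMatchingNumber : ∀ {n} → Adj n → ℕ → Set
HasMatchingNumber G m =
  (Σ (List _) λ M → IsMatching G M × length M ≡ m) ×
  (∀ M → IsMatching G M → length M ≤ m)

InClass : (n m : ℕ) → Adj n → Set
InClass n m G = IsUnicyclic G × HasMatchingNumber G m × (∃ λ g → HasGirth G g × Odd g)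

-- Polynomials over ℤ as coefficient lists (lowest degree first).

Poly : Set
Poly = List ℤ

_⊕_ : Poly → Poly → Poly
[] ⊕ q = q
(a ∷ p) ⊕ [] = a ∷ p
(a ∷ p) ⊕ (b ∷ q) = (a ℤ.+ b) ∷ (p ⊕ q)

scale : ℤ → Poly → Poly
scale c [] = []
scale c (a ∷ p) = (c ℤ.* a) ∷ scale c p

_⊛_ : Poly → Poly → Poly
[] ⊛ q = []
(a ∷ p) ⊛ q = scale a q ⊕ (+ 0 ∷ (p ⊛ q))

coeff : Poly → ℕ → ℤ
coeff [] k = + 0
coeff (a ∷ p) zero = a
coeff (a ∷ p) (suc k) = coeff p k

sign : ℕ → ℤ
sign zero = + 1
sign (suc k) = - sign k

det : ∀ {n} → (Fin n → Fin n → Poly) → Poly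
det {zero} M = + 1 ∷ []
det {suc n} M = sumFin λ j → scale (sign (toℕ j)) (M fzero j ⊛ det (λ i l → M (fsuc i) (punchIn j l)))
  where
  sumFin : ∀ {k} → (Fin k → Poly) → Poly
  sumFin {zero} f = []
  sumFin {suc k} f = f fzero ⊕ sumFin (λ i → f (fsuc i))

b2ℕ : Bool → ℕ
b2ℕ true = 1
b2ℕ false = 0

sumℕ : ∀ {k} → (Fin k → ℕ) → ℕ
sumℕ {zero} f = 0
sumℕ {suc k} f = f fzero ℕ.+ sumℕ (λ i → f (fsuc i))

degree : ∀ {n} → Adj n → Fin n → ℕ
degree G u = sumℕ (λ v → b2ℕ (G u v))

xI-Q : ∀ {n} → Adj n → Fin n → Fin n → Poly
xI-Q G i j =
  if toℕ i ≡ᵇ toℕ j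
  then (- (+ degree G i)) ∷ + 1 ∷ []
  else (- (+ b2ℕ (G i j))) ∷ []

charPolyQ : ∀ {n} → Adj n → Poly
charPolyQ G = det (xI-Q G)

-- det(xI - Q(G)) = Σᵢ (-1)^i φᵢ(G) x^(n-i)
φ : ∀ {n} → Adj n → ℕ → ℤ
φ {n} G i = sign i ℤ.* coeff (charPolyQ G) (n ℕ.∸ i)

-- The graphs G_g(s₁,t₁; …; s_g,t_g).
-- Vertices are labelled by naturals: the cycle is 0,1,…,g-1 (u_j = j-1);
-- then, for j = 1..g in order, s_j pendent paths u_j–a–b (a, b fresh)
-- and t_j pendent edges u_j–c (c fresh), fresh labels taken consecutively
-- from g upwards.  The total number of vertices is g + Σ (2 s_j + t_j).

cycleEdges : ℕ → List (ℕ × ℕ)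
cycleEdges g = go g
  where
  go : ℕ → List (ℕ × ℕ)
  go zero = []
  go (suc zero) = (0 , ℕ.pred g) ∷ []
  go (suc (suc k)) = (suc k , k) ∷ go (suc k)

paths2 : ℕ → ℕ → ℕ → List (ℕ × ℕ) × ℕ
paths2 r zero nxt = [] , nxt
paths2 r (suc s) nxt with paths2 r s (suc (suc nxt))
... | es , nxt' = (r , nxt) ∷ (nxt , suc nxt) ∷ es , nxt'

edges1 : ℕ → ℕ → ℕ → List (ℕ × ℕ) × ℕ
edges1 r zero nxt = [] , nxt
edges1 r (suc t) nxt with edges1 r t (suc nxt)
... | es , nxt' = (r , nxt) ∷ es , nxt'

attach : ℕ → List (ℕ × ℕ) → ℕ → List (ℕ × ℕ)
attach r [] nxt = []
attach r ((s , t) ∷ rest) nxt with paths2 r s nxt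
... | es₁ , nxt₁ with edges1 r t nxt₁
...   | es₂ , nxt₂ = es₁ ++ es₂ ++ attach (suc r) rest nxt₂

Gedges : (g : ℕ) → List (ℕ × ℕ) → List (ℕ × ℕ)
Gedges g st = cycleEdges g ++ attach 0 st g

memEdge : ℕ → ℕ → List (ℕ × ℕ) → Bool
memEdge a b [] = false
memEdge a b ((x , y) ∷ es) =
  ((a ≡ᵇ x) ∧ (b ≡ᵇ y)) ∨ ((a ≡ᵇ y) ∧ (b ≡ᵇ x)) ∨ memEdge a b es

-- G_g(s₁,t₁;…;s_g,t_g) on vertex set Fin n, where st = (s₁,t₁) ∷ … ∷ (s_g,t_g) ∷ []
-- (intended for n = g + Σ (2 s_j + t_j))
G-graph : (n g : ℕ) → List (ℕ × ℕ) → Adj n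
G-graph n g st u v = memEdge (toℕ u) (toℕ v) (Gedges g st)

G31 : (n m : ℕ) → Adj n
G31 n m = G-graph n 3 ((0 , 0) ∷ (0 , 0) ∷ (m ℕ.∸ 2 , (n ℕ.∸ 2 ℕ.* m) ℕ.+ 1) ∷ [])

G32 : (n m : ℕ) → Adj n
G32 n m = G-graph n 3 ((0 , 1) ∷ (0 , 1) ∷ (m ℕ.∸ 3 , (n ℕ.∸ 2 ℕ.* m) ℕ.+ 1) ∷ [])

CoeffGE : ∀ {n} → Adj n → Adj n → Set
CoeffGE {n} G H = ∀ i → i ≤ n → φ H i ℤ.≤ φ G i

{-# OPTIONS --safe #-}
-- Put y = −x, so that (−1)ⁿ det(xI − Q(G)) = det(yI + Q(G)) has nonnegative
-- coefficients φᵢ(G); "p ≽ q" means that p − q has nonnegative coefficients in y.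
-- A pendent vertex can be eliminated from the determinant, so each vertex
-- carries a pair (F , C) recording the trees already removed below it, and at
-- the end only the odd cycle is left.  Its determinant is tr ∏ M + 2 ∏ F for
-- nonnegative 2×2 matrices M depending on the pairs at the vertices.
--
-- During the elimination a matching is built greedily, together with a vertex
-- cover of the same size.  Around the cycle every vertex is then "joined"
-- (matched into its tree) or "free", and free vertices are paired with a
-- neighbour as far as possible.  Moving a pair, or a joined vertex, off the
-- cycle and hanging it as a pendent path of length 2 at a joined vertex does
-- not increase the determinant as long as enough of the cycle remains.  What
-- is left is a triangle with at most one joined vertex, or with three, and
-- moving all trees to one vertex and flattening them gives G₃¹ or G₃².
--
-- The two candidates differ by y((y+2)²F − (y²+3y+1)C): its linear coefficient
-- is 4, while at y = 3 it is negative once n − m > 3.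
module Submission where

open import Data.Bool using (Bool; true; false; if_then_else_; _∧_; _∨_)
open import Data.Bool.Properties using (∨-comm; ∨-assoc; ∧-comm)
open import Data.Fin using (Fin; toℕ; punchIn; fromℕ) renaming (zero to fzero; suc to fsuc)
open import Data.List using (List; []; _∷_; _++_; length; map; [_]; tabulate; lookup; allFin)
open import Data.List.Properties using (++-assoc; ++-identityʳ; map-++; length-++; length-tabulate; length-map; map-∘; map-cong-local)
open import Data.List.Membership.Propositional using (_∈_)
open import Data.List.Membership.Propositional.Properties using (∈-tabulate⁺; ∈-∃++; ∈-lookup; ∈-allFin; ∈-++⁺ˡ; ∈-++⁺ʳ)
open import Data.List.Relation.Unary.Any using (here; there; any?)
open import Data.List.Relation.Unary.All as All using (All; []; _∷_)
open import Data.List.Relation.Unary.AllPairs using ([]; _∷_)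
open import Data.List.Relation.Unary.Unique.Propositional using (Unique)
open import Data.List.Relation.Binary.Pointwise using (Pointwise; []; _∷_)
open import Data.Product using (_,_; _×_; proj₁; proj₂; ∃)
open import Data.Sum as Sum using (_⊎_; inj₁; inj₂)
open import Data.Empty using (⊥-elim; ⊥)
open import Data.Unit using (⊤)
open import Function using (_∘_)
open import Relation.Nullary using (yes; no; does; Dec; ¬_)
open import Relation.Binary.Definitions using (DecidableEquality)
open import Data.Nat.Solver using (module +-*-Solver)
open import Level using (0ℓ)
open import Data.Nat as ℕ using (ℕ; zero; suc; z≤n; s≤s; _≤_; _<_)
import Data.Nat.Properties as ℕₚ
import Data.Integer.Properties as ℤₚ
import Data.Fin.Properties as Finₚ
import Data.List.Relation.Unary.All.Properties as Allₚ
import Data.List.Relation.Binary.Permutation.Propositional.Properties as Perm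
open +-*-Solver using () renaming (solve to solveℕ; _:+_ to _⊹_; _:*_ to _⋆_; con to #_; _:=_ to _≐_)

-- Every inequality a ≽ b is proved by an identity that writes a - b as a sum of products of
-- elements already known to be nonnegative. Side conditions such as `V ≽ X`, `N (L c)` or a lower
-- bound on an entry of `Π` are present because these differences occur as factors in such an
-- identity.
--
-- The obstacle is that shortening the cycle is monotone only while the remaining part is heavy
-- enough: any two vertices suffice when a pair leaves, but the bound used for a joined vertex takes
-- two other joined ones. So a reduction with several joined vertices stops at three, and one with a
-- single joined vertex at a triangle with two bare vertices; these are the shapes of G₃² and G₃¹.
-- Two joined vertices would fit neither ending, and are excluded by parity: the vertices outside
-- the pairs are odd in number because the cycle is odd.
--
-- The cover bounds every matching by the number of edges counted. If no vertex of the cycle is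
-- joined, the cycle has to count at half weight, as an odd cycle has no vertex cover as small as
-- its matching number.

module PolynomialRing where
  open import Defs
  open import Algebra.Bundles using (CommutativeRing; RawRing)
  open import Algebra.Solver.Ring.AlmostCommutativeRing using (fromCommutativeRing; _-Raw-AlmostCommutative⟶_)
  open import Data.Integer as ℤ using (ℤ; +_; -_; +≤+)
  import Data.Integer.Solver as ℤS
  open import Relation.Binary.PropositionalEquality using (_≡_; refl; sym; trans; cong; cong₂; subst; module ≡-Reasoning)

  -- The commutative ring of coefficient lists, and positivity in the variable -x

  infix 4 _≋_
  -- Lists may end in zeros, so equality is taken coefficientwise. As a record it lets `p` and `q`
  -- be inferred from a proof.
  record _≋_ (p q : Poly) : Set where
    constructor mk
    field at : ∀ k → coeff p k ≡ coeff q k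
  open _≋_ public

  coeff-⊕ : ∀ p q k → coeff (p ⊕ q) k ≡ coeff p k ℤ.+ coeff q k
  coeff-⊕ [] q k = sym (ℤₚ.+-identityˡ _)
  coeff-⊕ (a ∷ p) [] k = sym (ℤₚ.+-identityʳ _)
  coeff-⊕ (a ∷ p) (b ∷ q) zero = refl
  coeff-⊕ (a ∷ p) (b ∷ q) (suc k) = coeff-⊕ p q k

  coeff-scale : ∀ c p k → coeff (scale c p) k ≡ c ℤ.* coeff p k
  coeff-scale c [] k = sym (ℤₚ.*-zeroʳ c)
  coeff-scale c (a ∷ p) zero = refl
  coeff-scale c (a ∷ p) (suc k) = coeff-scale c p k

  negate : Poly → Poly
  negate = scale (ℤ.-1ℤ)

  coeff-negate : ∀ p k → coeff (negate p) k ≡ - coeff p k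
  coeff-negate p k = trans (coeff-scale ℤ.-1ℤ p k) (ℤₚ.-1*i≡-i _)

  ≋-refl : ∀ {p} → p ≋ p
  ≋-refl = mk λ _ → refl

  ≋-sym : ∀ {p q} → p ≋ q → q ≋ p
  ≋-sym e = mk λ k → sym (at e k)

  ≋-trans : ∀ {p q r} → p ≋ q → q ≋ r → p ≋ r
  ≋-trans e f = mk λ k → trans (at e k) (at f k)

  ⊕-cong : ∀ {p p' q q'} → p ≋ p' → q ≋ q' → p ⊕ q ≋ p' ⊕ q'
  ⊕-cong {p} {p'} {q} {q'} e f = mk λ k →
    trans (coeff-⊕ p q k) (trans (cong₂ ℤ._+_ (at e k) (at f k)) (sym (coeff-⊕ p' q' k)))

  ⊕-assoc : ∀ p q r → (p ⊕ q) ⊕ r ≋ p ⊕ (q ⊕ r)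
  ⊕-assoc p q r = mk λ k → begin
    coeff ((p ⊕ q) ⊕ r) k                       ≡⟨ coeff-⊕ (p ⊕ q) r k ⟩
    coeff (p ⊕ q) k ℤ.+ coeff r k               ≡⟨ cong (ℤ._+ coeff r k) (coeff-⊕ p q k) ⟩
    coeff p k ℤ.+ coeff q k ℤ.+ coeff r k       ≡⟨ ℤₚ.+-assoc (coeff p k) _ _ ⟩
    coeff p k ℤ.+ (coeff q k ℤ.+ coeff r k)     ≡⟨ cong (ℤ._+_ (coeff p k)) (coeff-⊕ q r k) ⟨
    coeff p k ℤ.+ coeff (q ⊕ r) k               ≡⟨ coeff-⊕ p (q ⊕ r) k ⟨
    coeff (p ⊕ (q ⊕ r)) k                       ∎
    where open ≡-Reasoning

  ⊕-comm : ∀ p q → p ⊕ q ≋ q ⊕ p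
  ⊕-comm p q = mk λ k → trans (coeff-⊕ p q k) (trans (ℤₚ.+-comm (coeff p k) _) (sym (coeff-⊕ q p k)))

  ⊕-identityʳ : ∀ p → p ⊕ [] ≋ p
  ⊕-identityʳ p = mk λ k → trans (coeff-⊕ p [] k) (ℤₚ.+-identityʳ _)

  ⊕-inverseʳ : ∀ p → p ⊕ negate p ≋ []
  ⊕-inverseʳ p = mk λ k → trans (coeff-⊕ p (negate p) k)
    (trans (cong (ℤ._+_ (coeff p k)) (coeff-negate p k)) (ℤₚ.+-inverseʳ (coeff p k)))

  ∷-cong : ∀ {a b p q} → a ≡ b → p ≋ q → a ∷ p ≋ b ∷ q
  ∷-cong {a} {b} {p} {q} e f = mk go
    where
    go : ∀ k → coeff (a ∷ p) k ≡ coeff (b ∷ q) k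
    go zero = e
    go (suc k) = at f k

  0∷[]≋[] : + 0 ∷ [] ≋ []
  0∷[]≋[] = mk λ { zero → refl ; (suc k) → refl }

  scale-cong : ∀ c {p q} → p ≋ q → scale c p ≋ scale c q
  scale-cong c {p} {q} e = mk λ k →
    trans (coeff-scale c p k) (trans (cong (ℤ._*_ c) (at e k)) (sym (coeff-scale c q k)))

  scale-zero : ∀ p → scale (+ 0) p ≋ []
  scale-zero p = mk λ k → coeff-scale (+ 0) p k

  scale-one : ∀ p → scale (+ 1) p ≋ p
  scale-one p = mk λ k → trans (coeff-scale (+ 1) p k) (ℤₚ.*-identityˡ _)

  scale-⊕ : ∀ c p q → scale c (p ⊕ q) ≋ scale c p ⊕ scale c q
  scale-⊕ c p q = mk λ k → begin
    coeff (scale c (p ⊕ q)) k                        ≡⟨ coeff-scale c (p ⊕ q) k ⟩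
    c ℤ.* coeff (p ⊕ q) k                            ≡⟨ cong (ℤ._*_ c) (coeff-⊕ p q k) ⟩
    c ℤ.* (coeff p k ℤ.+ coeff q k)                  ≡⟨ ℤₚ.*-distribˡ-+ c _ _ ⟩
    c ℤ.* coeff p k ℤ.+ c ℤ.* coeff q k              ≡⟨ cong₂ ℤ._+_ (coeff-scale c p k) (coeff-scale c q k) ⟨
    coeff (scale c p) k ℤ.+ coeff (scale c q) k      ≡⟨ coeff-⊕ (scale c p) _ k ⟨
    coeff (scale c p ⊕ scale c q) k                  ∎
    where open ≡-Reasoning

  scale-+ : ∀ c d p → scale (c ℤ.+ d) p ≋ scale c p ⊕ scale d p
  scale-+ c d p = mk λ k → begin
    coeff (scale (c ℤ.+ d) p) k                      ≡⟨ coeff-scale (c ℤ.+ d) p k ⟩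
    (c ℤ.+ d) ℤ.* coeff p k                          ≡⟨ ℤₚ.*-distribʳ-+ (coeff p k) c d ⟩
    c ℤ.* coeff p k ℤ.+ d ℤ.* coeff p k              ≡⟨ cong₂ ℤ._+_ (coeff-scale c p k) (coeff-scale d p k) ⟨
    coeff (scale c p) k ℤ.+ coeff (scale d p) k      ≡⟨ coeff-⊕ (scale c p) _ k ⟨
    coeff (scale c p ⊕ scale d p) k                  ∎
    where open ≡-Reasoning

  scale-scale : ∀ c d p → scale c (scale d p) ≋ scale (c ℤ.* d) p
  scale-scale c d p = mk λ k → begin
    coeff (scale c (scale d p)) k    ≡⟨ coeff-scale c (scale d p) k ⟩
    c ℤ.* coeff (scale d p) k        ≡⟨ cong (ℤ._*_ c) (coeff-scale d p k) ⟩
    c ℤ.* (d ℤ.* coeff p k)          ≡⟨ ℤₚ.*-assoc c d _ ⟨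
    c ℤ.* d ℤ.* coeff p k            ≡⟨ coeff-scale (c ℤ.* d) p k ⟨
    coeff (scale (c ℤ.* d) p) k      ∎
    where open ≡-Reasoning

  ⊕-interchange : ∀ p q r s → (p ⊕ q) ⊕ (r ⊕ s) ≋ (p ⊕ r) ⊕ (q ⊕ s)
  ⊕-interchange p q r s = mk λ k → begin
    coeff ((p ⊕ q) ⊕ (r ⊕ s)) k ≡⟨ coeff-⊕ (p ⊕ q) _ k ⟩
    coeff (p ⊕ q) k ℤ.+ coeff (r ⊕ s) k ≡⟨ cong₂ ℤ._+_ (coeff-⊕ p q k) (coeff-⊕ r s k) ⟩
    (coeff p k ℤ.+ coeff q k) ℤ.+ (coeff r k ℤ.+ coeff s k)
      ≡⟨ solve 4 (λ a b c d → (a :+ b) :+ (c :+ d) := (a :+ c) :+ (b :+ d)) refl (coeff p k) (coeff q k) (coeff r k) (coeff s k) ⟩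
    (coeff p k ℤ.+ coeff r k) ℤ.+ (coeff q k ℤ.+ coeff s k) ≡⟨ cong₂ ℤ._+_ (coeff-⊕ p r k) (coeff-⊕ q s k) ⟨
    coeff (p ⊕ r) k ℤ.+ coeff (q ⊕ s) k ≡⟨ coeff-⊕ (p ⊕ r) _ k ⟨
    coeff ((p ⊕ r) ⊕ (q ⊕ s)) k ∎
    where
    open ≡-Reasoning
    open ℤS.+-*-Solver

  ⊛-congʳ : ∀ p {q q'} → q ≋ q' → p ⊛ q ≋ p ⊛ q'
  ⊛-congʳ [] e = ≋-refl
  ⊛-congʳ (a ∷ p) e = ⊕-cong (scale-cong a e) (∷-cong refl (⊛-congʳ p e))

  ⊛-[] : ∀ p → p ⊛ [] ≋ []
  ⊛-[] [] = ≋-refl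
  ⊛-[] (a ∷ p) = ≋-trans (∷-cong refl (⊛-[] p)) 0∷[]≋[]

  -- Multiplication recurses on its left factor only; unfolding the right one as well makes
  -- commutativity an induction.
  ⊛-∷ : ∀ p b q → p ⊛ (b ∷ q) ≋ scale b p ⊕ (+ 0 ∷ (p ⊛ q))
  ⊛-∷ [] b q = ≋-sym 0∷[]≋[]
  ⊛-∷ (a ∷ p) b q = ∷-cong (cong (ℤ._+ + 0) (ℤₚ.*-comm a b))
    (≋-trans (⊕-cong ≋-refl (⊛-∷ p b q))
    (≋-trans (≋-sym (⊕-assoc (scale a q) (scale b p) _))
    (≋-trans (⊕-cong (⊕-comm (scale a q) (scale b p)) ≋-refl)
             (⊕-assoc (scale b p) (scale a q) _))))

  ⊛-comm : ∀ p q → p ⊛ q ≋ q ⊛ p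
  ⊛-comm [] q = ≋-sym (⊛-[] q)
  ⊛-comm (a ∷ p) q = ≋-trans (⊕-cong ≋-refl (∷-cong refl (⊛-comm p q))) (≋-sym (⊛-∷ q a p))

  ⊛-cong : ∀ {p p' q q'} → p ≋ p' → q ≋ q' → p ⊛ q ≋ p' ⊛ q'
  ⊛-cong {p} {p'} {q} {q'} e f =
    ≋-trans (⊛-congʳ p f) (≋-trans (⊛-comm p q') (≋-trans (⊛-congʳ q' e) (⊛-comm q' p')))

  ⊛-distribʳ : ∀ r p q → (p ⊕ q) ⊛ r ≋ (p ⊛ r) ⊕ (q ⊛ r)
  ⊛-distribʳ r [] q = ≋-refl
  ⊛-distribʳ r (a ∷ p) [] = ≋-sym (⊕-identityʳ _)
  ⊛-distribʳ r (a ∷ p) (b ∷ q) =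
    ≋-trans (⊕-cong (scale-+ a b r) (∷-cong refl (⊛-distribʳ r p q)))
            (⊕-interchange (scale a r) (scale b r) (+ 0 ∷ (p ⊛ r)) (+ 0 ∷ (q ⊛ r)))

  ⊛-distribˡ : ∀ r p q → r ⊛ (p ⊕ q) ≋ (r ⊛ p) ⊕ (r ⊛ q)
  ⊛-distribˡ r p q = ≋-trans (⊛-comm r (p ⊕ q))
    (≋-trans (⊛-distribʳ r p q) (⊕-cong (⊛-comm p r) (⊛-comm q r)))

  scale-⊛ : ∀ c p q → scale c p ⊛ q ≋ scale c (p ⊛ q)
  scale-⊛ c [] q = ≋-refl
  scale-⊛ c (a ∷ p) q =
    ≋-trans (⊕-cong (≋-sym (scale-scale c a q)) (∷-cong (sym (ℤₚ.*-zeroʳ c)) (scale-⊛ c p q)))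
            (≋-sym (scale-⊕ c (scale a q) (+ 0 ∷ (p ⊛ q))))

  0∷-⊛ : ∀ p q → (+ 0 ∷ p) ⊛ q ≋ + 0 ∷ (p ⊛ q)
  0∷-⊛ p q = ⊕-cong (scale-zero q) ≋-refl

  ⊛-assoc : ∀ p q r → (p ⊛ q) ⊛ r ≋ p ⊛ (q ⊛ r)
  ⊛-assoc [] q r = ≋-refl
  ⊛-assoc (a ∷ p) q r =
    ≋-trans (⊛-distribʳ r (scale a q) (+ 0 ∷ (p ⊛ q)))
    (⊕-cong (scale-⊛ a q r) (≋-trans (0∷-⊛ (p ⊛ q) r) (∷-cong refl (⊛-assoc p q r))))

  const : ℤ → Poly
  const c = c ∷ []

  const-⊛ : ∀ c p → const c ⊛ p ≋ scale c p
  const-⊛ c p = ≋-trans (⊕-cong ≋-refl 0∷[]≋[]) (⊕-identityʳ _)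

  ⊛-identityˡ : ∀ p → const (+ 1) ⊛ p ≋ p
  ⊛-identityˡ p = ≋-trans (const-⊛ (+ 1) p) (scale-one p)

  PolyRing : CommutativeRing 0ℓ 0ℓ
  PolyRing = record
    { Carrier = Poly ; _≈_ = _≋_ ; _+_ = _⊕_ ; _*_ = _⊛_ ; -_ = negate ; 0# = [] ; 1# = const (+ 1)
    ; isCommutativeRing = record
      { isRing = record
        { +-isAbelianGroup = record
          { isGroup = record
            { isMonoid = record
              { isSemigroup = record
                { isMagma = record
                  { isEquivalence = record { refl = ≋-refl ; sym = ≋-sym ; trans = ≋-trans }
                  ; ∙-cong = ⊕-cong }
                ; assoc = ⊕-assoc }
              ; identity = (λ p → ≋-refl) , ⊕-identityʳ }
            ; inverse = (λ p → ≋-trans (⊕-comm (negate p) p) (⊕-inverseʳ p)) , ⊕-inverseʳ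
            ; ⁻¹-cong = scale-cong ℤ.-1ℤ }
          ; comm = ⊕-comm }
        ; *-cong = ⊛-cong
        ; *-assoc = ⊛-assoc
        ; *-identity = ⊛-identityˡ , (λ p → ≋-trans (⊛-comm p _) (⊛-identityˡ p))
        ; distrib = ⊛-distribˡ , ⊛-distribʳ }
      ; *-comm = ⊛-comm } }

  ℤ-rawRing : RawRing 0ℓ 0ℓ
  ℤ-rawRing = record
    { Carrier = ℤ ; _≈_ = _≡_ ; _+_ = ℤ._+_ ; _*_ = ℤ._*_ ; -_ = ℤ.-_ ; 0# = + 0 ; 1# = + 1 }

  constHom : ℤ-rawRing -Raw-AlmostCommutative⟶ fromCommutativeRing PolyRing
  constHom = record
    { ⟦_⟧ = const
    ; +-homo = λ c d → ≋-refl
    ; *-homo = λ c d → ≋-sym (const-⊛ c (const d))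
    ; -‿homo = λ c → ∷-cong (sym (ℤₚ.-1*i≡-i c)) ≋-refl
    ; 0-homo = 0∷[]≋[]
    ; 1-homo = ≋-refl }

  sign-+ : ∀ k l → sign (k ℕ.+ l) ≡ sign k ℤ.* sign l
  sign-+ zero l = sym (ℤₚ.*-identityˡ (sign l))
  sign-+ (suc k) l = trans (cong -_ (sign-+ k l)) (ℤₚ.neg-distribˡ-* (sign k) (sign l))

  -- For `e` = 0 these are the polynomials with nonnegative coefficients in -x. The offset `e` only
  -- matters through its parity; it makes the tail of a list again of this form.
  SignNonneg : ℕ → Poly → Set
  SignNonneg e p = ∀ k → + 0 ℤ.≤ sign (e ℕ.+ k) ℤ.* coeff p k

  SignNonneg-resp : ∀ e {p q} → p ≋ q → SignNonneg e p → SignNonneg e q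
  SignNonneg-resp e eq np k = subst (λ c → + 0 ℤ.≤ sign (e ℕ.+ k) ℤ.* c) (at eq k) (np k)

  0≤-+ : ∀ {i j} → + 0 ℤ.≤ i → + 0 ℤ.≤ j → + 0 ℤ.≤ i ℤ.+ j
  0≤-+ = ℤₚ.+-mono-≤

  0≤-* : ∀ {i j} → + 0 ℤ.≤ i → + 0 ℤ.≤ j → + 0 ℤ.≤ i ℤ.* j
  0≤-* {+ m} {+ n} _ _ = subst (+ 0 ℤ.≤_) (ℤₚ.pos-* m n) (+≤+ ℕ.z≤n)

  SignNonneg-⊕ : ∀ e p q → SignNonneg e p → SignNonneg e q → SignNonneg e (p ⊕ q)
  SignNonneg-⊕ e p q np nq k = subst (+ 0 ℤ.≤_)
    (sym (trans (cong (ℤ._*_ (sign (e ℕ.+ k))) (coeff-⊕ p q k)) (ℤₚ.*-distribˡ-+ (sign (e ℕ.+ k)) _ _)))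
    (0≤-+ (np k) (nq k))

  SignNonneg-0∷ : ∀ e p → SignNonneg (suc e) p → SignNonneg e (+ 0 ∷ p)
  SignNonneg-0∷ e p np zero = subst (+ 0 ℤ.≤_) (sym (ℤₚ.*-zeroʳ (sign (e ℕ.+ 0)))) ℤₚ.≤-refl
  SignNonneg-0∷ e p np (suc k) = subst (λ i → + 0 ℤ.≤ sign i ℤ.* coeff p k) (sym (ℕₚ.+-suc e k)) (np k)

  SignNonneg-⊛ : ∀ e e' p q → SignNonneg e p → SignNonneg e' q → SignNonneg (e ℕ.+ e') (p ⊛ q)
  SignNonneg-⊛ e e' [] q np nq k = subst (+ 0 ℤ.≤_) (sym (ℤₚ.*-zeroʳ (sign (e ℕ.+ e' ℕ.+ k)))) ℤₚ.≤-refl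
  SignNonneg-⊛ e e' (a ∷ p) q np nq = SignNonneg-⊕ (e ℕ.+ e') (scale a q) _ head
    (SignNonneg-0∷ (e ℕ.+ e') (p ⊛ q) (SignNonneg-⊛ (suc e) e' p q tail nq))
    where
    open ℤS.+-*-Solver
    tail : SignNonneg (suc e) p
    tail k = subst (λ i → + 0 ℤ.≤ sign i ℤ.* coeff p k) (ℕₚ.+-suc e k) (np (suc k))
    head : SignNonneg (e ℕ.+ e') (scale a q)
    head k = subst (+ 0 ℤ.≤_) eq (0≤-* (np 0) (nq k))
      where
      open ≡-Reasoning
      eq : sign (e ℕ.+ 0) ℤ.* a ℤ.* (sign (e' ℕ.+ k) ℤ.* coeff q k) ≡ sign (e ℕ.+ e' ℕ.+ k) ℤ.* coeff (scale a q) k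
      eq = begin
        sign (e ℕ.+ 0) ℤ.* a ℤ.* (sign (e' ℕ.+ k) ℤ.* coeff q k)
          ≡⟨ cong (λ i → sign i ℤ.* a ℤ.* (sign (e' ℕ.+ k) ℤ.* coeff q k)) (ℕₚ.+-identityʳ e) ⟩
        sign e ℤ.* a ℤ.* (sign (e' ℕ.+ k) ℤ.* coeff q k)
          ≡⟨ solve 4 (λ s t a c → s :* a :* (t :* c) := s :* t :* (a :* c)) refl (sign e) (sign (e' ℕ.+ k)) a (coeff q k) ⟩
        sign e ℤ.* sign (e' ℕ.+ k) ℤ.* (a ℤ.* coeff q k)
          ≡⟨ cong₂ ℤ._*_ (trans (sym (sign-+ e (e' ℕ.+ k))) (cong sign (sym (ℕₚ.+-assoc e e' k)))) (sym (coeff-scale a q k)) ⟩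
        sign (e ℕ.+ e' ℕ.+ k) ℤ.* coeff (scale a q) k ∎

-- Positive cones, and hanging trees as dual numbers

module Cones where
  open import Algebra.Bundles using (CommutativeRing)
  open import Algebra.Solver.Ring.AlmostCommutativeRing using (fromCommutativeRing; _-Raw-AlmostCommutative⟶_)
  import Algebra.Solver.Ring as RingSolver
  open import Data.Integer as ℤ using (ℤ; +_)
  open import Data.Maybe using (Maybe; just; nothing)
  open import Relation.Binary.PropositionalEquality as ≡ using (_≡_)
  open PolynomialRing using (ℤ-rawRing)

  -- What the comparisons use of the polynomials with nonnegative coefficients in y. With an
  -- abstract carrier the solver never meets coefficient lists; integer constants enter through
  -- `hom`.
  record Cone : Set₁ where
    field
      ring   : CommutativeRing 0ℓ 0ℓ
      hom    : ℤ-rawRing -Raw-AlmostCommutative⟶ fromCommutativeRing ring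
    open CommutativeRing ring using (Carrier; _≈_; _+_; _*_)
    open _-Raw-AlmostCommutative⟶_ hom using (⟦_⟧)
    field
      N      : Carrier → Set
      N-resp : ∀ {a b} → a ≈ b → N a → N b
      N-+    : ∀ {a b} → N a → N b → N (a + b)
      N-*    : ∀ {a b} → N a → N b → N (a * b)
      N-κ    : ∀ n → N ⟦ + n ⟧
      y      : Carrier
      N-y    : N y

  module Solver (R : CommutativeRing 0ℓ 0ℓ) (h : ℤ-rawRing -Raw-AlmostCommutative⟶ fromCommutativeRing R) where
    open CommutativeRing R using (_≈_; reflexive)
    open _-Raw-AlmostCommutative⟶_ h using (⟦_⟧)
    coeff≟ : ∀ c d → Maybe (⟦ c ⟧ ≈ ⟦ d ⟧)
    coeff≟ c d with c ℤ.≟ d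
    ... | yes e = just (reflexive (≡.cong ⟦_⟧ e))
    ... | no _  = nothing
    open RingSolver ℤ-rawRing (fromCommutativeRing R) h coeff≟ using (Polynomial; con; _:+_; _:*_; _:-_; :-_; solve; _:=_) public

  module Core (S : Cone) where
    open Cone S public
    open CommutativeRing ring hiding (zero; ring) public
    open Solver ring hom public
    open _-Raw-AlmostCommutative⟶_ hom using (0-homo; -‿homo) renaming (⟦_⟧ to embed) public

    κ : ℕ → Carrier
    κ n = embed (+ n)

    k : ∀ {n} → ℕ → Polynomial n
    k c = con (+ c)

    infix 4 _≽_
    _≽_ : Carrier → Carrier → Set
    a ≽ b = N (a - b)

    ≽-refl : ∀ {a b} → a ≈ b → a ≽ b
    ≽-refl {a} {b} e = N-resp (trans 0-homo (trans (sym (-‿inverseʳ b)) (+-congʳ (sym e)))) (N-κ 0)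

    ≽-trans : ∀ {a b c} → a ≽ b → b ≽ c → a ≽ c
    ≽-trans {a} {b} {c} p q = N-resp (solve 3 (λ a b c → (a :- b) :+ (b :- c) := a :- c) refl a b c) (N-+ p q)

    ≽-respˡ : ∀ {a b c} → a ≈ b → b ≽ c → a ≽ c
    ≽-respˡ e = ≽-trans (≽-refl e)

    ≽-respʳ : ∀ {a b c} → a ≽ b → b ≈ c → a ≽ c
    ≽-respʳ p e = ≽-trans p (≽-refl e)

    ≽-N : ∀ {a b} → N b → a ≽ b → N a
    ≽-N {a} {b} nb p = N-resp (solve 2 (λ a b → (a :- b) :+ b := a) refl a b) (N-+ p nb)

    infixl 5 _⊞_
    _⊞_ = N-+
    infixl 6 _⊠_
    _⊠_ = N-*

    Dual : Set
    Dual = Carrier × Carrier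

    ND : Dual → Set
    ND (F , C) = N F × N C

    infix 4 _≈₂_
    _≈₂_ : Dual → Dual → Set
    (F , C) ≈₂ (F' , C') = F ≈ F' × C ≈ C'

    infixr 7 _⊗_
    -- Multiplication of dual numbers F + Cε with ε² = 0: trees hanging at one vertex multiply their
    -- determinants and add their contributions C/F to its diagonal entry.
    _⊗_ : Dual → Dual → Dual
    (F , C) ⊗ (F' , C') = F * F' , F * C' + C * F'

    oneD leafD pathD : Dual
    oneD = κ 1 , κ 0
    leafD = κ 1 + y , y
    pathD = y * y + κ 3 * y + κ 1 , y * y + κ 2 * y

    -- A root with pair (F , C) and an edge upwards has determinant f = (1 + y)F + C; eliminating it
    -- adds 1 - F/f = (yF + C)/f to the entry above, where 1 is the degree of the edge.
    unD : Dual → Dual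
    unD (F , C) = (κ 1 + y) * F + C , y * F + C

    ≈₂-refl : ∀ {a} → a ≈₂ a
    ≈₂-refl = refl , refl

    ≈₂-sym : ∀ {a b} → a ≈₂ b → b ≈₂ a
    ≈₂-sym (e , f) = sym e , sym f

    ≈₂-trans : ∀ {a b c} → a ≈₂ b → b ≈₂ c → a ≈₂ c
    ≈₂-trans (e , f) (e' , f') = trans e e' , trans f f'

    ≈₂-reflexive : ∀ {a b} → a ≡ b → a ≈₂ b
    ≈₂-reflexive ≡.refl = ≈₂-refl

    ⊗-cong : ∀ {a a' b b'} → a ≈₂ a' → b ≈₂ b' → a ⊗ b ≈₂ a' ⊗ b'
    ⊗-cong (e , f) (e' , f') = *-cong e e' , +-cong (*-cong e f') (*-cong f e')

    unD-cong : ∀ {a a'} → a ≈₂ a' → unD a ≈₂ unD a'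
    unD-cong (e , f) = +-cong (*-congˡ e) f , +-cong (*-congˡ e) f

    unD-one : unD oneD ≈₂ leafD
    unD-one = solve 1 (λ y → (k 1 :+ y) :* k 1 :+ k 0 := k 1 :+ y) refl y , solve 1 (λ y → y :* k 1 :+ k 0 := y) refl y

    unD-leaf : unD leafD ≈₂ pathD
    unD-leaf = solve 1 (λ y → (k 1 :+ y) :* (k 1 :+ y) :+ y := y :* y :+ k 3 :* y :+ k 1) refl y ,
      solve 1 (λ y → y :* (k 1 :+ y) :+ y := y :* y :+ k 2 :* y) refl y

    ⊗-assoc : ∀ a b c → (a ⊗ b) ⊗ c ≈₂ a ⊗ (b ⊗ c)
    ⊗-assoc (F , C) (F' , C') (F″ , C″) = *-assoc F F' F″ ,
      solve 6 (λ F C F' C' F″ C″ → (F :* F') :* C″ :+ (F :* C' :+ C :* F') :* F″ := F :* (F' :* C″ :+ C' :* F″) :+ C :* (F' :* F″)) refl F C F' C' F″ C″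

    ⊗-comm : ∀ a b → a ⊗ b ≈₂ b ⊗ a
    ⊗-comm (F , C) (F' , C') = *-comm F F' ,
      solve 4 (λ F C F' C' → F :* C' :+ C :* F' := F' :* C :+ C' :* F) refl F C F' C'

    ⊗-swap : ∀ a b c → a ⊗ (b ⊗ c) ≈₂ b ⊗ (a ⊗ c)
    ⊗-swap a b c = ≈₂-trans (≈₂-sym (⊗-assoc a b c)) (≈₂-trans (⊗-cong (⊗-comm a b) ≈₂-refl) (⊗-assoc b a c))

    ⊗-identityˡ : ∀ a → oneD ⊗ a ≈₂ a
    ⊗-identityˡ (F , C) = solve 1 (λ F → k 1 :* F := F) refl F ,
      solve 2 (λ F C → k 1 :* C :+ k 0 :* F := C) refl F C

    ⊗-identityʳ : ∀ a → a ⊗ oneD ≈₂ a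
    ⊗-identityʳ a = ≈₂-trans (⊗-comm a oneD) (⊗-identityˡ a)

    Nα : N (κ 1 + y)
    Nα = N-κ 1 ⊞ N-y

    N-one : ND oneD
    N-one = N-κ 1 , N-κ 0

    N-leaf : ND leafD
    N-leaf = Nα , N-y

    N-path : ND pathD
    N-path = ((N-y ⊠ N-y) ⊞ N-κ 3 ⊠ N-y) ⊞ N-κ 1 , N-y ⊠ N-y ⊞ N-κ 2 ⊠ N-y

    N-⊗ : ∀ {a b} → ND a → ND b → ND (a ⊗ b)
    N-⊗ (nF , nC) (nF' , nC') = nF ⊠ nF' , nF ⊠ nC' ⊞ nC ⊠ nF'

    N-un : ∀ {a} → ND a → ND (unD a)
    N-un (nF , nC) = (Nα ⊠ nF) ⊞ nC , (N-y ⊠ nF) ⊞ nC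

    -- The pair of a vertex with s pendent paths of length 2 and t pendent edges.
    Fl : ℕ → ℕ → Dual
    Fl zero zero = oneD
    Fl zero (suc t) = leafD ⊗ Fl zero t
    Fl (suc s) t = pathD ⊗ Fl s t

    Fl-leaf : ∀ s t → Fl s (suc t) ≈₂ leafD ⊗ Fl s t
    Fl-leaf zero t = ≈₂-refl
    Fl-leaf (suc s) t = ≈₂-trans (⊗-cong ≈₂-refl (Fl-leaf s t)) (⊗-swap pathD leafD (Fl s t))

    Fl-+ : ∀ s t s' t' → Fl s t ⊗ Fl s' t' ≈₂ Fl (s ℕ.+ s') (t ℕ.+ t')
    Fl-+ zero zero s' t' = ⊗-identityˡ _
    Fl-+ zero (suc t) s' t' = ≈₂-trans (⊗-assoc leafD (Fl 0 t) _)
      (≈₂-trans (⊗-cong ≈₂-refl (Fl-+ zero t s' t')) (≈₂-sym (Fl-leaf s' (t ℕ.+ t'))))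
    Fl-+ (suc s) t s' t' = ≈₂-trans (⊗-assoc pathD (Fl s t) _) (⊗-cong ≈₂-refl (Fl-+ s t s' t'))

    N-Fl : ∀ s t → ND (Fl s t)
    N-Fl zero zero = N-one
    N-Fl zero (suc t) = N-⊗ {leafD} {Fl 0 t} N-leaf (N-Fl zero t)
    N-Fl (suc s) t = N-⊗ {pathD} {Fl s t} N-path (N-Fl s t)

    -- A determinant is linear in the pair (F , C) at one vertex: X is the minor without this
    -- vertex, and yX + V the value when nothing hangs there.
    val : Carrier → Carrier → Dual → Carrier
    val X V (F , C) = F * (y * X + V) + C * X

    val-cong : ∀ X V {a b} → a ≈₂ b → val X V a ≈ val X V b
    val-cong X V (e , f) = +-cong (*-congʳ e) (*-congʳ f)

    val-⊗ : ∀ X V a b → val X V (a ⊗ b) ≈ val (X * proj₁ a) (V * proj₁ a + X * proj₂ a) b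
    val-⊗ X V (F , C) (F' , C') = solve 7 (λ X V F C F' C' y →
      (F :* F') :* (y :* X :+ V) :+ (F :* C' :+ C :* F') :* X
      := F' :* (y :* (X :* F) :+ (V :* F :+ X :* C)) :+ C' :* (X :* F)) refl X V F C F' C' y

    -- Quantifying over X and V covers all surroundings of the vertex at once, which makes the
    -- relation stable under hanging further trees.
    Flattens : Dual → Dual → Set
    Flattens a b = ∀ X V → N X → V ≽ X → val X V a ≽ val X V b

    -- Trees `a` at the same vertex count as surroundings: by `val-⊗` they turn X into XF and V into
    -- VF + XC, so V - X becomes (V - X)F + XC.
    flattens-⊗ʳ : ∀ a {b b'} → ND a → Flattens b b' → Flattens (a ⊗ b) (a ⊗ b')
    flattens-⊗ʳ a@(F , C) {b} {b'} (nF , nC) fl X V nX VX =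
      ≽-respˡ (val-⊗ X V a b) (≽-respʳ (fl _ _ (nX ⊠ nF)
        (N-resp (solve 4 (λ X V F C → (V :- X) :* F :+ X :* C := (V :* F :+ X :* C) :- X :* F) refl X V F C)
          (VX ⊠ nF ⊞ nX ⊠ nC)))
        (sym (val-⊗ X V a b')))

    flattens-trans : ∀ {a b c} → Flattens a b → Flattens b c → Flattens a c
    flattens-trans f g X V nX VX = ≽-trans (f X V nX VX) (g X V nX VX)

    flattens-≈ : ∀ {a b} → a ≈₂ b → Flattens a b
    flattens-≈ e X V _ _ = ≽-refl (val-cong X V e)

    -- Trees T₁,…,T_r hanging at a vertex v, with s disjoint edges chosen in
    -- them and t vertices left over.  With fᵢ = det(y + Q) of Tᵢ, the edge to v
    -- counted in the degree of the root, dual is (∏ fᵢ , C), where C / ∏ fᵢ is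
    -- what eliminating the trees adds to the diagonal entry y of v.
    record Bundle : Set where
      field
        dual    : Dual
        nonneg  : ND dual
        s t     : ℕ
        flatten : Flattens dual (Fl s t)
    open Bundle public

    emptyB leafB pathB : Bundle
    emptyB = record { dual = oneD ; nonneg = N-one ; s = 0 ; t = 0 ; flatten = flattens-≈ ≈₂-refl }
    leafB = record { dual = leafD ; nonneg = N-leaf ; s = 0 ; t = 1 ; flatten = flattens-≈ (≈₂-sym (⊗-identityʳ leafD)) }
    pathB = record { dual = pathD ; nonneg = N-path ; s = 1 ; t = 0 ; flatten = flattens-≈ (≈₂-sym (⊗-identityʳ pathD)) }

    infixr 7 _⊗B_
    _⊗B_ : Bundle → Bundle → Bundle
    a ⊗B b = record
      { dual = dual a ⊗ dual b
      ; nonneg = N-⊗ {dual a} {dual b} (nonneg a) (nonneg b)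
      ; s = s a ℕ.+ s b ; t = t a ℕ.+ t b
      ; flatten = flattens-trans (flattens-⊗ʳ (dual a) (nonneg a) (flatten b))
          (flattens-trans (flattens-≈ (⊗-comm (dual a) (Fl (s b) (t b))))
          (flattens-trans (flattens-⊗ʳ (Fl (s b) (t b)) (N-Fl (s b) (t b)) (flatten a))
          (flattens-≈ (≈₂-trans (⊗-comm (Fl (s b) (t b)) (Fl (s a) (t a))) (Fl-+ (s a) (t a) (s b) (t b))))))
      }

    -- The trees at an unmatched child move up to the vertex; the difference is exactly CV.
    flattens-un : ∀ {a} → ND a → Flattens (unD a) (leafD ⊗ a)
    flattens-un {F , C} (nF , nC) X V nX VX = N-resp
      (solve 5 (λ X V F C y → C :* V :=
        (((k 1 :+ y) :* F :+ C) :* (y :* X :+ V) :+ (y :* F :+ C) :* X)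
        :- (((k 1 :+ y) :* F) :* (y :* X :+ V) :+ ((k 1 :+ y) :* C :+ y :* F) :* X)) refl X V F C y)
      (nC ⊠ ≽-N nX VX)

    -- The child carries `a` and is matched to a grandchild carrying `b`; both bundles move up and
    -- leave a pendent path. The summand y(V - X) in the difference is where `V ≽ X` enters.
    flattens-ma : ∀ {a b} → ND a → ND b → Flattens (unD (unD b ⊗ a)) (pathD ⊗ (a ⊗ b))
    flattens-ma {F , C} {F' , C'} (nF , nC) (nF' , nC') X V nX VX = N-resp
      (solve 7 (λ X V F C F' C' y →
        let f = (k 1 :+ y) :* F' :+ C' ; q = y :* F' :+ C'
            G = f :* F ; D = f :* C :+ q :* F
            β = y :* y :+ k 3 :* y :+ k 1 ; δ = y :* y :+ k 2 :* y in
        C :* F' :* (V :+ y :* (V :- X)) :+ F :* C' :* ((y :+ k 2) :* V) :+ C :* C' :* ((y :* X :+ X) :+ V)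
         := (((k 1 :+ y) :* G :+ D) :* (y :* X :+ V) :+ (y :* G :+ D) :* X)
        :- ((β :* (F :* F')) :* (y :* X :+ V) :+ (β :* (F :* C' :+ C :* F') :+ δ :* (F :* F')) :* X)) refl X V F C F' C' y)
      ((nC ⊠ nF') ⊠ (nV ⊞ N-y ⊠ VX) ⊞ (nF ⊠ nC') ⊠ ((N-y ⊞ N-κ 2) ⊠ nV) ⊞ (nC ⊠ nC') ⊠ ((N-y ⊠ nX ⊞ nX) ⊞ nV))
      where
      nV : N V
      nV = ≽-N nX VX

    unB : Bundle → Bundle
    unB b = record
      { dual = unD (dual b) ; nonneg = N-un {dual b} (nonneg b) ; s = s b ; t = suc (t b)
      ; flatten = flattens-trans (flattens-un (nonneg b)) (flatten (leafB ⊗B b)) }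

    maB : Bundle → Bundle → Bundle
    maB a b = record
      { dual = unD (unD (dual b) ⊗ dual a)
      ; nonneg = N-un {unD (dual b) ⊗ dual a} (N-⊗ {unD (dual b)} {dual a} (N-un {dual b} (nonneg b)) (nonneg a))
      ; s = suc (s a ℕ.+ s b) ; t = t a ℕ.+ t b
      ; flatten = flattens-trans (flattens-ma (nonneg a) (nonneg b)) (flatten (pathB ⊗B (a ⊗B b))) }

    -- Transfer matrices around the cycle

    record Mat : Set where
      constructor ⟨_,_,_,_⟩
      field e₁₁ e₁₂ e₂₁ e₂₂ : Carrier
    open Mat public

    infixl 7 _⊙_
    _⊙_ : Mat → Mat → Mat
    ⟨ a , b , c , d ⟩ ⊙ ⟨ a' , b' , c' , d' ⟩ =
      ⟨ a * a' + b * c' , a * b' + b * d' , c * a' + d * c' , c * b' + d * d' ⟩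

    infix 4 _≈ₘ_
    record _≈ₘ_ (A B : Mat) : Set where
      constructor mkₘ
      field
        q₁₁ : e₁₁ A ≈ e₁₁ B
        q₁₂ : e₁₂ A ≈ e₁₂ B
        q₂₁ : e₂₁ A ≈ e₂₁ B
        q₂₂ : e₂₂ A ≈ e₂₂ B

    ⊙-cong : ∀ {A A' B B'} → A ≈ₘ A' → B ≈ₘ B' → A ⊙ B ≈ₘ A' ⊙ B'
    ⊙-cong (mkₘ a b c d) (mkₘ a' b' c' d') = mkₘ
      (+-cong (*-cong a a') (*-cong b c')) (+-cong (*-cong a b') (*-cong b d'))
      (+-cong (*-cong c a') (*-cong d c')) (+-cong (*-cong c b') (*-cong d d'))

    ≈ₘ-trans : ∀ {A B C} → A ≈ₘ B → B ≈ₘ C → A ≈ₘ C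
    ≈ₘ-trans (mkₘ a b c d) (mkₘ a' b' c' d') = mkₘ (trans a a') (trans b b') (trans c c') (trans d d')

    ≈ₘ-sym : ∀ {A B} → A ≈ₘ B → B ≈ₘ A
    ≈ₘ-sym (mkₘ a b c d) = mkₘ (sym a) (sym b) (sym c) (sym d)

    ≈ₘ-refl : ∀ {A} → A ≈ₘ A
    ≈ₘ-refl = mkₘ refl refl refl refl

    ⊙-assoc : ∀ A B C → (A ⊙ B) ⊙ C ≈ₘ A ⊙ (B ⊙ C)
    ⊙-assoc ⟨ a , b , c , d ⟩ ⟨ a' , b' , c' , d' ⟩ ⟨ a″ , b″ , c″ , d″ ⟩ = mkₘ
      (entry a b a″ c″) (entry a b b″ d″) (entry c d a″ c″) (entry c d b″ d″)
      where
      entry : ∀ r s u v → (r * a' + s * c') * u + (r * b' + s * d') * v ≈ r * (a' * u + b' * v) + s * (c' * u + d' * v)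
      entry r s u v = solve 8 (λ r s u v a' b' c' d' →
        (r :* a' :+ s :* c') :* u :+ (r :* b' :+ s :* d') :* v := r :* (a' :* u :+ b' :* v) :+ s :* (c' :* u :+ d' :* v)) refl r s u v a' b' c' d'

    I₂ : Mat
    I₂ = ⟨ κ 1 , κ 0 , κ 0 , κ 1 ⟩

    ⊙-identityʳ : ∀ A → A ⊙ I₂ ≈ₘ A
    ⊙-identityʳ ⟨ a , b , c , d ⟩ = mkₘ (l a b) (r a b) (l c d) (r c d)
      where
      l : ∀ a b → a * κ 1 + b * κ 0 ≈ a
      l = solve 2 (λ a b → a :* k 1 :+ b :* k 0 := a) refl
      r : ∀ a b → a * κ 0 + b * κ 1 ≈ b
      r = solve 2 (λ a b → a :* k 0 :+ b :* k 1 := b) refl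

    tr : Mat → Carrier
    tr A = e₁₁ A + e₂₂ A

    tr-cong : ∀ {A B} → A ≈ₘ B → tr A ≈ tr B
    tr-cong (mkₘ a b c d) = +-cong a d

    tr-comm : ∀ A B → tr (A ⊙ B) ≈ tr (B ⊙ A)
    tr-comm ⟨ a , b , c , d ⟩ ⟨ a' , b' , c' , d' ⟩ = solve 8 (λ a b c d a' b' c' d' →
      (a :* a' :+ b :* c') :+ (c :* b' :+ d :* d') := (a' :* a :+ b' :* c) :+ (c' :* b :+ d' :* d)) refl a b c d a' b' c' d'

    -- With h = F and q = yF + C the 2×2 matrix below is the transfer matrix
    -- (q+2h, −h; h, 0) of the three-term recurrence, in a basis that makes all
    -- its entries nonnegative.
    mat : Dual → Mat
    mat (F , C) = ⟨ F + (y * F + C) , y * F + C , F , F ⟩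

    mat-cong : ∀ {a b} → a ≈₂ b → mat a ≈ₘ mat b
    mat-cong (e , f) = mkₘ (+-cong e g) g e e where g = +-cong (*-congˡ e) f

    Π : List Dual → Mat
    Π [] = I₂
    Π (x ∷ xs) = Π xs ⊙ mat x

    J : List Dual → Carrier
    J [] = κ 1
    J (x ∷ xs) = J xs * proj₁ x

    Π-++ : ∀ xs ys → Π (xs ++ ys) ≈ₘ Π ys ⊙ Π xs
    Π-++ [] ys = ≈ₘ-sym (⊙-identityʳ (Π ys))
    Π-++ (x ∷ xs) ys = ≈ₘ-trans (⊙-cong (Π-++ xs ys) ≈ₘ-refl) (⊙-assoc (Π ys) (Π xs) (mat x))

    J-++ : ∀ xs ys → J (xs ++ ys) ≈ J xs * J ys
    J-++ [] ys = solve 1 (λ a → a := k 1 :* a) refl (J ys)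
    J-++ (x ∷ xs) ys = trans (*-congʳ (J-++ xs ys))
      (solve 3 (λ a b c → (a :* b) :* c := (a :* c) :* b) refl (J xs) (J ys) (proj₁ x))

    -- The sign of 2J is that of an odd cycle. Moves that take a single vertex off the cycle pass
    -- through words of even length, where this is only a formal expression; the inequalities hold
    -- for it all the same.
    cyc : List Dual → Carrier
    cyc xs = tr (Π xs) + κ 2 * J xs

    cyc-rotate : ∀ xs ys → cyc (xs ++ ys) ≈ cyc (ys ++ xs)
    cyc-rotate xs ys = +-cong
      (trans (tr-cong (Π-++ xs ys)) (trans (tr-comm (Π ys) (Π xs)) (sym (tr-cong (Π-++ ys xs)))))
      (*-congˡ (trans (J-++ xs ys) (trans (*-comm (J xs) (J ys)) (sym (J-++ ys xs)))))

    Π-cong : ∀ {xs ys} → Pointwise _≈₂_ xs ys → Π xs ≈ₘ Π ys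
    Π-cong [] = ≈ₘ-refl
    Π-cong (e ∷ es) = ⊙-cong (Π-cong es) (mat-cong e)

    J-cong : ∀ {xs ys} → Pointwise _≈₂_ xs ys → J xs ≈ J ys
    J-cong [] = refl
    J-cong (e ∷ es) = *-cong (J-cong es) (proj₁ e)

    cyc-cong : ∀ {xs ys} → Pointwise _≈₂_ xs ys → cyc xs ≈ cyc ys
    cyc-cong es = +-cong (tr-cong (Π-cong es)) (*-congˡ (J-cong es))

    pointwise-refl : ∀ {xs} → Pointwise _≈₂_ xs xs
    pointwise-refl {[]} = []
    pointwise-refl {x ∷ xs} = ≈₂-refl ∷ pointwise-refl

    -- Each `mat` has F as a summand of both diagonal entries, so the diagonal of the product
    -- dominates `J`. The bounds on `e₁₂` and `e₂₂` below are built on this slack.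
    record NonnegMat (A : Mat) (j : Carrier) : Set where
      field
        n₁₁ : N (e₁₁ A)
        n₁₂ : N (e₁₂ A)
        n₂₁ : N (e₂₁ A)
        n₂₂ : N (e₂₂ A)
        nj  : N j
        n₁₁-j : e₁₁ A ≽ j
        n₂₂-j : e₂₂ A ≽ j

    Π-nonneg : ∀ {xs} → All ND xs → NonnegMat (Π xs) (J xs)
    Π-nonneg [] = record { n₁₁ = N-κ 1 ; n₁₂ = N-κ 0 ; n₂₁ = N-κ 0 ; n₂₂ = N-κ 1 ; nj = N-κ 1 ; n₁₁-j = ≽-refl refl ; n₂₂-j = ≽-refl refl }
    Π-nonneg {(F , C) ∷ xs} ((nF , nC) ∷ ns) = record
      { n₁₁ = (n₁₁ ⊠ (nF ⊞ nq)) ⊞ n₁₂ ⊠ nF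
      ; n₁₂ = n₁₁ ⊠ nq ⊞ n₁₂ ⊠ nF
      ; n₂₁ = n₂₁ ⊠ (nF ⊞ nq) ⊞ n₂₂ ⊠ nF
      ; n₂₂ = n₂₁ ⊠ nq ⊞ n₂₂ ⊠ nF
      ; nj = nj ⊠ nF
      ; n₁₁-j = N-resp (solve 5 (λ p r j F q → (p :- j) :* F :+ p :* q :+ r :* F := (p :* (F :+ q) :+ r :* F) :- j :* F) refl (e₁₁ A) (e₁₂ A) (J xs) F q)
          (n₁₁-j ⊠ nF ⊞ n₁₁ ⊠ nq ⊞ n₁₂ ⊠ nF)
      ; n₂₂-j = N-resp (solve 5 (λ s w j F q → s :* q :+ (w :- j) :* F := (s :* q :+ w :* F) :- j :* F) refl (e₂₁ A) (e₂₂ A) (J xs) F q)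
          (n₂₁ ⊠ nq ⊞ n₂₂-j ⊠ nF) }
      where
      A = Π xs
      q = y * F + C
      open NonnegMat (Π-nonneg ns)
      nq : N q
      nq = N-y ⊠ nF ⊞ nC

    -- In ratios: e₁₂/J is at least the sum of (yF + C)/F over the letters. The factor `c` clears
    -- denominators.
    e₁₂-bound : ∀ {xs c b b' x} → All ND xs → ND x → N c →
      c * e₁₂ (Π xs) ≽ b * J xs → c * (y * proj₁ x + proj₂ x) ≽ b' * proj₁ x →
      c * e₁₂ (Π (x ∷ xs)) ≽ (b + b') * J (x ∷ xs)
    e₁₂-bound {xs} {c} {b} {b'} {F , C} ns (nF , nC) nc h₁ h₂ =
      N-resp (solve 8 (λ p r j c b b' q F →
        c :* q :* (p :- j) :+ j :* (c :* q :- b' :* F) :+ F :* (c :* r :- b :* j)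
        := c :* (p :* q :+ r :* F) :- (b :+ b') :* (j :* F)) refl (e₁₁ (Π xs)) (e₁₂ (Π xs)) (J xs) c b b' q F)
        (nc ⊠ (N-y ⊠ nF ⊞ nC) ⊠ n₁₁-j ⊞ nj ⊠ h₂ ⊞ nF ⊠ h₁)
      where
      q = y * F + C
      open NonnegMat (Π-nonneg ns)

-- Inequalities for taking vertices off the cycle

module CycleInequalities where
  open Cones using (Cone; module Core)

  module Cycles (S : Cone) where
    open Core S public

    -- Equal to yF + C for `leafD` and to the second component of `pathD`; it is also the entry
    -- `e₁₂` for two vertices with nothing hanging.
    δ : Carrier
    δ = y * y + κ 2 * y

    Nδ : N δ
    Nδ = N-y ⊠ N-y ⊞ N-κ 2 ⊠ N-y

    -- (1+y)q − (y²+2y)h for h = F, q = yF + C.  It is 0 for a vertex with one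
    -- pendent edge; its nonnegativity says that c carries at least that much.
    L : Dual → Carrier
    L (F , C) = (κ 1 + y) * C - y * F

    -- Two letters suffice, whatever follows. For just two bare vertices this bound and that of
    -- `two-letters₂₂` are equalities, which explains δ and 1 + y.
    two-letters₁₂ : ∀ {x₁ x₂ xs} → ND x₁ → ND x₂ → All ND xs → e₁₂ (Π (x₁ ∷ x₂ ∷ xs)) ≽ δ * J (x₁ ∷ x₂ ∷ xs)
    two-letters₁₂ {F₁ , C₁} {F₂ , C₂} {xs} (nF₁ , nC₁) (nF₂ , nC₂) ns = N-resp
      (solve 8 (λ p r j F₁ C₁ F₂ C₂ y →
        let q₁ = y :* F₁ :+ C₁ ; q₂ = y :* F₂ :+ C₂ in
        (p :- j) :* ((F₂ :+ q₂) :* q₁ :+ q₂ :* F₁) :+ r :* (F₂ :* q₁ :+ F₂ :* F₁)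
        :+ j :* ((k 1 :+ y) :* (F₂ :* C₁ :+ C₂ :* F₁) :+ C₁ :* C₂)
        := ((p :* (F₂ :+ q₂) :+ r :* F₂) :* q₁ :+ (p :* q₂ :+ r :* F₂) :* F₁) :- (y :* y :+ k 2 :* y) :* ((j :* F₂) :* F₁))
        refl (e₁₁ (Π xs)) (e₁₂ (Π xs)) (J xs) F₁ C₁ F₂ C₂ y)
      (n₁₁-j ⊠ ((nF₂ ⊞ nq₂) ⊠ nq₁ ⊞ nq₂ ⊠ nF₁) ⊞ n₁₂ ⊠ (nF₂ ⊠ nq₁ ⊞ nF₂ ⊠ nF₁)
        ⊞ nj ⊠ (Nα ⊠ (nF₂ ⊠ nC₁ ⊞ nC₂ ⊠ nF₁) ⊞ nC₁ ⊠ nC₂))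
      where
      open NonnegMat (Π-nonneg ns)
      nq₁ = N-y ⊠ nF₁ ⊞ nC₁
      nq₂ = N-y ⊠ nF₂ ⊞ nC₂

    two-letters₂₂ : ∀ {x₁ x₂ xs} → ND x₁ → ND x₂ → All ND xs → e₂₂ (Π (x₁ ∷ x₂ ∷ xs)) ≽ (κ 1 + y) * J (x₁ ∷ x₂ ∷ xs)
    two-letters₂₂ {F₁ , C₁} {F₂ , C₂} {xs} (nF₁ , nC₁) (nF₂ , nC₂) ns = N-resp
      (solve 8 (λ s w j F₁ C₁ F₂ C₂ y →
        let q₁ = y :* F₁ :+ C₁ ; q₂ = y :* F₂ :+ C₂ in
        s :* ((F₂ :+ q₂) :* q₁ :+ q₂ :* F₁) :+ (w :- j) :* (F₂ :* q₁ :+ F₂ :* F₁) :+ j :* (F₂ :* C₁)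
        := ((s :* (F₂ :+ q₂) :+ w :* F₂) :* q₁ :+ (s :* q₂ :+ w :* F₂) :* F₁) :- (k 1 :+ y) :* ((j :* F₂) :* F₁))
        refl (e₂₁ (Π xs)) (e₂₂ (Π xs)) (J xs) F₁ C₁ F₂ C₂ y)
      (n₂₁ ⊠ ((nF₂ ⊞ nq₂) ⊠ nq₁ ⊞ nq₂ ⊠ nF₁) ⊞ n₂₂-j ⊠ (nF₂ ⊠ nq₁ ⊞ nF₂ ⊠ nF₁) ⊞ nj ⊠ (nF₂ ⊠ nC₁))
      where
      open NonnegMat (Π-nonneg ns)
      nq₁ = N-y ⊠ nF₁ ⊞ nC₁
      nq₂ = N-y ⊠ nF₂ ⊞ nC₂

    -- The cycle vertex `d` becomes a pendent edge at `c`, and its trees move along. The loss from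
    -- shortening the cycle is covered by the bound on `e₁₂` of the rest.
    remove-free : ∀ {c d zs} → ND c → ND d → All ND zs → e₁₂ (Π zs) ≽ δ * J zs →
      cyc (c ∷ d ∷ zs) ≽ cyc ((c ⊗ (leafD ⊗ d)) ∷ zs)
    remove-free {F , C} {D , E} {zs} (nF , nC) (nD , nE) ns h = N-resp
      (solve 10 (λ p r s w j F C D E y →
        let q = y :* F :+ C ; qd = y :* D :+ E
            f = (k 1 :+ y) :* D ; c = (k 1 :+ y) :* E :+ y :* D
            F' = F :* f ; q' = y :* F' :+ (F :* c :+ C :* f)
            p₁ = p :* (D :+ qd) :+ r :* D ; r₁ = p :* qd :+ r :* D
            s₁ = s :* (D :+ qd) :+ w :* D ; w₁ = s :* qd :+ w :* D
        in
        D :* (F :* (r :- (y :* y :+ k 2 :* y) :* j) :+ F :* (y :* y :* j) :+ C :* (r :+ w)) :+ E :* (F :* p :+ C :* (p :+ s))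
        := (((p₁ :* (F :+ q) :+ r₁ :* F) :+ (s₁ :* q :+ w₁ :* F)) :+ k 2 :* ((j :* D) :* F))
        :- (((p :* (F' :+ q') :+ r :* F') :+ (s :* q' :+ w :* F')) :+ k 2 :* (j :* F')))
        refl (e₁₁ (Π zs)) (e₁₂ (Π zs)) (e₂₁ (Π zs)) (e₂₂ (Π zs)) (J zs) F C D E y)
      (nD ⊠ (nF ⊠ h ⊞ nF ⊠ (N-y ⊠ N-y ⊠ nj) ⊞ nC ⊠ (n₁₂ ⊞ n₂₂)) ⊞ nE ⊠ (nF ⊠ n₁₁ ⊞ nC ⊠ (n₁₁ ⊞ n₂₁)))
      where open NonnegMat (Π-nonneg ns)

    -- A joined vertex with trees `a` leaves the cycle together with its partner, which carries `b`,
    -- as a pendent path. The rest has to provide 2δJ, twice what one joined vertex guarantees.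
    remove-mat : ∀ {c a b zs} → ND c → N (L c) → ND a → ND b → All ND zs → (κ 1 + y) * e₁₂ (Π zs) ≽ (δ + δ) * J zs →
      cyc (c ∷ (unD b ⊗ a) ∷ zs) ≽ cyc ((c ⊗ (pathD ⊗ (a ⊗ b))) ∷ zs)
    remove-mat {F , C} {A , X} {B , Y} {zs} (nF , nC) nL (nA , nX) (nB , nY) ns h = N-resp
      (solve 12 (λ p r s w j F C A X B Y y →
        let q = y :* F :+ C
            L = (k 1 :+ y) :* C :- y :* F
            β = y :* y :+ k 3 :* y :+ k 1 ; δ = y :* y :+ k 2 :* y
            g = (k 1 :+ y) :* B :+ Y ; qb = y :* B :+ Y
            D = g :* A ; E = g :* X :+ qb :* A
            qd = y :* D :+ E
            f = β :* (A :* B) ; c = β :* (A :* Y :+ X :* B) :+ δ :* (A :* B)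
            F' = F :* f ; q' = y :* F' :+ (F :* c :+ C :* f)
            p₁ = p :* (D :+ qd) :+ r :* D ; r₁ = p :* qd :+ r :* D
            s₁ = s :* (D :+ qd) :+ w :* D ; w₁ = s :* qd :+ w :* D
            pZ = (F :+ q) :* p :+ q :* s ; rZ = (F :+ q) :* r :+ q :* w
            sZ = F :* (p :+ s) ; wZ = F :* (r :+ w)
        in
        A :* B :* (F :* ((k 1 :+ y) :* r :- (δ :+ δ) :* j) :+ L :* (r :+ w))
        :+ X :* B :* ((k 1 :+ y) :* F :* p :+ L :* (p :+ s))
        :+ A :* Y :* ((y :+ k 2) :* (F :* p :+ C :* (p :+ s)) :+ (rZ :+ wZ :+ k 2 :* (j :* F)))
        :+ X :* Y :* (pZ :+ sZ)
        := (((p₁ :* (F :+ q) :+ r₁ :* F) :+ (s₁ :* q :+ w₁ :* F)) :+ k 2 :* ((j :* D) :* F))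
        :- (((p :* (F' :+ q') :+ r :* F') :+ (s :* q' :+ w :* F')) :+ k 2 :* (j :* F')))
        refl (e₁₁ (Π zs)) (e₁₂ (Π zs)) (e₂₁ (Π zs)) (e₂₂ (Π zs)) (J zs) F C A X B Y y)
      (nA ⊠ nB ⊠ (nF ⊠ h ⊞ nL ⊠ (n₁₂ ⊞ n₂₂))
       ⊞ nX ⊠ nB ⊠ (Nα ⊠ nF ⊠ n₁₁ ⊞ nL ⊠ (n₁₁ ⊞ n₂₁))
       ⊞ nA ⊠ nY ⊠ ((N-y ⊞ N-κ 2) ⊠ (nF ⊠ n₁₁ ⊞ nC ⊠ (n₁₁ ⊞ n₂₁)) ⊞ (((nF ⊞ nq) ⊠ n₁₂ ⊞ nq ⊠ n₂₂) ⊞ nF ⊠ (n₁₂ ⊞ n₂₂) ⊞ N-κ 2 ⊠ (nj ⊠ nF)))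
       ⊞ nX ⊠ nY ⊠ (((nF ⊞ nq) ⊠ n₁₁ ⊞ nq ⊠ n₂₁) ⊞ nF ⊠ (n₁₁ ⊞ n₂₁)))
      where
      open NonnegMat (Π-nonneg ns)
      nq = N-y ⊠ nF ⊞ nC

    -- Two consecutive cycle vertices matched to each other leave as one pendent path. Both
    -- conditions on the rest hold as soon as it has two letters.
    remove-pair : ∀ {c a b zs} → ND c → N (L c) → ND a → ND b → All ND zs →
      e₁₂ (Π zs) ≽ δ * J zs → e₂₂ (Π zs) ≽ (κ 1 + y) * J zs →
      cyc (c ∷ a ∷ b ∷ zs) ≽ cyc ((c ⊗ (pathD ⊗ (a ⊗ b))) ∷ zs)
    remove-pair {F , C} {A , X} {B , Y} {zs} (nF , nC) nL (nA , nX) (nB , nY) ns h₁ h₂ = N-resp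
      (solve 12 (λ p r s w j F C A X B Y y →
        let q = y :* F :+ C ; qa = y :* A :+ X ; qb = y :* B :+ Y
            L = (k 1 :+ y) :* C :- y :* F
            β = y :* y :+ k 3 :* y :+ k 1 ; δ = y :* y :+ k 2 :* y
            f = β :* (A :* B) ; c = β :* (A :* Y :+ X :* B) :+ δ :* (A :* B)
            F' = F :* f ; q' = y :* F' :+ (F :* c :+ C :* f)
            p₁ = p :* (B :+ qb) :+ r :* B ; r₁ = p :* qb :+ r :* B
            s₁ = s :* (B :+ qb) :+ w :* B ; w₁ = s :* qb :+ w :* B
            p₂ = p₁ :* (A :+ qa) :+ r₁ :* A ; r₂ = p₁ :* qa :+ r₁ :* A
            s₂ = s₁ :* (A :+ qa) :+ w₁ :* A ; w₂ = s₁ :* qa :+ w₁ :* A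
            pZ = (F :+ q) :* p :+ q :* s ; rZ = (F :+ q) :* r :+ q :* w
            sZ = F :* (p :+ s) ; wZ = F :* (r :+ w)
        in
        A :* B :* ((y :+ k 2) :* (F :* (r :- δ :* j) :+ C :* r :+ C :* (w :- (k 1 :+ y) :* j) :+ j :* L) :+ j :* F :* (y :* y :* y :+ k 3 :* y :* y))
        :+ A :* Y :* ((y :+ k 2) :* (F :* p :+ C :* (p :+ s)))
        :+ X :* B :* ((k 1 :+ y) :* F :* p :+ L :* (p :+ s) :+ rZ :+ wZ)
        :+ X :* Y :* (pZ :+ sZ)
        := (((p₂ :* (F :+ q) :+ r₂ :* F) :+ (s₂ :* q :+ w₂ :* F)) :+ k 2 :* (((j :* B) :* A) :* F))
        :- (((p :* (F' :+ q') :+ r :* F') :+ (s :* q' :+ w :* F')) :+ k 2 :* (j :* F')))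
        refl (e₁₁ (Π zs)) (e₁₂ (Π zs)) (e₂₁ (Π zs)) (e₂₂ (Π zs)) (J zs) F C A X B Y y)
      (nA ⊠ nB ⊠ ((N-y ⊞ N-κ 2) ⊠ (nF ⊠ h₁ ⊞ nC ⊠ n₁₂ ⊞ nC ⊠ h₂ ⊞ nj ⊠ nL) ⊞ nj ⊠ nF ⊠ (N-y ⊠ N-y ⊠ N-y ⊞ N-κ 3 ⊠ N-y ⊠ N-y))
       ⊞ nA ⊠ nY ⊠ ((N-y ⊞ N-κ 2) ⊠ (nF ⊠ n₁₁ ⊞ nC ⊠ (n₁₁ ⊞ n₂₁)))
       ⊞ nX ⊠ nB ⊠ (Nα ⊠ nF ⊠ n₁₁ ⊞ nL ⊠ (n₁₁ ⊞ n₂₁) ⊞ ((nF ⊞ nq) ⊠ n₁₂ ⊞ nq ⊠ n₂₂) ⊞ nF ⊠ (n₁₂ ⊞ n₂₂))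
       ⊞ nX ⊠ nY ⊠ (((nF ⊞ nq) ⊠ n₁₁ ⊞ nq ⊠ n₂₁) ⊞ nF ⊠ (n₁₁ ⊞ n₂₁)))
      where
      open NonnegMat (Π-nonneg ns)
      nq = N-y ⊠ nF ⊞ nC

    -- A triangle looks the same from each vertex and in both directions, so the value on three
    -- letters is symmetric; q stands for yF + C.
    cyc₃ₚ : ∀ {n} → (h₁ h₂ h₃ q₁ q₂ q₃ : Polynomial n) → Polynomial n
    cyc₃ₚ h₁ h₂ h₃ q₁ q₂ q₃ =
      k 4 :* (h₁ :* h₂ :* h₃) :+ k 3 :* (q₁ :* h₂ :* h₃ :+ h₁ :* q₂ :* h₃ :+ h₁ :* h₂ :* q₃)
      :+ k 2 :* (q₁ :* q₂ :* h₃ :+ q₁ :* h₂ :* q₃ :+ h₁ :* q₂ :* q₃) :+ q₁ :* q₂ :* q₃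

    cyc₃ : ∀ c a b → cyc (c ∷ a ∷ b ∷ []) ≈
      let h₁ = proj₁ c ; h₂ = proj₁ a ; h₃ = proj₁ b
          q₁ = y * proj₁ c + proj₂ c ; q₂ = y * proj₁ a + proj₂ a ; q₃ = y * proj₁ b + proj₂ b in
      κ 4 * (h₁ * h₂ * h₃) + κ 3 * (q₁ * h₂ * h₃ + h₁ * q₂ * h₃ + h₁ * h₂ * q₃)
        + κ 2 * (q₁ * q₂ * h₃ + q₁ * h₂ * q₃ + h₁ * q₂ * q₃) + q₁ * q₂ * q₃
    cyc₃ (h₁ , C₁) (h₂ , C₂) (h₃ , C₃) = solve 6 (λ h₁ h₂ h₃ q₁ q₂ q₃ →
      let p₃ = k 1 :* (h₃ :+ q₃) :+ k 0 :* h₃ ; r₃ = k 1 :* q₃ :+ k 0 :* h₃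
          s₃ = k 0 :* (h₃ :+ q₃) :+ k 1 :* h₃ ; w₃ = k 0 :* q₃ :+ k 1 :* h₃
          p₂ = p₃ :* (h₂ :+ q₂) :+ r₃ :* h₂ ; r₂ = p₃ :* q₂ :+ r₃ :* h₂
          s₂ = s₃ :* (h₂ :+ q₂) :+ w₃ :* h₂ ; w₂ = s₃ :* q₂ :+ w₃ :* h₂ in
      ((p₂ :* (h₁ :+ q₁) :+ r₂ :* h₁) :+ (s₂ :* q₁ :+ w₂ :* h₁)) :+ k 2 :* (((k 1 :* h₃) :* h₂) :* h₁)
      := cyc₃ₚ h₁ h₂ h₃ q₁ q₂ q₃)
      refl h₁ h₂ h₃ (y * h₁ + C₁) (y * h₂ + C₂) (y * h₃ + C₃)

    cyc₃-swap : ∀ c a b → cyc (c ∷ a ∷ b ∷ []) ≈ cyc (c ∷ b ∷ a ∷ [])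
    cyc₃-swap c@(h₁ , C₁) a@(h₂ , C₂) b@(h₃ , C₃) = trans (cyc₃ c a b) (trans
      (solve 6 (λ h₁ h₂ h₃ q₁ q₂ q₃ → cyc₃ₚ h₁ h₂ h₃ q₁ q₂ q₃ := cyc₃ₚ h₁ h₃ h₂ q₁ q₃ q₂)
        refl h₁ h₂ h₃ (y * h₁ + C₁) (y * h₂ + C₂) (y * h₃ + C₃))
      (sym (cyc₃ c b a)))

    ≽-resp₂ : ∀ {a a' b b'} → a ≈ a' → b ≈ b' → a' ≽ b' → a ≽ b
    ≽-resp₂ e f p = ≽-respˡ e (≽-respʳ p (sym f))

    -- Here the cycle keeps its length and only trees move. Every term of the difference contains X
    -- or Y, so equality holds when nothing hangs at the other two vertices.
    triangle-free : ∀ {c a b} → ND c → ND a → ND b →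
      cyc (c ∷ a ∷ b ∷ []) ≽ cyc ((c ⊗ (a ⊗ b)) ∷ oneD ∷ oneD ∷ [])
    triangle-free {c@(F , C)} {a@(A , X)} {b@(B , Y)} (nF , nC) (nA , nX) (nB , nY) =
      ≽-resp₂ (cyc₃ c a b) (cyc₃ (c ⊗ (a ⊗ b)) oneD oneD) (N-resp
      (solve 7 (λ F C A X B Y y →
        let F' = F :* (A :* B) ; C' = F :* (A :* Y :+ X :* B) :+ C :* (A :* B)
            q₀ = y :* k 1 :+ k 0 in
        (X :* B :+ A :* Y) :* ((y :+ k 2) :* C) :+ X :* Y :* ((y :+ k 2) :* F :+ C)
        := cyc₃ₚ F A B (y :* F :+ C) (y :* A :+ X) (y :* B :+ Y) :- cyc₃ₚ F' (k 1) (k 1) (y :* F' :+ C') q₀ q₀)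
        refl F C A X B Y y)
      ((nX ⊠ nB ⊞ nA ⊠ nY) ⊠ ((N-y ⊞ N-κ 2) ⊠ nC) ⊞ nX ⊠ nY ⊠ ((N-y ⊞ N-κ 2) ⊠ nF ⊞ nC)))

    -- The joined neighbour keeps one pendent edge and hands the rest to `c`. The factor `L` in the
    -- terms with X or X' reflects that `c` should carry at least as much as the pendent edge left
    -- behind.
    triangle-mat : ∀ {c a a' b} → ND c → N (L c) → ND a → ND a' → ND b →
      cyc (c ∷ (unD a' ⊗ a) ∷ b ∷ []) ≽ cyc ((c ⊗ (a ⊗ a')) ∷ leafD ∷ b ∷ [])
    triangle-mat {c@(F , C)} {a@(A , X)} {a'@(A' , X')} {b@(B , Y)} (nF , nC) nL (nA , nX) (nA' , nX') (nB , nY) =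
      ≽-resp₂ (cyc₃ c (unD a' ⊗ a) b) (cyc₃ (c ⊗ (a ⊗ a')) leafD b) (N-resp
      (solve 9 (λ F C A X A' X' B qb y →
        let L = (k 1 :+ y) :* C :- y :* F ; q = y :* F :+ C
            g = (k 1 :+ y) :* A' :+ X' ; qg = y :* A' :+ X'
            D = g :* A ; E = g :* X :+ qg :* A
            F' = F :* (A :* A') ; C' = F :* (A :* X' :+ X :* A') :+ C :* (A :* A') in
        X :* A' :* ((k 2 :* B :+ qb) :* L)
        :+ A :* X' :* ((k 4 :* (B :* F) :+ k 3 :* (qb :* F :+ B :* q) :+ k 2 :* (qb :* q)) :+ (k 2 :* B :+ qb) :* L)
        :+ X :* X' :* (k 3 :* (B :* F) :+ k 2 :* (qb :* F :+ B :* q) :+ qb :* q)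
        := cyc₃ₚ F D B q (y :* D :+ E) qb :- cyc₃ₚ F' (k 1 :+ y) B (y :* F' :+ C') (y :* (k 1 :+ y) :+ y) qb)
        refl F C A X A' X' B qb y)
      (nX ⊠ nA' ⊠ ((N-κ 2 ⊠ nB ⊞ nqb) ⊠ nL)
       ⊞ nA ⊠ nX' ⊠ ((N-κ 4 ⊠ (nB ⊠ nF) ⊞ N-κ 3 ⊠ (nqb ⊠ nF ⊞ nB ⊠ nq) ⊞ N-κ 2 ⊠ (nqb ⊠ nq)) ⊞ (N-κ 2 ⊠ nB ⊞ nqb) ⊠ nL)
       ⊞ nX ⊠ nX' ⊠ (N-κ 3 ⊠ (nB ⊠ nF) ⊞ N-κ 2 ⊠ (nqb ⊠ nF ⊞ nB ⊠ nq) ⊞ nqb ⊠ nq)))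
      where
      qb = y * B + Y
      nqb = N-y ⊠ nB ⊞ nY
      nq = N-y ⊠ nF ⊞ nC

    -- The X and V of `val` for one vertex of a triangle whose other two vertices are bare (index 1)
    -- or carry one pendent edge each (index 2). For instance, X₁ = (y + 2)² - 1.
    X₁ V₁ X₂ V₂ : Carrier
    X₁ = y * y + κ 4 * y + κ 3
    V₁ = κ 2 * (y * y) + κ 6 * y + κ 4
    X₂ = κ 3 * ((κ 1 + y) * (κ 1 + y)) + κ 4 * (δ * (κ 1 + y)) + δ * δ
    V₂ = κ 4 * ((κ 1 + y) * (κ 1 + y)) + κ 6 * (δ * (κ 1 + y)) + κ 2 * (δ * δ)

    triangle-val₁ : ∀ c → cyc (c ∷ oneD ∷ oneD ∷ []) ≈ val X₁ V₁ c
    triangle-val₁ c@(F , C) = trans (cyc₃ c oneD oneD) (solve 3 (λ F C y →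
        let q₀ = y :* k 1 :+ k 0
            X = y :* y :+ k 4 :* y :+ k 3 ; V = k 2 :* (y :* y) :+ k 6 :* y :+ k 4 in
        cyc₃ₚ F (k 1) (k 1) (y :* F :+ C) q₀ q₀ := F :* (y :* X :+ V) :+ C :* X) refl F C y)

    triangle-val₂ : ∀ c → cyc (c ∷ leafD ∷ leafD ∷ []) ≈ val X₂ V₂ c
    triangle-val₂ c@(F , C) = trans (cyc₃ c leafD leafD) (solve 3 (λ F C y →
        let α = k 1 :+ y ; q₀ = y :* α :+ y ; δ = y :* y :+ k 2 :* y
            X = k 3 :* (α :* α) :+ k 4 :* (δ :* α) :+ δ :* δ ; V = k 4 :* (α :* α) :+ k 6 :* (δ :* α) :+ k 2 :* (δ :* δ) in
        cyc₃ₚ F α α (y :* F :+ C) q₀ q₀ := F :* (y :* X :+ V) :+ C :* X) refl F C y)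

    N-X₁ : N X₁
    N-X₁ = N-y ⊠ N-y ⊞ N-κ 4 ⊠ N-y ⊞ N-κ 3

    N-X₂ : N X₂
    N-X₂ = N-κ 3 ⊠ (Nα ⊠ Nα) ⊞ N-κ 4 ⊠ (Nδ ⊠ Nα) ⊞ Nδ ⊠ Nδ

    V₁≽X₁ : V₁ ≽ X₁
    V₁≽X₁ = N-resp (solve 1 (λ y → y :* y :+ k 2 :* y :+ k 1 := (k 2 :* (y :* y) :+ k 6 :* y :+ k 4) :- (y :* y :+ k 4 :* y :+ k 3)) refl y)
      (N-y ⊠ N-y ⊞ N-κ 2 ⊠ N-y ⊞ N-κ 1)

    V₂≽X₂ : V₂ ≽ X₂
    V₂≽X₂ = N-resp (solve 2 (λ α δ → α :* α :+ k 2 :* (δ :* α) :+ δ :* δ :=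
        (k 4 :* (α :* α) :+ k 6 :* (δ :* α) :+ k 2 :* (δ :* δ)) :- (k 3 :* (α :* α) :+ k 4 :* (δ :* α) :+ δ :* δ)) refl (κ 1 + y) δ)
      (Nα ⊠ Nα ⊞ N-κ 2 ⊠ (Nδ ⊠ Nα) ⊞ Nδ ⊠ Nδ)

    P₁ P₂ : ℕ → ℕ → Carrier
    P₁ s t = cyc (Fl s t ∷ oneD ∷ oneD ∷ [])
    P₂ s t = cyc (Fl s t ∷ leafD ∷ leafD ∷ [])

    -- Cutting a pendent path into two pendent edges lowers the value by yV. It serves to give up
    -- matching edges when there are more than required.
    flattens-path : Flattens pathD (leafD ⊗ leafD)
    flattens-path X V nX VX = N-resp (solve 3 (λ X V y →
        let α = k 1 :+ y in
        y :* V := ((y :* y :+ k 3 :* y :+ k 1) :* (y :* X :+ V) :+ (y :* y :+ k 2 :* y) :* X)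
          :- ((α :* α) :* (y :* X :+ V) :+ (α :* y :+ y :* α) :* X)) refl X V y)
      (N-y ⊠ ≽-N nX VX)

    flattens-unmatch : ∀ s t → Flattens (Fl (suc s) t) (Fl s (suc (suc t)))
    flattens-unmatch s t = flattens-trans (flattens-≈ (⊗-comm pathD (Fl s t)))
      (flattens-trans (flattens-⊗ʳ (Fl s t) (N-Fl s t) flattens-path)
      (flattens-≈ (≈₂-trans (⊗-comm (Fl s t) (leafD ⊗ leafD)) (≈₂-trans (⊗-assoc leafD leafD (Fl s t))
        (≈₂-sym (≈₂-trans (Fl-leaf s (suc t)) (⊗-cong ≈₂-refl (Fl-leaf s t))))))))

    flatten₁ : ∀ {a b} → Flattens a b → cyc (a ∷ oneD ∷ oneD ∷ []) ≽ cyc (b ∷ oneD ∷ oneD ∷ [])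
    flatten₁ {a} {b} f = ≽-resp₂ (triangle-val₁ a) (triangle-val₁ b) (f X₁ V₁ N-X₁ V₁≽X₁)

    flatten₂ : ∀ {a b} → Flattens a b → cyc (a ∷ leafD ∷ leafD ∷ []) ≽ cyc (b ∷ leafD ∷ leafD ∷ [])
    flatten₂ {a} {b} f = ≽-resp₂ (triangle-val₂ a) (triangle-val₂ b) (f X₂ V₂ N-X₂ V₂≽X₂)

-- Reducing a cycle that contains a joined vertex

module CycleWords where
  open import Relation.Binary.PropositionalEquality as ≡ using (_≡_; _≢_)
  open Cones using (Cone)
  open CycleInequalities using (module Cycles)

  double≢suc-double : ∀ j l → j ℕ.+ j ≢ suc (l ℕ.+ l)
  double≢suc-double (suc j) zero e with ≡.trans (≡.sym (ℕₚ.+-suc j j)) (ℕₚ.suc-injective e)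
  ... | ()
  double≢suc-double (suc j) (suc l) e = double≢suc-double j l
    (ℕₚ.suc-injective (≡.trans (≡.sym (ℕₚ.+-suc j j)) (≡.trans (ℕₚ.suc-injective e) (≡.cong suc (ℕₚ.+-suc l l)))))

  module Words (S : Cone) where
    open Cycles S public

    -- A cycle vertex with its hanging bundle; "joined b b'" is matched to a
    -- neighbour outside the cycle which carries the bundle b'.
    data State : Set where
      free   : Bundle → State
      joined : Bundle → Bundle → State

    rest : State → Bundle
    rest (free b) = b
    rest (joined b b') = unB b' ⊗B b

    letter : State → Dual
    letter v = dual (rest v)

    N-letter : ∀ v → ND (letter v)
    N-letter v = nonneg (rest v)

    weight : Bundle → ℕ
    weight b = 2 ℕ.* s b ℕ.+ t b

    size : State → ℕ
    size v = suc (weight (rest v))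

    edges : State → ℕ
    edges (free b) = s b
    edges (joined b b') = suc (s b ℕ.+ s b')

    -- The order is met exactly, the number of matching edges only as a bound: surplus paths are
    -- split into pendent edges later, by `lower₁`.
    record Below₁ (P : Carrier) (n m : ℕ) : Set where
      constructor below₁
      field
        s' t'  : ℕ
        bound  : P ≽ P₁ s' t'
        order  : n ≡ 3 ℕ.+ (2 ℕ.* s' ℕ.+ t')
        number : m ≤ 2 ℕ.+ s'

    record Below₂ (P : Carrier) (n m : ℕ) : Set where
      constructor below₂
      field
        s' t'  : ℕ
        bound  : P ≽ P₂ s' t'
        order  : n ≡ 5 ℕ.+ (2 ℕ.* s' ℕ.+ t')
        number : m ≤ 3 ℕ.+ s'

    Below : Carrier → ℕ → ℕ → Set
    Below P n m = Below₁ P n m ⊎ Below₂ P n m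

    below-≽ : ∀ {P Q n m n' m'} → P ≽ Q → n ≡ n' → m ≡ m' → Below Q n' m' → Below P n m
    below-≽ p ≡.refl ≡.refl (inj₁ (below₁ s' t' b o u)) = inj₁ (below₁ s' t' (≽-trans p b) o u)
    below-≽ p ≡.refl ≡.refl (inj₂ (below₂ s' t' b o u)) = inj₂ (below₂ s' t' (≽-trans p b) o u)

    -- The partner alone contributes a pendent edge, for which `L` vanishes; whatever hangs at the
    -- vertex or at its partner only adds to it.
    L-joined : ∀ b b' → N (L (letter (joined b b')))
    L-joined b b' = N-resp (solve 5 (λ F C F' C' y →
        let g = (k 1 :+ y) :* F' :+ C' ; q = y :* F' :+ C' in
        (k 1 :+ y) :* (g :* C) :+ F :* C' := (k 1 :+ y) :* (g :* C :+ q :* F) :- y :* (g :* F))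
        refl (proj₁ (dual b)) (proj₂ (dual b)) (proj₁ (dual b')) (proj₂ (dual b')) y)
      (Nα ⊠ ((Nα ⊠ proj₁ (nonneg b') ⊞ proj₂ (nonneg b')) ⊠ proj₂ (nonneg b)) ⊞ proj₁ (nonneg b) ⊠ proj₂ (nonneg b'))

    joined-⊗ : ∀ b b' x zs → cyc ((letter (joined b b') ⊗ x) ∷ zs) ≈ cyc ((unD (dual b') ⊗ (dual b ⊗ x)) ∷ zs)
    joined-⊗ b b' x zs = cyc-cong {letter (joined b b') ⊗ x ∷ zs} {unD (dual b') ⊗ (dual b ⊗ x) ∷ zs}
      (⊗-assoc (unD (dual b')) (dual b) x ∷ pointwise-refl)

    Pair : Set
    Pair = Bundle × Bundle

    mated : Pair → State
    mated (b , b') = joined b b'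

    sizes edgess : List State → ℕ
    sizes [] = 0
    sizes (v ∷ vs) = size v ℕ.+ sizes vs
    edgess [] = 0
    edgess (v ∷ vs) = edges v ℕ.+ edgess vs

    letters : List State → List Dual
    letters = map letter

    N-letters : ∀ vs → All ND (letters vs)
    N-letters [] = []
    N-letters (v ∷ vs) = N-letter v ∷ N-letters vs

    -- By `L-joined` each joined vertex has (yF + C)/F at least δ/(1 + y); two of them give the 2δ
    -- that `remove-mat` asks for.
    mats-bound : ∀ a b ps → (κ 1 + y) * e₁₂ (Π (letters (map mated (a ∷ b ∷ ps)))) ≽ (δ + δ) * J (letters (map mated (a ∷ b ∷ ps)))
    mats-bound a b ps = ≽-respʳ (step a (b ∷ ps) (step b ps base)) (*-congʳ (solve 1 (λ d → k 0 :+ d :+ d := d :+ d) refl δ))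
      where
      base : (κ 1 + y) * e₁₂ (Π (letters (map mated ps))) ≽ κ 0 * J (letters (map mated ps))
      base = N-resp (solve 3 (λ α r j → α :* r := α :* r :- k 0 :* j) refl (κ 1 + y) (e₁₂ (Π (letters (map mated ps)))) (J (letters (map mated ps))))
        (Nα ⊠ NonnegMat.n₁₂ (Π-nonneg (N-letters (map mated ps))))
      step : ∀ {d} c qs → (κ 1 + y) * e₁₂ (Π (letters (map mated qs))) ≽ d * J (letters (map mated qs)) →
        (κ 1 + y) * e₁₂ (Π (letters (map mated (c ∷ qs)))) ≽ (d + δ) * J (letters (map mated (c ∷ qs)))
      step (c , c') qs h = e₁₂-bound (N-letters (map mated qs)) (N-letter (joined c c')) Nα h
        (N-resp (solve 3 (λ F C y → (k 1 :+ y) :* C :- y :* F := (k 1 :+ y) :* (y :* F :+ C) :- (y :* y :+ k 2 :* y) :* F)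
          refl (proj₁ (letter (joined c c'))) (proj₂ (letter (joined c c'))) y) (L-joined c c'))

    below-triangle₁ : ∀ b {P} → P ≽ cyc (dual b ∷ oneD ∷ oneD ∷ []) → Below₁ P (3 ℕ.+ weight b) (2 ℕ.+ s b)
    below-triangle₁ b p = below₁ (s b) (t b) (≽-trans p (flatten₁ (flatten b))) ≡.refl ℕₚ.≤-refl

    below-triangle₂ : ∀ b {P} → P ≽ cyc (dual b ∷ leafD ∷ leafD ∷ []) → Below₂ P (5 ℕ.+ weight b) (3 ℕ.+ s b)
    below-triangle₂ b p = below₂ (s b) (t b) (≽-trans p (flatten₂ (flatten b))) ≡.refl ℕₚ.≤-refl

    -- The second and third vertex are stripped down to one pendent edge each, `cyc₃-swap` bringing
    -- the third into position. These edges stay on the triangle, which is the shape of G₃².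
    three-mats : ∀ c c' a a' b b' → Below (cyc (letters (joined c c' ∷ joined a a' ∷ joined b b' ∷ [])))
      (sizes (joined c c' ∷ joined a a' ∷ joined b b' ∷ [])) (edgess (joined c c' ∷ joined a a' ∷ joined b b' ∷ []))
    three-mats c c' a a' b b' = below-≽
      (≽-trans (triangle-mat (N-letter C₀) (L-joined c c') (nonneg a) (nonneg a') (N-letter (joined b b')))
      (≽-respˡ (trans (joined-⊗ c c' (dual a ⊗ dual a') (leafD ∷ letter (joined b b') ∷ [])) (cyc₃-swap (letter C₁) leafD (letter (joined b b'))))
      (≽-respʳ (triangle-mat (N-letter C₁) (L-joined (c ⊗B (a ⊗B a')) c') (nonneg b) (nonneg b') N-leaf)
               (joined-⊗ (c ⊗B (a ⊗B a')) c' (dual b ⊗ dual b') (leafD ∷ leafD ∷ [])))))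
      (solveℕ 12 (λ sc tc sc' tc' sa ta sa' ta' sb tb sb' tb' →
          ((# 1) ⊹ ((# 2) ⋆ (sc' ⊹ sc) ⊹ ((# 1) ⊹ tc' ⊹ tc))) ⊹ (((# 1) ⊹ ((# 2) ⋆ (sa' ⊹ sa) ⊹ ((# 1) ⊹ ta' ⊹ ta))) ⊹ (((# 1) ⊹ ((# 2) ⋆ (sb' ⊹ sb) ⊹ ((# 1) ⊹ tb' ⊹ tb))) ⊹ (# 0)))
          ≐ (# 5) ⊹ ((# 2) ⋆ (sc' ⊹ ((sc ⊹ (sa ⊹ sa')) ⊹ (sb ⊹ sb'))) ⊹ ((# 1) ⊹ tc' ⊹ ((tc ⊹ (ta ⊹ ta')) ⊹ (tb ⊹ tb')))))
          ≡.refl (s c) (t c) (s c') (t c') (s a) (t a) (s a') (t a') (s b) (t b) (s b') (t b'))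
      (solveℕ 6 (λ sc sc' sa sa' sb sb' →
          ((# 1) ⊹ (sc ⊹ sc')) ⊹ (((# 1) ⊹ (sa ⊹ sa')) ⊹ (((# 1) ⊹ (sb ⊹ sb')) ⊹ (# 0)))
          ≐ (# 3) ⊹ (sc' ⊹ ((sc ⊹ (sa ⊹ sa')) ⊹ (sb ⊹ sb')))) ≡.refl (s c) (s c') (s a) (s a') (s b) (s b'))
      (inj₂ (below-triangle₂ (rest C₂) (≽-refl refl)))
      where
      C₀ = joined c c'
      C₁ = joined (c ⊗B (a ⊗B a')) c'
      C₂ = joined ((c ⊗B (a ⊗B a')) ⊗B (b ⊗B b')) c'

    sizes-++ : ∀ us vs → sizes (us ++ vs) ≡ sizes us ℕ.+ sizes vs
    sizes-++ [] vs = ≡.refl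
    sizes-++ (u ∷ us) vs = ≡.trans (≡.cong (size u ℕ.+_) (sizes-++ us vs)) (≡.sym (ℕₚ.+-assoc (size u) _ _))

    edgess-++ : ∀ us vs → edgess (us ++ vs) ≡ edgess us ℕ.+ edgess vs
    edgess-++ [] vs = ≡.refl
    edgess-++ (u ∷ us) vs = ≡.trans (≡.cong (edges u ℕ.+_) (edgess-++ us vs)) (≡.sym (ℕₚ.+-assoc (edges u) _ _))

    grow : Bundle → Bundle → Bundle → Bundle
    grow c a b = c ⊗B (pathB ⊗B (a ⊗B b))

    size-grow : ∀ c c' a b → size (joined (grow c a b) c') ≡ size (joined c c') ℕ.+ (2 ℕ.+ (weight a ℕ.+ weight b))
    size-grow c c' a b = solveℕ 8 (λ sc tc sc' tc' sa ta sb tb →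
      (# 1) ⊹ ((# 2) ⋆ (sc' ⊹ (sc ⊹ ((# 1) ⊹ (sa ⊹ sb)))) ⊹ ((# 1) ⊹ tc' ⊹ (tc ⊹ (ta ⊹ tb))))
      ≐ ((# 1) ⊹ ((# 2) ⋆ (sc' ⊹ sc) ⊹ ((# 1) ⊹ tc' ⊹ tc))) ⊹ ((# 2) ⊹ (((# 2) ⋆ sa ⊹ ta) ⊹ ((# 2) ⋆ sb ⊹ tb))))
      ≡.refl (s c) (t c) (s c') (t c') (s a) (t a) (s b) (t b)

    edges-grow : ∀ c c' a b → edges (joined (grow c a b) c') ≡ edges (joined c c') ℕ.+ suc (s a ℕ.+ s b)
    edges-grow c c' a b = solveℕ 4 (λ sc sc' sa sb →
      (# 1) ⊹ ((sc ⊹ ((# 1) ⊹ (sa ⊹ sb))) ⊹ sc') ≐ ((# 1) ⊹ (sc ⊹ sc')) ⊹ ((# 1) ⊹ (sa ⊹ sb)))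
      ≡.refl (s c) (s c') (s a) (s b)

    size-joined : ∀ a b → size (joined a b) ≡ 2 ℕ.+ (weight a ℕ.+ weight b)
    size-joined a b = solveℕ 4 (λ sa ta sb tb →
      (# 1) ⊹ ((# 2) ⋆ (sb ⊹ sa) ⊹ ((# 1) ⊹ tb ⊹ ta)) ≐ (# 2) ⊹ (((# 2) ⋆ sa ⊹ ta) ⊹ ((# 2) ⋆ sb ⊹ tb)))
      ≡.refl (s a) (t a) (s b) (t b)

    -- Only joined vertices are left: all but three are turned into pendent
    -- paths at the first one.
    collapse : ∀ c c' p q ps → let vs = joined c c' ∷ map mated (p ∷ q ∷ ps) in Below (cyc (letters vs)) (sizes vs) (edgess vs)
    collapse c c' (a , a') (b , b') [] = three-mats c c' a a' b b'
    collapse c c' (a , a') q (r ∷ ps) = below-≽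
      (≽-respʳ (remove-mat (N-letter (joined c c')) (L-joined c c') (nonneg a) (nonneg a') (N-letters (map mated (q ∷ r ∷ ps))) (mats-bound q r ps))
        (joined-⊗ c c' (dual (pathB ⊗B (a ⊗B a'))) (letters (map mated (q ∷ r ∷ ps)))))
      (≡.trans (≡.sym (ℕₚ.+-assoc (size (joined c c')) _ _)) (≡.cong (ℕ._+ sizes (map mated (q ∷ r ∷ ps)))
        (≡.trans (≡.cong (size (joined c c') ℕ.+_) (size-joined a a')) (≡.sym (size-grow c c' a a')))))
      (≡.trans (≡.sym (ℕₚ.+-assoc (edges (joined c c')) _ _)) (≡.cong (ℕ._+ edgess (map mated (q ∷ r ∷ ps)))
        (≡.sym (edges-grow c c' a a'))))
      (collapse (grow c a a') c' q r ps)

    -- Consecutive cycle vertices, two at a time when a cycle edge of the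
    -- matching joins them.
    data Unit : Set where
      pair   : Bundle → Bundle → Unit
      single : Bundle → Bundle → Unit

    states : List Unit → List State
    states [] = []
    states (pair a b ∷ us) = free a ∷ free b ∷ states us
    states (single a b ∷ us) = joined a b ∷ states us

    pairs singles : List Unit → ℕ
    pairs [] = 0
    pairs (pair _ _ ∷ us) = suc (pairs us)
    pairs (single _ _ ∷ us) = pairs us
    singles [] = 0
    singles (pair _ _ ∷ us) = singles us
    singles (single _ _ ∷ us) = suc (singles us)

    pair-step : ∀ c c' a b v w zs →
      cyc (letters (joined c c' ∷ free a ∷ free b ∷ v ∷ w ∷ zs)) ≽ cyc (letters (joined (grow c a b) c' ∷ v ∷ w ∷ zs))
    pair-step c c' a b v w zs = ≽-respʳ
      (remove-pair (N-letter (joined c c')) (L-joined c c') (nonneg a) (nonneg b) (N-letters (v ∷ w ∷ zs))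
        (two-letters₁₂ (N-letter v) (N-letter w) (N-letters zs)) (two-letters₂₂ (N-letter v) (N-letter w) (N-letters zs)))
      (joined-⊗ c c' (dual (pathB ⊗B (a ⊗B b))) (letters (v ∷ w ∷ zs)))

    pair-size : ∀ c c' a b zs → sizes (joined c c' ∷ free a ∷ free b ∷ zs) ≡ sizes (joined (grow c a b) c' ∷ zs)
    pair-size c c' a b zs = ≡.trans
      (solveℕ 4 (λ x u v z → x ⊹ (((# 1) ⊹ u) ⊹ (((# 1) ⊹ v) ⊹ z)) ≐ (x ⊹ ((# 2) ⊹ (u ⊹ v))) ⊹ z) ≡.refl (size (joined c c')) (weight a) (weight b) (sizes zs))
      (≡.cong (ℕ._+ sizes zs) (≡.sym (size-grow c c' a b)))

    pair-edges : ∀ c c' a b p zs → suc p ℕ.+ edgess (joined c c' ∷ free a ∷ free b ∷ zs) ≡ p ℕ.+ edgess (joined (grow c a b) c' ∷ zs)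
    pair-edges c c' a b p zs = ≡.trans
      (solveℕ 5 (λ p x u v z → (# 1) ⊹ p ⊹ (x ⊹ (u ⊹ (v ⊹ z))) ≐ p ⊹ ((x ⊹ ((# 1) ⊹ (u ⊹ v))) ⊹ z)) ≡.refl p (edges (joined c c')) (s a) (s b) (edgess zs))
      (≡.cong (λ e → p ℕ.+ (e ℕ.+ edgess zs)) (≡.sym (edges-grow c c' a b)))

    -- All pairs but the last can be absorbed, as two further letters remain each time. The last
    -- pair forms the triangle with the centre and gives up its trees only.
    only-pairs : ∀ c c' a b us → singles us ≡ 0 → let us' = pair a b ∷ us ; vs = joined c c' ∷ states us' in
      Below (cyc (letters vs)) (sizes vs) (pairs us' ℕ.+ edgess vs)
    only-pairs c c' a b [] _ = below-≽
      (triangle-free (N-letter (joined c c')) (nonneg a) (nonneg b))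
      (solveℕ 8 (λ sc tc sc' tc' sa ta sb tb →
        ((# 1) ⊹ ((# 2) ⋆ (sc' ⊹ sc) ⊹ ((# 1) ⊹ tc' ⊹ tc))) ⊹ (((# 1) ⊹ ((# 2) ⋆ sa ⊹ ta)) ⊹ (((# 1) ⊹ ((# 2) ⋆ sb ⊹ tb)) ⊹ (# 0)))
        ≐ (# 3) ⊹ ((# 2) ⋆ ((sc' ⊹ sc) ⊹ (sa ⊹ sb)) ⊹ (((# 1) ⊹ tc' ⊹ tc) ⊹ (ta ⊹ tb))))
        ≡.refl (s c) (t c) (s c') (t c') (s a) (t a) (s b) (t b))
      (solveℕ 4 (λ sc sc' sa sb → (# 1) ⊹ (((# 1) ⊹ (sc ⊹ sc')) ⊹ (sa ⊹ (sb ⊹ (# 0)))) ≐ (# 2) ⊹ ((sc' ⊹ sc) ⊹ (sa ⊹ sb)))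
        ≡.refl (s c) (s c') (s a) (s b))
      (inj₁ (below-triangle₁ (rest (joined c c') ⊗B (a ⊗B b)) (≽-refl refl)))
    only-pairs c c' a b (pair a₂ b₂ ∷ us) e = below-≽
      (pair-step c c' a b (free a₂) (free b₂) (states us))
      (pair-size c c' a b (states (pair a₂ b₂ ∷ us)))
      (pair-edges c c' a b (pairs (pair a₂ b₂ ∷ us)) (states (pair a₂ b₂ ∷ us)))
      (only-pairs (grow c a b) c' a₂ b₂ us e)

    letters-++ : ∀ us vs → letters (us ++ vs) ≡ letters us ++ letters vs
    letters-++ = map-++ letter

    cyc-rotate-states : ∀ us vs → cyc (letters (us ++ vs)) ≈ cyc (letters (vs ++ us))
    cyc-rotate-states us vs = trans (reflexive (≡.cong cyc (letters-++ us vs)))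
      (trans (cyc-rotate (letters us) (letters vs)) (reflexive (≡.cong cyc (≡.sym (letters-++ vs us)))))

    two-states : ∀ us (ps : List Pair) → 2 ≤ length ps ℕ.+ singles us →
      ∃ λ v → ∃ λ w → ∃ λ zs → states us ++ map mated ps ≡ v ∷ w ∷ zs
    two-states (pair a b ∷ us) ps _ = _ , _ , _ , ≡.refl
    two-states (single a b ∷ pair _ _ ∷ us) ps _ = _ , _ , _ , ≡.refl
    two-states (single a b ∷ single _ _ ∷ us) ps _ = _ , _ , _ , ≡.refl
    two-states (single a b ∷ []) (p ∷ ps) _ = _ , _ , _ , ≡.refl
    two-states (single a b ∷ []) [] (s≤s ())
    two-states [] (p ∷ q ∷ ps) _ = _ , _ , _ , ≡.refl
    two-states [] (p ∷ []) (s≤s ())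

    -- The pairs following a joined vertex become pendent paths at it; "ps" are
    -- the joined vertices that have been dealt with.
    absorb : ∀ c c' us ps → 2 ≤ length ps ℕ.+ singles us → let vs = joined c c' ∷ states us ++ map mated ps in
      Below (cyc (letters vs)) (sizes vs) (pairs us ℕ.+ edgess vs)
    absorb c c' [] (p ∷ q ∷ ps) _ = collapse c c' p q ps
    absorb c c' [] (p ∷ []) (s≤s ())
    absorb c c' (pair a b ∷ us) ps h = below-≽ step
      (pair-size c c' a b (states us ++ map mated ps))
      (pair-edges c c' a b (pairs us) (states us ++ map mated ps))
      (absorb (grow c a b) c' us ps h)
      where
      step : cyc (letters (joined c c' ∷ free a ∷ free b ∷ states us ++ map mated ps)) ≽ cyc (letters (joined (grow c a b) c' ∷ states us ++ map mated ps))
      step with states us ++ map mated ps | two-states us ps h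
      ... | _ | v , w , zs , ≡.refl = pair-step c c' a b v w zs
    -- The centre has absorbed its pairs; it is rotated to the end, and the next joined vertex
    -- becomes the centre.
    absorb c c' (single a b ∷ us) ps h = below-≽
      (≽-refl (trans (cyc-rotate-states (joined c c' ∷ []) (joined a b ∷ states us ++ map mated ps))
        (reflexive (≡.cong (λ vs → cyc (letters vs)) assoc))))
      (≡.trans (move sizes sizes-++) (≡.cong sizes assoc))
      (≡.cong (pairs us ℕ.+_) (≡.trans (move edgess edgess-++) (≡.cong edgess assoc)))
      (absorb a b us (ps ++ [ c , c' ]) (ℕₚ.≤-trans h (ℕₚ.≤-reflexive
        (≡.trans (ℕₚ.+-suc (length ps) (singles us)) (≡.cong (ℕ._+ singles us) (≡.sym (≡.trans (length-++ ps) (ℕₚ.+-comm (length ps) 1))))))))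
      where
      assoc : (joined a b ∷ states us ++ map mated ps) ++ [ joined c c' ] ≡ joined a b ∷ states us ++ map mated (ps ++ [ c , c' ])
      assoc = ≡.cong (joined a b ∷_) (≡.trans (++-assoc (states us) (map mated ps) _) (≡.cong (states us ++_) (≡.sym (map-++ mated ps [ c , c' ]))))
      move : ∀ (f : List State → ℕ) → (∀ us vs → f (us ++ vs) ≡ f us ℕ.+ f vs) →
        f (joined c c' ∷ joined a b ∷ states us ++ map mated ps) ≡ f ((joined a b ∷ states us ++ map mated ps) ++ [ joined c c' ])
      move f f-++ = ≡.trans (f-++ [ joined c c' ] _) (≡.trans (ℕₚ.+-comm (f [ joined c c' ]) _) (≡.sym (f-++ (joined a b ∷ states us ++ map mated ps) [ joined c c' ])))

    -- Without another joined vertex the reduction ends in the first triangle, with at least two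
    -- others in the second. Exactly one other would fit neither ending.
    below-units : ∀ c c' u us → singles (u ∷ us) ≢ 1 → let vs = joined c c' ∷ states (u ∷ us) in
      Below (cyc (letters vs)) (sizes vs) (pairs (u ∷ us) ℕ.+ edgess vs)
    below-units c c' u us h with singles (u ∷ us) in e
    below-units c c' (pair a b) us h | 0 = only-pairs c c' a b us e
    ... | 1 = ⊥-elim (h ≡.refl)
    ... | suc (suc n) = below-≽ (≽-refl (reflexive (≡.cong (λ vs → cyc (letters (joined c c' ∷ vs))) (≡.sym id++))))
        (≡.cong (λ vs → sizes (joined c c' ∷ vs)) (≡.sym id++)) (≡.cong (λ vs → pairs (u ∷ us) ℕ.+ edgess (joined c c' ∷ vs)) (≡.sym id++))
        (absorb c c' (u ∷ us) [] (≡.subst (2 ≤_) (≡.sym e) (s≤s (s≤s z≤n))))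
      where
      id++ : states (u ∷ us) ++ [] ≡ states (u ∷ us)
      id++ = ++-identityʳ (states (u ∷ us))

-- Grouping the cycle vertices into units; parity of an odd cycle

module CycleParsing where
  open import Relation.Binary.PropositionalEquality as ≡ using (_≡_; _≢_)
  open Cones using (Cone)
  open CycleWords using (module Words; double≢suc-double)

  module Parsing (S : Cone) where
    open Words S public

    -- Every maximal run of ℓ free vertices contributes ⌊ℓ/2⌋, the number of disjoint path edges
    -- that fit into it.
    freePairs : List State → ℕ
    freePairs [] = 0
    freePairs (joined _ _ ∷ w) = freePairs w
    freePairs (free _ ∷ []) = 0
    freePairs (free _ ∷ free _ ∷ w) = suc (freePairs w)
    freePairs (free _ ∷ joined _ _ ∷ w) = freePairs w

    record Parsed (w end : List State) : Set where
      field
        us           : List Unit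
        same-letters : letters w ≡ letters (states us ++ end)
        same-sizes   : sizes w ≡ sizes (states us ++ end)
        same-edges   : freePairs w ℕ.+ edgess w ≡ pairs us ℕ.+ edgess (states us ++ end)
        same-length  : length w ≡ pairs us ℕ.+ pairs us ℕ.+ singles us ℕ.+ length end
    open Parsed

    parsed-single : ∀ b b' {w end} → Parsed w end → Parsed (joined b b' ∷ w) end
    parsed-single b b' {w} {end} p = record
      { us = single b b' ∷ us p
      ; same-letters = ≡.cong (letter (joined b b') ∷_) (same-letters p)
      ; same-sizes = ≡.cong (size (joined b b') ℕ.+_) (same-sizes p)
      ; same-edges = begin
          freePairs w ℕ.+ (e ℕ.+ edgess w)   ≡⟨ swap (freePairs w) e (edgess w) ⟩
          e ℕ.+ (freePairs w ℕ.+ edgess w)   ≡⟨ ≡.cong (e ℕ.+_) (same-edges p) ⟩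
          e ℕ.+ (pairs (us p) ℕ.+ edgess (states (us p) ++ end)) ≡⟨ swap e (pairs (us p)) _ ⟩
          pairs (us p) ℕ.+ (e ℕ.+ edgess (states (us p) ++ end)) ∎
      ; same-length = ≡.trans (≡.cong suc (same-length p))
          (solveℕ 3 (λ p q r → (# 1) ⊹ (p ⊹ q ⊹ r) ≐ p ⊹ ((# 1) ⊹ q) ⊹ r) ≡.refl (pairs (us p) ℕ.+ pairs (us p)) (singles (us p)) (length end)) }
      where
      open ≡.≡-Reasoning
      e = edges (joined b b')
      swap : ∀ a b c → a ℕ.+ (b ℕ.+ c) ≡ b ℕ.+ (a ℕ.+ c)
      swap = solveℕ 3 (λ a b c → a ⊹ (b ⊹ c) ≐ b ⊹ (a ⊹ c)) ≡.refl

    -- If `v` is joined, it is rematched to `a`, and its former partner stays in its bundle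
    -- unmatched. The hypothesis says that the number of matching edges does not change.
    parsed-pair : ∀ a v {w end} → freePairs (free a ∷ v ∷ w) ℕ.+ edges v ≡ suc (freePairs w ℕ.+ s (rest v)) →
      Parsed w end → Parsed (free a ∷ v ∷ w) end
    parsed-pair a v {w} {end} h p = record
      { us = pair a (rest v) ∷ us p
      ; same-letters = ≡.cong (λ l → dual a ∷ letter v ∷ l) (same-letters p)
      ; same-sizes = ≡.cong (λ x → suc (weight a) ℕ.+ (size v ℕ.+ x)) (same-sizes p)
      ; same-edges = begin
          fp ℕ.+ (s a ℕ.+ (edges v ℕ.+ edgess w))     ≡⟨ solveℕ 4 (λ x y z w → x ⊹ (y ⊹ (z ⊹ w)) ≐ y ⊹ ((x ⊹ z) ⊹ w)) ≡.refl fp (s a) (edges v) (edgess w) ⟩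
          s a ℕ.+ ((fp ℕ.+ edges v) ℕ.+ edgess w)     ≡⟨ ≡.cong (λ x → s a ℕ.+ (x ℕ.+ edgess w)) h ⟩
          s a ℕ.+ (suc (freePairs w ℕ.+ s (rest v)) ℕ.+ edgess w)
            ≡⟨ solveℕ 4 (λ x y z w → x ⊹ ((# 1) ⊹ (y ⊹ z) ⊹ w) ≐ (# 1) ⊹ ((x ⊹ z) ⊹ (y ⊹ w))) ≡.refl (s a) (freePairs w) (s (rest v)) (edgess w) ⟩
          suc ((s a ℕ.+ s (rest v)) ℕ.+ (freePairs w ℕ.+ edgess w)) ≡⟨ ≡.cong (λ x → suc ((s a ℕ.+ s (rest v)) ℕ.+ x)) (same-edges p) ⟩
          suc ((s a ℕ.+ s (rest v)) ℕ.+ (pairs (us p) ℕ.+ edgess (states (us p) ++ end)))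
            ≡⟨ solveℕ 4 (λ x z y w → (# 1) ⊹ ((x ⊹ z) ⊹ (y ⊹ w)) ≐ (# 1) ⊹ y ⊹ (x ⊹ (z ⊹ w))) ≡.refl (s a) (s (rest v)) (pairs (us p)) _ ⟩
          suc (pairs (us p)) ℕ.+ (s a ℕ.+ (s (rest v) ℕ.+ edgess (states (us p) ++ end))) ∎
      ; same-length = ≡.trans (≡.cong (λ x → suc (suc x)) (same-length p))
          (solveℕ 3 (λ p q r → (# 2) ⊹ (p ⊹ p ⊹ q ⊹ r) ≐ ((# 1) ⊹ p) ⊹ ((# 1) ⊹ p) ⊹ q ⊹ r) ≡.refl (pairs (us p)) (singles (us p)) (length end)) }
      where
      open ≡.≡-Reasoning
      fp = freePairs (free a ∷ v ∷ w)

    parsed-end : ∀ end → freePairs end ≡ 0 → Parsed end end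
    parsed-end end e = record { us = [] ; same-letters = ≡.refl ; same-sizes = ≡.refl
      ; same-edges = ≡.cong (ℕ._+ edgess end) e ; same-length = ≡.refl }

    parse : ∀ w → Parsed w [] ⊎ (∃ λ a → Parsed w [ free a ])
    parse [] = inj₁ (parsed-end [] ≡.refl)
    parse (free a ∷ []) = inj₂ (a , parsed-end [ free a ] ≡.refl)
    parse (joined b b' ∷ w) with parse w
    ... | inj₁ p = inj₁ (parsed-single b b' p)
    ... | inj₂ (a , p) = inj₂ (a , parsed-single b b' p)
    parse (free a ∷ free b ∷ w) with parse w
    ... | inj₁ p = inj₁ (parsed-pair a (free b) ≡.refl p)
    ... | inj₂ (e , p) = inj₂ (e , parsed-pair a (free b) ≡.refl p)
    -- `a` is left over from a run of free vertices of odd length and takes the next joined vertex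
    -- as its partner.
    parse (free a ∷ joined b b' ∷ w) = go (parse w)
      where
      eq : freePairs w ℕ.+ suc (s b ℕ.+ s b') ≡ suc (freePairs w ℕ.+ (s b' ℕ.+ s b))
      eq = solveℕ 3 (λ x y z → x ⊹ ((# 1) ⊹ (y ⊹ z)) ≐ (# 1) ⊹ (x ⊹ (z ⊹ y))) ≡.refl (freePairs w) (s b) (s b')
      go : Parsed w [] ⊎ (∃ λ e → Parsed w [ free e ]) → Parsed (free a ∷ joined b b' ∷ w) [] ⊎ (∃ λ e → Parsed (free a ∷ joined b b' ∷ w) [ free e ])
      go (inj₁ p) = inj₁ (parsed-pair a (joined b b') eq p)
      go (inj₂ (e , p)) = inj₂ (e , parsed-pair a (joined b b') eq p)

    states-++ : ∀ us vs → states (us ++ vs) ≡ states us ++ states vs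
    states-++ [] vs = ≡.refl
    states-++ (pair a b ∷ us) vs = ≡.cong (λ l → free a ∷ free b ∷ l) (states-++ us vs)
    states-++ (single a b ∷ us) vs = ≡.cong (joined a b ∷_) (states-++ us vs)

    pairs-++ : ∀ us vs → pairs (us ++ vs) ≡ pairs us ℕ.+ pairs vs
    pairs-++ [] vs = ≡.refl
    pairs-++ (pair a b ∷ us) vs = ≡.cong suc (pairs-++ us vs)
    pairs-++ (single a b ∷ us) vs = pairs-++ us vs

    singles-++ : ∀ us vs → singles (us ++ vs) ≡ singles us ℕ.+ singles vs
    singles-++ [] vs = ≡.refl
    singles-++ (pair a b ∷ us) vs = singles-++ us vs
    singles-++ (single a b ∷ us) vs = ≡.cong suc (singles-++ us vs)

    first-single : ∀ us → singles us ≢ 0 → ∃ λ ps → ∃ λ d → ∃ λ d' → ∃ λ us' → us ≡ ps ++ single d d' ∷ us'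
    first-single [] h = ⊥-elim (h ≡.refl)
    first-single (single d d' ∷ us) h = [] , d , d' , us , ≡.refl
    first-single (pair a b ∷ us) h with first-single us h
    ... | ps , d , d' , us' , ≡.refl = pair a b ∷ ps , d , d' , us' , ≡.refl

    below-odd-singles : ∀ us vs a b → let w = us ++ pair a b ∷ vs in ∀ d d' → singles w ≢ 1 →
      Below (cyc (letters (joined d d' ∷ states w))) (sizes (joined d d' ∷ states w)) (pairs w ℕ.+ edgess (joined d d' ∷ states w))
    below-odd-singles [] vs a b d d' h = below-units d d' (pair a b) vs h
    below-odd-singles (u ∷ us) vs a b d d' h = below-units d d' u (us ++ pair a b ∷ vs) h

    -- The vertex a left over by the scan is adjacent to the starting vertex c,
    -- and is paired with it.
    below-leftover : ∀ c c' us a k → suc (pairs us ℕ.+ pairs us ℕ.+ singles us) ≡ k ℕ.+ k →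
      let vs = joined c c' ∷ states us ++ [ free a ] in Below (cyc (letters vs)) (sizes vs) (pairs us ℕ.+ edgess vs)
    below-leftover c c' us a k odd with first-single us nz
      where
      -- Without single units the left side of `odd` would be 1 plus an even number.
      nz : singles us ≢ 0
      nz e = double≢suc-double k (pairs us) (≡.trans (≡.sym odd) (≡.cong suc (≡.trans (≡.cong (pairs us ℕ.+ pairs us ℕ.+_) e) (ℕₚ.+-identityʳ _))))
    ... | ps , d , d' , us' , ≡.refl = below-≽ (≽-refl rotation) size-eq edges-eq
          (below-odd-singles us' ps a (rest C) d d' ≢1)
      where
      C D : State
      C = joined c c'
      D = joined d d'
      -- Apart from `d` there is one single unit less than before; if one were left there would have
      -- been two, against the parity in `odd`.
      ≢1 : singles (us' ++ pair a (rest C) ∷ ps) ≢ 1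
      ≢1 e = double≢suc-double k (suc (pairs (ps ++ single d d' ∷ us'))) (≡.trans (≡.sym odd) (≡.cong suc
        (≡.trans (≡.cong (P ℕ.+ P ℕ.+_) two) (solveℕ 1 (λ p → p ⊹ p ⊹ (# 2) ≐ (# 1) ⊹ p ⊹ ((# 1) ⊹ p)) ≡.refl P))))
        where
        P = pairs (ps ++ single d d' ∷ us')
        two : singles (ps ++ single d d' ∷ us') ≡ 2
        two = ≡.trans (singles-++ ps (single d d' ∷ us')) (≡.trans (ℕₚ.+-suc (singles ps) (singles us'))
          (≡.cong suc (≡.trans (ℕₚ.+-comm (singles ps) (singles us')) (≡.trans (≡.sym (singles-++ us' (pair a (rest C) ∷ ps))) e))))
      xs = C ∷ states ps
      rotation : cyc (letters (C ∷ states (ps ++ single d d' ∷ us') ++ [ free a ])) ≈ cyc (letters (D ∷ states (us' ++ pair a (rest C) ∷ ps)))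
      rotation = trans (reflexive (≡.cong (λ l → cyc (letters (C ∷ l ++ [ free a ]))) (states-++ ps (single d d' ∷ us'))))
        (trans (reflexive (≡.cong (λ l → cyc (letters (C ∷ l))) (++-assoc (states ps) (D ∷ states us') [ free a ])))
        (trans (cyc-rotate-states xs (D ∷ states us' ++ [ free a ]))
        (reflexive (≡.trans (≡.cong (λ l → cyc (letters (D ∷ l))) (++-assoc (states us') [ free a ] xs))
          (≡.trans (≡.cong cyc (≡.cong (letter D ∷_) (letters-++ (states us') (free a ∷ xs))))
              (≡.trans (≡.cong cyc (≡.cong (letter D ∷_) (≡.sym (letters-++ (states us') (states (pair a (rest C) ∷ ps))))))
               (≡.cong (λ l → cyc (letters (D ∷ l))) (≡.sym (states-++ us' (pair a (rest C) ∷ ps))))))))))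
      module Additive (f : List State → ℕ) (f-++ : ∀ us vs → f (us ++ vs) ≡ f us ℕ.+ f vs) where
        f-states : ∀ us vs → f (states (us ++ vs)) ≡ f (states us) ℕ.+ f (states vs)
        f-states us vs = ≡.trans (≡.cong f (states-++ us vs)) (f-++ (states us) (states vs))
        lhs : f (states (ps ++ single d d' ∷ us') ++ [ free a ]) ≡ f (states ps) ℕ.+ f (D ∷ states us') ℕ.+ f [ free a ]
        lhs = ≡.trans (f-++ (states (ps ++ single d d' ∷ us')) [ free a ]) (≡.cong (ℕ._+ f [ free a ]) (f-states ps (single d d' ∷ us')))
      size-eq : sizes (C ∷ states (ps ++ single d d' ∷ us') ++ [ free a ]) ≡ sizes (D ∷ states (us' ++ pair a (rest C) ∷ ps))
      size-eq = ≡.trans (≡.cong (size C ℕ.+_) lhs)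
        (≡.trans (solveℕ 5 (λ c p d u a → c ⊹ (p ⊹ (d ⊹ u) ⊹ (a ⊹ (# 0))) ≐ d ⊹ (u ⊹ (a ⊹ (c ⊹ p)))) ≡.refl (size C) (sizes (states ps)) (size D) (sizes (states us')) (size (free a)))
        (≡.cong (size D ℕ.+_) (≡.sym (f-states us' (pair a (rest C) ∷ ps)))))
        where open Additive sizes sizes-++
      edges-eq : pairs (ps ++ single d d' ∷ us') ℕ.+ edgess (C ∷ states (ps ++ single d d' ∷ us') ++ [ free a ])
        ≡ pairs (us' ++ pair a (rest C) ∷ ps) ℕ.+ edgess (D ∷ states (us' ++ pair a (rest C) ∷ ps))
      edges-eq = ≡.trans (≡.cong₂ ℕ._+_ (pairs-++ ps (single d d' ∷ us')) (≡.cong (edges C ℕ.+_) lhs))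
        (≡.trans (solveℕ 8 (λ c c' p d u a pp pu → (pp ⊹ pu) ⊹ (((# 1) ⊹ (c ⊹ c')) ⊹ (p ⊹ (d ⊹ u) ⊹ (a ⊹ (# 0)))) ≐ (pu ⊹ ((# 1) ⊹ pp)) ⊹ (d ⊹ (u ⊹ (a ⊹ ((c' ⊹ c) ⊹ p)))))
           ≡.refl (s c) (s c') (edgess (states ps)) (edges D) (edgess (states us')) (s a) (pairs ps) (pairs us'))
        (≡.sym (≡.cong₂ ℕ._+_ (pairs-++ us' (pair a (rest C) ∷ ps)) (≡.cong (edges D ℕ.+_) (f-states us' (pair a (rest C) ∷ ps))))))
        where open Additive edgess edgess-++

    below-joined : ∀ c c' w k → length w ≡ suc k ℕ.+ suc k → let vs = joined c c' ∷ w in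
      Below (cyc (letters vs)) (sizes vs) (freePairs w ℕ.+ edgess vs)
    below-joined c c' w k even = go (parse w)
      where
      C = joined c c'
      swap : ∀ a b c → a ℕ.+ (b ℕ.+ c) ≡ b ℕ.+ (a ℕ.+ c)
      swap = solveℕ 3 (λ a b c → a ⊹ (b ⊹ c) ≐ b ⊹ (a ⊹ c)) ≡.refl
      via : ∀ {end} (p : Parsed w end) → let vs = C ∷ states (us p) ++ end in
        Below (cyc (letters vs)) (sizes vs) (pairs (us p) ℕ.+ edgess vs) → Below (cyc (letters (C ∷ w))) (sizes (C ∷ w)) (freePairs w ℕ.+ edgess (C ∷ w))
      via p = below-≽ (≽-refl (reflexive (≡.cong (λ l → cyc (letter C ∷ l)) (same-letters p))))
        (≡.cong (size C ℕ.+_) (same-sizes p))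
        (≡.trans (swap (freePairs w) (edges C) (edgess w)) (≡.trans (≡.cong (edges C ℕ.+_) (same-edges p)) (swap (edges C) (pairs (us p)) _)))
      go : Parsed w [] ⊎ (∃ λ a → Parsed w [ free a ]) → Below (cyc (letters (C ∷ w))) (sizes (C ∷ w)) (freePairs w ℕ.+ edgess (C ∷ w))
      go (inj₁ p) = via p (≡.subst (λ l → Below (cyc (letters (C ∷ l))) (sizes (C ∷ l)) (pairs (us p) ℕ.+ edgess (C ∷ l)))
          (≡.sym (++-identityʳ (states (us p)))) (units (us p) (≡.trans (≡.sym (same-length p)) even)))
        where
        units : ∀ us → pairs us ℕ.+ pairs us ℕ.+ singles us ℕ.+ 0 ≡ suc k ℕ.+ suc k →
          Below (cyc (letters (C ∷ states us))) (sizes (C ∷ states us)) (pairs us ℕ.+ edgess (C ∷ states us))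
        units [] ()
        units (u ∷ us) e = below-units c c' u us λ one → double≢suc-double (suc k) (pairs (u ∷ us))
          (≡.trans (≡.sym e) (≡.trans (≡.cong (λ x → pairs (u ∷ us) ℕ.+ pairs (u ∷ us) ℕ.+ x ℕ.+ 0) one)
            (solveℕ 1 (λ p → p ⊹ p ⊹ (# 1) ⊹ (# 0) ≐ (# 1) ⊹ (p ⊹ p)) ≡.refl (pairs (u ∷ us)))))
      go (inj₂ (a , p)) = via p (below-leftover c c' (us p) a (suc k) (≡.trans (ℕₚ.+-comm 1 _) (≡.trans (≡.sym (same-length p)) even)))

    pair-up : ∀ k (bs : List Bundle) → length bs ≡ k ℕ.+ k → ∃ λ us → states us ≡ map free bs × singles us ≡ 0 × pairs us ≡ k
    pair-up zero [] _ = [] , ≡.refl , ≡.refl , ≡.refl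
    pair-up (suc k) [] ()
    pair-up (suc k) (a ∷ []) e = ⊥-elim (ℕₚ.0≢1+n (≡.trans (ℕₚ.suc-injective e) (ℕₚ.+-suc k k)))
    pair-up (suc k) (a ∷ b ∷ bs) e with pair-up k bs (ℕₚ.suc-injective (≡.trans (ℕₚ.suc-injective e) (ℕₚ.+-suc k k)))
    ... | us , st , si , pa = pair a b ∷ us , ≡.cong (λ l → free a ∷ free b ∷ l) st , si , ≡.cong suc pa

    -- No vertex of the cycle is matched outwards: two neighbours of the centre
    -- become pendent edges at it, which costs one edge of the matching.
    below-all-free : ∀ c bs k → length bs ≡ suc k ℕ.+ suc k → let vs = map free (c ∷ bs) in
      Below (cyc (letters vs)) (sizes vs) (suc k ℕ.+ edgess vs)
    below-all-free c (a ∷ []) k e = ⊥-elim (ℕₚ.0≢1+n (≡.trans (ℕₚ.suc-injective e) (ℕₚ.+-suc k k)))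
    below-all-free c (a ∷ b ∷ []) (suc k) e = ⊥-elim (ℕₚ.0≢1+n (≡.trans (ℕₚ.suc-injective (ℕₚ.suc-injective e)) (ℕₚ.+-suc k (suc k))))
    below-all-free c (a ∷ b ∷ []) zero _ = inj₁ (below₁ (s B) (t B)
      (≽-trans (triangle-free (nonneg c) (nonneg a) (nonneg b)) (flatten₁ (flatten B)))
      (solveℕ 6 (λ sc tc sa ta sb tb →
        ((# 1) ⊹ ((# 2) ⋆ sc ⊹ tc)) ⊹ (((# 1) ⊹ ((# 2) ⋆ sa ⊹ ta)) ⊹ (((# 1) ⊹ ((# 2) ⋆ sb ⊹ tb)) ⊹ (# 0)))
        ≐ (# 3) ⊹ ((# 2) ⋆ (sc ⊹ (sa ⊹ sb)) ⊹ (tc ⊹ (ta ⊹ tb)))) ≡.refl (s c) (t c) (s a) (t a) (s b) (t b))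
      (s≤s (ℕₚ.m≤n⇒m≤1+n (ℕₚ.≤-reflexive (≡.cong (λ x → s c ℕ.+ (s a ℕ.+ x)) (ℕₚ.+-identityʳ (s b)))))))
      where B = c ⊗B (a ⊗B b)
    below-all-free c (a ∷ b ∷ x ∷ []) k e = ⊥-elim (double≢suc-double (suc k) 1 (≡.sym e))
    below-all-free c (a ∷ b ∷ x ∷ z ∷ bs) zero ()
    below-all-free c (a ∷ b ∷ x ∷ z ∷ bs) (suc k) e with pair-up k bs (len e)
      where
      len : ∀ {m} → 4 ℕ.+ m ≡ suc (suc k) ℕ.+ suc (suc k) → m ≡ k ℕ.+ k
      len {m} e = ℕₚ.+-cancelˡ-≡ 4 m (k ℕ.+ k) (≡.trans e (solveℕ 1 (λ k → (# 2) ⊹ k ⊹ ((# 2) ⊹ k) ≐ (# 4) ⊹ (k ⊹ k)) ≡.refl k))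
    ... | us , st , si , pa = below-≽
      (≽-trans (remove-free (nonneg c) (nonneg a) (nonneg b ∷ nonneg x ∷ nonneg z ∷ N-all) (two-letters₁₂ (nonneg b) (nonneg x) (nonneg z ∷ N-all)))
      (≽-trans (remove-free (nonneg (c ⊗B (leafB ⊗B a))) (nonneg b) (nonneg x ∷ nonneg z ∷ N-all) (two-letters₁₂ (nonneg x) (nonneg z) N-all))
      (≽-refl (trans (cyc-cong {l₁ ∷ zs} {l₂ ∷ zs} (l₁≈l₂ ∷ pointwise-refl)) (reflexive (≡.cong (λ l → cyc (l₂ ∷ dual x ∷ dual z ∷ letters l)) (≡.sym st)))))))
      (≡.trans (solveℕ 9 (λ sc tc sa ta sb tb x z w →
          ((# 1) ⊹ ((# 2) ⋆ sc ⊹ tc)) ⊹ (((# 1) ⊹ ((# 2) ⋆ sa ⊹ ta)) ⊹ (((# 1) ⊹ ((# 2) ⋆ sb ⊹ tb)) ⊹ (x ⊹ (z ⊹ w))))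
          ≐ ((# 1) ⊹ ((# 2) ⋆ (sc ⊹ (sa ⊹ sb)) ⊹ ((# 1) ⊹ (tc ⊹ (ta ⊹ ((# 1) ⊹ tb)))))) ⊹ (x ⊹ (z ⊹ w)))
          ≡.refl (s c) (t c) (s a) (t a) (s b) (t b) (size (free x)) (size (free z)) (sizes (map free bs)))
        (≡.cong (λ l → size C ℕ.+ (size (free x) ℕ.+ (size (free z) ℕ.+ sizes l))) (≡.sym st)))
      (≡.trans (solveℕ 7 (λ k c a b x z w →
          ((# 2) ⊹ k) ⊹ (c ⊹ (a ⊹ (b ⊹ (x ⊹ (z ⊹ w))))) ≐ ((# 1) ⊹ k) ⊹ (((# 1) ⊹ ((c ⊹ (a ⊹ b)) ⊹ (# 0))) ⊹ (x ⊹ (z ⊹ w))))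
          ≡.refl k (s c) (s a) (s b) (s x) (s z) (edgess (map free bs)))
        (≡.cong₂ (λ p l → suc p ℕ.+ (edges C ℕ.+ (s x ℕ.+ (s z ℕ.+ edgess l)))) (≡.sym pa) (≡.sym st)))
      (only-pairs (c ⊗B (a ⊗B (leafB ⊗B b))) emptyB x z us si)
      where
      -- One of the two new pendent edges is declared the partner of the centre, so that
      -- `only-pairs` applies.
      C = joined (c ⊗B (a ⊗B (leafB ⊗B b))) emptyB
      zs = dual x ∷ dual z ∷ letters (map free bs)
      l₁ = (dual c ⊗ (leafD ⊗ dual a)) ⊗ (leafD ⊗ dual b)
      l₂ = letter C
      N-all : All ND (letters (map free bs))
      N-all = N-letters (map free bs)
      l₁≈l₂ : l₁ ≈₂ l₂
      l₁≈l₂ = ≈₂-trans (⊗-cong (⊗-swap (dual c) leafD (dual a)) ≈₂-refl)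
        (≈₂-trans (⊗-assoc leafD (dual c ⊗ dual a) (leafD ⊗ dual b))
        (≈₂-trans (⊗-cong ≈₂-refl (⊗-assoc (dual c) (dual a) (leafD ⊗ dual b)))
                  (⊗-cong (≈₂-sym unD-one) ≈₂-refl)))

-- Determinants over lists of vertices, and elimination of a pendent vertex

module ListDeterminants where
  open import Algebra.Solver.Ring.AlmostCommutativeRing using (_-Raw-AlmostCommutative⟶_)
  import Data.Integer as ℤ
  open import Data.List.Relation.Unary.All.Properties using (++⁺)
  open import Data.List.Relation.Binary.Permutation.Propositional using (_↭_) renaming (refl to ↭refl; prep to ↭prep; swap to ↭swap; trans to ↭trans)
  open import Relation.Binary.PropositionalEquality as ≡ using (_≡_; _≢_)
  open import Defs using (b2ℕ; sign)
  open Cones using (Cone; module Core)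

  module Det (S : Cone) (V : Set) where
    open Core S public

    -- Alternating sum in which `pre` holds the entries already passed, so that each summand sees
    -- all other entries in their order. With lists of vertices as indices, deleting or permuting
    -- vertices needs no renumbering.
    alt : (V → List V → Carrier) → List V → List V → Carrier
    alt f pre [] = κ 0
    alt f pre (x ∷ xs) = f x (pre ++ xs) - alt f (pre ++ [ x ]) xs

    D : (V → V → Carrier) → List V → List V → Carrier
    D M [] [] = κ 1
    D M [] (_ ∷ _) = κ 0
    D M (r ∷ rs) cs = alt (λ c rest → M r c * D M rs rest) [] cs

    sub-cong : ∀ {a a' b b'} → a ≈ a' → b ≈ b' → a - b ≈ a' - b'
    sub-cong e f = +-cong e (-‿cong f)

    alt-cong : (P : V → Set) → ∀ {f g} → (∀ x rest → P x → All P rest → f x rest ≈ g x rest) →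
      ∀ pre xs → All P pre → All P xs → alt f pre xs ≈ alt g pre xs
    alt-cong P e pre [] _ _ = refl
    alt-cong P e pre (x ∷ xs) ps (q ∷ qs) = sub-cong (e x (pre ++ xs) q (++⁺ ps qs)) (alt-cong P e (pre ++ [ x ]) xs (++⁺ ps (q ∷ [])) qs)

    alt-cong′ : ∀ {f g} pre xs → All (λ x → ∀ rest → f x rest ≈ g x rest) xs → alt f pre xs ≈ alt g pre xs
    alt-cong′ pre [] [] = refl
    alt-cong′ pre (x ∷ xs) (e ∷ es) = sub-cong (e _) (alt-cong′ _ xs es)

    alt-zero : ∀ f pre xs → All (λ x → ∀ rest → f x rest ≈ κ 0) xs → alt f pre xs ≈ κ 0
    alt-zero f pre [] _ = refl
    alt-zero f pre (x ∷ xs) (z ∷ zs) = trans (sub-cong (z _) (alt-zero f _ xs zs)) (solve 0 (k 0 :- k 0 := k 0) refl)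

    alt-scale : ∀ a f pre xs → alt (λ x rest → a * f x rest) pre xs ≈ a * alt f pre xs
    alt-scale a f pre [] = solve 1 (λ a → k 0 := a :* k 0) refl a
    alt-scale a f pre (x ∷ xs) = trans (sub-cong refl (alt-scale a f _ xs))
      (solve 3 (λ a b c → a :* b :- a :* c := a :* (b :- c)) refl a (f x (pre ++ xs)) (alt f (pre ++ [ x ]) xs))

    alt-sub : ∀ f g pre xs → alt (λ x rest → f x rest - g x rest) pre xs ≈ alt f pre xs - alt g pre xs
    alt-sub f g pre [] = solve 0 (k 0 := k 0 :- k 0) refl
    alt-sub f g pre (x ∷ xs) = trans (sub-cong refl (alt-sub f g _ xs))
      (solve 4 (λ a b c d → (a :- b) :- (c :- d) := (a :- c) :- (b :- d)) refl (f x (pre ++ xs)) (g x (pre ++ xs)) (alt f (pre ++ [ x ]) xs) (alt g (pre ++ [ x ]) xs))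

    alt-shift : ∀ f r pre xs → alt f (r ∷ pre) xs ≈ alt (λ x rest → f x (r ∷ rest)) pre xs
    alt-shift f r pre [] = refl
    alt-shift f r pre (x ∷ xs) = sub-cong refl (alt-shift f r (pre ++ [ x ]) xs)

    D-cong : (P Q : V → Set) → ∀ {M M'} → (∀ r c → P r → Q c → M r c ≈ M' r c) →
      ∀ rs cs → All P rs → All Q cs → D M rs cs ≈ D M' rs cs
    D-cong P Q e [] [] _ _ = refl
    D-cong P Q e [] (_ ∷ _) _ _ = refl
    D-cong P Q e (r ∷ rs) cs (p ∷ ps) qs =
      alt-cong Q (λ x rest q qs' → *-cong (e r x p q) (D-cong P Q e rs rest ps qs')) [] cs [] qs

    D-negate : ∀ M rs cs → D (λ r c → - M r c) rs cs ≈ embed (sign (length rs)) * D M rs cs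
    D-negate M [] [] = solve 0 (k 1 := k 1 :* k 1) refl
    D-negate M [] (_ ∷ _) = solve 0 (k 0 := k 1 :* k 0) refl
    D-negate M (r ∷ rs) cs = trans
      (alt-cong′ [] cs (All.universal (λ c rest → trans (*-congˡ (D-negate M rs rest))
        (solve 3 (λ m s d → (:- m) :* (s :* d) := (:- s) :* (m :* d)) refl (M r c) (embed (sign (length rs))) (D M rs rest))) cs))
      (trans (alt-scale (- embed (sign (length rs))) _ [] cs) (*-congʳ (sym (-‿homo (sign (length rs))))))

    Anti : V → V → (List V → Carrier) → Set
    Anti a b g = ∀ us vs → g (us ++ a ∷ b ∷ vs) ≈ - g (us ++ b ∷ a ∷ vs)

    alt-anti-prefix : ∀ f a b → (∀ x → Anti a b (f x)) → ∀ us vs xs → alt f (us ++ a ∷ b ∷ vs) xs ≈ - alt f (us ++ b ∷ a ∷ vs) xs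
    alt-anti-prefix f a b h us vs [] = solve 0 (k 0 := :- k 0) refl
    alt-anti-prefix f a b h us vs (x ∷ xs)
      rewrite ++-assoc us (a ∷ b ∷ vs) xs | ++-assoc us (b ∷ a ∷ vs) xs
            | ++-assoc us (a ∷ b ∷ vs) [ x ] | ++-assoc us (b ∷ a ∷ vs) [ x ] =
      trans (sub-cong (h x us (vs ++ xs)) (alt-anti-prefix f a b h us (vs ++ [ x ]) xs))
        (solve 2 (λ a b → (:- a) :- (:- b) := :- (a :- b)) refl _ _)

    alt-anti : ∀ f a b → (∀ x → Anti a b (f x)) → ∀ pre xs ys → alt f pre (xs ++ a ∷ b ∷ ys) ≈ - alt f pre (xs ++ b ∷ a ∷ ys)
    alt-anti f a b h pre [] ys
      rewrite ++-assoc pre [ a ] ys | ++-assoc pre [ b ] ys | ++-assoc pre [ a ] [ b ] | ++-assoc pre [ b ] [ a ] =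
      trans (sub-cong refl (sub-cong refl (alt-anti-prefix f a b h pre [] ys)))
        (solve 3 (λ a b c → a :- (b :- (:- c)) := :- (b :- (a :- c))) refl _ _ _)
    alt-anti f a b h pre (x ∷ xs) ys
      rewrite ≡.sym (++-assoc pre xs (a ∷ b ∷ ys)) | ≡.sym (++-assoc pre xs (b ∷ a ∷ ys)) =
      trans (sub-cong (h x (pre ++ xs) ys) (alt-anti f a b h (pre ++ [ x ]) xs ys))
        (solve 2 (λ a b → (:- a) :- (:- b) := :- (a :- b)) refl _ _)

    neg-zero : κ 0 ≈ - κ 0
    neg-zero = solve 0 (k 0 := :- k 0) refl

    D-anti-cols : ∀ M rs a b → Anti a b (D M rs)
    D-anti-cols M [] a b [] vs = neg-zero
    D-anti-cols M [] a b (_ ∷ us) vs = neg-zero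
    D-anti-cols M (r ∷ rs) a b us vs = alt-anti _ a b
      (λ x us vs → trans (*-congˡ (D-anti-cols M rs a b us vs)) (solve 2 (λ m d → m :* (:- d) := :- (m :* d)) refl _ _)) [] us vs

    -- Expanding a row and a column in either order gives the same double sum. `exchange`
    -- generalises over the columns already passed, with `c` in front of them.
    D-column : ∀ M rs c cs → D M rs (c ∷ cs) ≈ alt (λ r rest → M r c * D M rest cs) [] rs
    D-column M [] c cs = refl
    D-column M (r ∷ rs) c cs = sub-cong refl (trans (exchange [] cs) (sym (alt-shift _ r [] rs)))
      where
      exchange : ∀ pre xs → alt (λ x rest → M r x * D M rs rest) (c ∷ pre) xs
        ≈ alt (λ r' rest → M r' c * alt (λ x rest' → M r x * D M rest rest') pre xs) [] rs
      exchange pre [] = sym (alt-zero _ [] rs (All.universal (λ r' _ → solve 1 (λ a → a :* k 0 := k 0) refl (M r' c)) rs))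
      exchange pre (x ∷ xs) = trans
        (sub-cong (trans (*-congˡ (D-column M rs c (pre ++ xs))) (sym (alt-scale (M r x) _ [] rs))) (exchange (pre ++ [ x ]) xs))
        (trans (sym (alt-sub _ _ [] rs))
          (alt-cong′ [] rs (All.universal (λ r' rest → solve 4 (λ a b c d → a :* (b :* c) :- b :* d := b :* (a :* c :- d)) refl (M r x) (M r' c) _ _) rs)))

    D-anti-rows : ∀ M cs a b → Anti a b (λ rs → D M rs cs)
    D-anti-rows M [] a b [] vs = neg-zero
    D-anti-rows M [] a b (_ ∷ us) vs = neg-zero
    D-anti-rows M (c ∷ cs) a b us vs = trans (D-column M (us ++ a ∷ b ∷ vs) c cs)
      (trans (alt-anti _ a b (λ x us vs → trans (*-congˡ (D-anti-rows M cs a b us vs)) (solve 2 (λ m d → m :* (:- d) := :- (m :* d)) refl _ _)) [] us vs)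
        (-‿cong (sym (D-column M (us ++ b ∷ a ∷ vs) c cs))))

    det : (V → V → Carrier) → List V → Carrier
    det M vs = D M vs vs

    -- The same transposition acts on rows and on columns, and the two signs cancel.
    det-swap : ∀ M us a b vs → det M (us ++ a ∷ b ∷ vs) ≈ det M (us ++ b ∷ a ∷ vs)
    det-swap M us a b vs = trans (D-anti-cols M (us ++ a ∷ b ∷ vs) a b us vs)
      (trans (-‿cong (D-anti-rows M (us ++ b ∷ a ∷ vs) a b us vs)) (solve 1 (λ a → :- (:- a) := a) refl _))

    det-↭-prefix : ∀ M pre {vs ws} → vs ↭ ws → det M (pre ++ vs) ≈ det M (pre ++ ws)
    det-↭-prefix M pre ↭refl = refl
    det-↭-prefix M pre (↭prep {xs} {ys} x p) = ≡.subst₂ (λ a b → det M a ≈ det M b) (++-assoc pre [ x ] xs) (++-assoc pre [ x ] ys) (det-↭-prefix M (pre ++ [ x ]) p)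
    det-↭-prefix M pre (↭swap {xs} {ys} x z p) = trans (det-swap M pre x z xs)
      (≡.subst₂ (λ a b → det M a ≈ det M b) (++-assoc pre (z ∷ x ∷ []) xs) (++-assoc pre (z ∷ x ∷ []) ys) (det-↭-prefix M (pre ++ z ∷ x ∷ []) p))
    det-↭-prefix M pre (↭trans p q) = trans (det-↭-prefix M pre p) (det-↭-prefix M pre q)

    det-↭ : ∀ M {vs ws} → vs ↭ ws → det M vs ≈ det M ws
    det-↭ M = det-↭-prefix M []

    0*-zero : ∀ {a} b → a ≈ κ 0 → a * b ≈ κ 0
    0*-zero b e = trans (*-congʳ e) (solve 1 (λ b → k 0 :* b := k 0) refl b)

    det-pendent : ∀ M w u zs → All (λ z → M w z ≈ κ 0) zs → All (λ z → M z w ≈ κ 0) zs →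
      det M (w ∷ u ∷ zs) ≈ M w w * det M (u ∷ zs) - M w u * (M u w * det M zs)
    det-pendent M w u zs row col = sub-cong refl
      (trans (sub-cong (*-congˡ column) (alt-zero _ _ zs (All.map (λ e rest → 0*-zero _ e) row)))
        (solve 1 (λ a → a :- k 0 := a) refl _))
      where
      column : D M (u ∷ zs) (w ∷ zs) ≈ M u w * det M zs
      column = trans (D-column M (u ∷ zs) w zs)
        (trans (sub-cong refl (alt-zero _ _ zs (All.map (λ e rest → 0*-zero _ e) col))) (solve 1 (λ a → a :- k 0 := a) refl _))

  module Weighted (S : Cone) (V : Set) (_≟_ : DecidableEquality V) where
    open Det S V public

    deg : (V → V → Bool) → List V → V → ℕ
    deg G [] u = 0
    deg G (v ∷ vs) u = b2ℕ (G u v) ℕ.+ deg G vs u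

    diag : (V → V → Bool) → (V → Dual) → List V → V → Carrier
    diag G ℓ vs u = (y * proj₁ (ℓ u) + proj₂ (ℓ u)) + κ (deg G vs u) * proj₁ (ℓ u)

    -- Row u of diag(y + C/F) + Q(G), multiplied by F, where (F , C) = ℓ u.
    matrix : (V → V → Bool) → (V → Dual) → List V → V → V → Carrier
    matrix G ℓ vs u v = (if does (u ≟ v) then diag G ℓ vs u else κ 0) + proj₁ (ℓ u) * κ (b2ℕ (G u v))

    P : (V → V → Bool) → (V → Dual) → List V → Carrier
    P G ℓ vs = det (matrix G ℓ vs) vs

    matrix-diag : ∀ G ℓ vs u → G u u ≡ false → matrix G ℓ vs u u ≈ diag G ℓ vs u
    matrix-diag G ℓ vs u e with u ≟ u
    ... | yes _ rewrite e = solve 2 (λ a b → a :+ b :* k 0 := a) refl _ _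
    ... | no ne = ⊥-elim (ne ≡.refl)

    matrix-off : ∀ G ℓ vs u v {b} → u ≢ v → G u v ≡ b → matrix G ℓ vs u v ≈ proj₁ (ℓ u) * κ (b2ℕ b)
    matrix-off G ℓ vs u v ne ≡.refl with u ≟ v
    ... | yes e = ⊥-elim (ne e)
    ... | no _ = solve 1 (λ a → k 0 :+ a := a) refl _

    deg-none : ∀ G u vs → All (λ v → G u v ≡ false) vs → deg G vs u ≡ 0
    deg-none G u [] [] = ≡.refl
    deg-none G u (v ∷ vs) (e ∷ es) rewrite e = deg-none G u vs es

    update : V → Dual → (V → Dual) → V → Dual
    update u a ℓ v = if does (v ≟ u) then a else ℓ v

    update-same : ∀ u a ℓ → update u a ℓ u ≡ a
    update-same u a ℓ with u ≟ u
    ... | yes _ = ≡.refl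
    ... | no ne = ⊥-elim (ne ≡.refl)

    update-other : ∀ u a ℓ v → v ≢ u → update u a ℓ v ≡ ℓ v
    update-other u a ℓ v ne with v ≟ u
    ... | yes e = ⊥-elim (ne e)
    ... | no _ = ≡.refl

    update-cong : ∀ r {x x'} {ℓ ℓ' : V → Dual} → x ≈₂ x' → ∀ u → (u ≢ r → ℓ u ≈₂ ℓ' u) → update r x ℓ u ≈₂ update r x' ℓ' u
    update-cong r e u f with u ≟ r
    ... | yes _ = e
    ... | no ne = f ne

    update-self : ∀ r (ℓ : V → Dual) {x} → ℓ r ≈₂ x → ∀ u → ℓ u ≈₂ update r x ℓ u
    update-self r ℓ e u with u ≟ r
    ... | yes ≡.refl = e
    ... | no _ = ≈₂-refl

    κ-suc : ∀ n → κ (suc n) ≈ κ 1 + κ n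
    κ-suc n = _-Raw-AlmostCommutative⟶_.+-homo hom (ℤ.+ 1) (ℤ.+ n)

    record Pendent (G : V → V → Bool) (w u : V) (zs : List V) : Set where
      field
        w≢u   : w ≢ u
        w∉zs  : All (w ≢_) zs
        u∉zs  : All (u ≢_) zs
        loop  : ∀ v → G v v ≡ false
        symm  : ∀ v v' → G v v' ≡ G v' v
        edge  : G w u ≡ true
        other : All (λ z → G w z ≡ false) zs

    -- A Schur complement without division: the pivot of `w` is multiplied into row `u`, which is
    -- why rows are scaled. The remaining rows do not change, since none of their vertices is
    -- adjacent to `w`.
    eliminate : ∀ G ℓ w u zs → Pendent G w u zs →
      P G ℓ (w ∷ u ∷ zs) ≈ P G (update u (unD (ℓ w) ⊗ ℓ u) ℓ) (u ∷ zs)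
    eliminate G ℓ w u zs pen = trans
      (det-pendent M w u zs
        (All.zipWith (λ { {z} (ne , e) → trans (matrix-off G ℓ vs w z ne e) (solve 1 (λ a → a :* k 0 := k 0) refl _) }) (w∉zs , other))
        (All.zipWith (λ { {z} (ne , e) → trans (matrix-off G ℓ vs z w (λ q → ne (≡.sym q)) (≡.trans (symm z w) e)) (solve 1 (λ a → a :* k 0 := k 0) refl _) }) (w∉zs , other)))
      (trans (sub-cong (*-cong Mww (sub-cong (*-congʳ Muu) refl)) (*-cong Mwu (*-congʳ Muw)))
      (trans (solve 8 (λ A B F C d y Dz T →
          let f = (k 1 :+ y) :* A :+ B ; q = y :* A :+ B in
          ((y :* A :+ B) :+ k 1 :* A) :* (((y :* F :+ C) :+ (k 1 :+ d) :* F) :* Dz :- T) :- A :* (F :* Dz)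
          := ((y :* (f :* F) :+ (f :* C :+ q :* F)) :+ d :* (f :* F)) :* Dz :- f :* T)
          refl (proj₁ (ℓ w)) (proj₂ (ℓ w)) (proj₁ (ℓ u)) (proj₂ (ℓ u)) (κ d) y (det M zs) T)
      (sub-cong (*-cong (sym M'uu) (D-cong (λ z → z ≢ w × z ≢ u × G z w ≡ false) (λ _ → ⊤) rows zs zs zs-ok (All.universal _ zs)))
        (trans (sym (alt-scale f _ [ u ] zs)) (alt-cong′ [ u ] zs (All.map (λ {x} ne rest → row x rest ne) u∉zs))))))
      where
      open Pendent pen
      vs = w ∷ u ∷ zs
      ℓ' = update u (unD (ℓ w) ⊗ ℓ u) ℓ
      M = matrix G ℓ vs
      M' = matrix G ℓ' (u ∷ zs)
      d = deg G zs u
      f = (κ 1 + y) * proj₁ (ℓ w) + proj₂ (ℓ w)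
      -- The part of the expansion along row `u` off the diagonal; it merely acquires the factor
      -- `f`.
      T = alt (λ c rest → M u c * D M zs rest) [ u ] zs
      Mww : M w w ≈ (y * proj₁ (ℓ w) + proj₂ (ℓ w)) + κ 1 * proj₁ (ℓ w)
      Mww = trans (matrix-diag G ℓ vs w (loop w)) (reflexive (≡.cong (λ n → (y * proj₁ (ℓ w) + proj₂ (ℓ w)) + κ n * proj₁ (ℓ w))
        (≡.cong₂ ℕ._+_ (≡.cong b2ℕ (loop w)) (≡.cong₂ ℕ._+_ (≡.cong b2ℕ edge) (deg-none G w zs other)))))
      Muu : M u u ≈ (y * proj₁ (ℓ u) + proj₂ (ℓ u)) + (κ 1 + κ d) * proj₁ (ℓ u)
      Muu = trans (matrix-diag G ℓ vs u (loop u)) (+-congˡ (*-congʳ (trans (reflexive (≡.cong κ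
        (≡.cong₂ ℕ._+_ (≡.cong b2ℕ (≡.trans (symm u w) edge)) (≡.cong (λ b → b2ℕ b ℕ.+ d) (loop u))))) (κ-suc d))))
      Mwu : M w u ≈ proj₁ (ℓ w)
      Mwu = trans (matrix-off G ℓ vs w u w≢u edge) (solve 1 (λ a → a :* k 1 := a) refl _)
      Muw : M u w ≈ proj₁ (ℓ u)
      Muw = trans (matrix-off G ℓ vs u w (λ e → w≢u (≡.sym e)) (≡.trans (symm u w) edge)) (solve 1 (λ a → a :* k 1 := a) refl _)
      M'uu : M' u u ≈ (y * proj₁ (unD (ℓ w) ⊗ ℓ u) + proj₂ (unD (ℓ w) ⊗ ℓ u)) + κ d * proj₁ (unD (ℓ w) ⊗ ℓ u)
      M'uu = trans (matrix-diag G ℓ' (u ∷ zs) u (loop u)) (reflexive (≡.cong₂ (λ a n → (y * proj₁ a + proj₂ a) + κ n * proj₁ a)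
        (update-same u _ ℓ) (≡.cong (λ b → b2ℕ b ℕ.+ d) (loop u))))
      zs-ok : All (λ z → z ≢ w × z ≢ u × G z w ≡ false) zs
      zs-ok = All.zipWith (λ { {z} (a , b , e) → (λ q → a (≡.sym q)) , (λ q → b (≡.sym q)) , ≡.trans (symm z w) e }) (w∉zs , All.zip (u∉zs , other))
      rows : ∀ r c → r ≢ w × r ≢ u × G r w ≡ false → ⊤ → M r c ≈ M' r c
      rows r c (_ , r≢u , e) _ rewrite update-other u (unD (ℓ w) ⊗ ℓ u) ℓ r r≢u | e = refl
      row : ∀ x rest → u ≢ x → f * (M u x * D M zs rest) ≈ M' u x * D M' zs rest
      row x rest ne = trans (sym (*-assoc f _ _)) (*-cong
        (trans (*-congˡ (matrix-off G ℓ vs u x ne ≡.refl)) (trans (sym (*-assoc f _ _))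
          (trans (reflexive (≡.cong (λ a → proj₁ a * κ (b2ℕ (G u x))) (≡.sym (update-same u (unD (ℓ w) ⊗ ℓ u) ℓ))))
            (sym (matrix-off G ℓ' (u ∷ zs) u x ne ≡.refl)))))
        (D-cong (λ z → z ≢ w × z ≢ u × G z w ≡ false) (λ _ → ⊤) rows zs rest zs-ok (All.universal _ rest)))

    deg-cong : ∀ {G G'} u vs → All (λ v → G u v ≡ G' u v) vs → deg G vs u ≡ deg G' vs u
    deg-cong u [] [] = ≡.refl
    deg-cong u (v ∷ vs) (e ∷ es) = ≡.cong₂ (λ b d → b2ℕ b ℕ.+ d) e (deg-cong u vs es)

    deg-↭ : ∀ G u {vs ws} → vs ↭ ws → deg G vs u ≡ deg G ws u
    deg-↭ G u ↭refl = ≡.refl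
    deg-↭ G u (↭prep x p) = ≡.cong (b2ℕ (G u x) ℕ.+_) (deg-↭ G u p)
    deg-↭ G u (↭swap {xs} x z p) = ≡.trans (≡.sym (ℕₚ.+-assoc (b2ℕ (G u x)) _ _)) (≡.trans (≡.cong₂ ℕ._+_ (ℕₚ.+-comm (b2ℕ (G u x)) (b2ℕ (G u z))) (deg-↭ G u p)) (ℕₚ.+-assoc (b2ℕ (G u z)) _ _))
    deg-↭ G u (↭trans p q) = ≡.trans (deg-↭ G u p) (deg-↭ G u q)

    P-↭ : ∀ G ℓ {vs ws} → vs ↭ ws → P G ℓ vs ≈ P G ℓ ws
    P-↭ G ℓ {vs} {ws} p = trans (D-cong (λ _ → ⊤) (λ _ → ⊤) entry vs vs (All.universal _ vs) (All.universal _ vs)) (det-↭ (matrix G ℓ ws) p)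
      where
      entry : ∀ r c → ⊤ → ⊤ → matrix G ℓ vs r c ≈ matrix G ℓ ws r c
      entry r c _ _ rewrite deg-↭ G r p = refl

    P-cong : ∀ {G G' ℓ ℓ'} vs → All (λ u → All (λ v → G u v ≡ G' u v) vs) vs → All (λ u → ℓ u ≈₂ ℓ' u) vs → P G ℓ vs ≈ P G' ℓ' vs
    P-cong {G} {G'} {ℓ} {ℓ'} vs eG eℓ = D-cong (λ u → All (λ v → G u v ≡ G' u v) vs × ℓ u ≈₂ ℓ' u) (_∈ vs) entry vs vs (All.zip (eG , eℓ)) (All.tabulate (λ m → m))
      where
      entry : ∀ r c → All (λ v → G r v ≡ G' r v) vs × ℓ r ≈₂ ℓ' r → c ∈ vs → matrix G ℓ vs r c ≈ matrix G' ℓ' vs r c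
      entry r c (eG , (e , f)) c∈ rewrite All.lookup eG c∈ | deg-cong {G} {G'} r vs eG with does (r ≟ c)
      ... | true = +-cong (+-cong (+-cong (*-congˡ e) f) (*-congˡ e)) (*-congʳ e)
      ... | false = +-congˡ (*-congʳ e)

    P-congℓ : ∀ G ℓ ℓ' vs → All (λ u → ℓ u ≈₂ ℓ' u) vs → P G ℓ vs ≈ P G ℓ' vs
    P-congℓ G ℓ ℓ' vs = P-cong {G} {G} {ℓ} {ℓ'} vs (All.universal (λ _ → All.universal (λ _ → ≡.refl) vs) vs)

-- The determinant of a weighted odd cycle

module CycleDeterminants where
  open import Data.List.Relation.Unary.All.Properties using (++⁻ˡ)
  open import Relation.Binary.PropositionalEquality as ≡ using (_≡_)
  open Cones using (Cone)
  open ListDeterminants using (module Det)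

  module CycleDet (S : Cone) (V : Set) where
    open Det S V public

    module _ (ℓ : V → Dual) (M : V → V → Carrier) where
      h a : V → Carrier
      h v = proj₁ (ℓ v)
      a v = (y * h v + proj₂ (ℓ v)) + κ 2 * h v

      -- A path inside the cycle: its end vertices keep degree 2, so all diagonal entries have the
      -- same form.
      data Chain : List V → Set where
        end  : ∀ {x} → M x x ≈ a x → Chain [ x ]
        link : ∀ {x x' zs} → M x x ≈ a x → M x x' ≈ h x → M x' x ≈ h x' →
          All (λ z → M x z ≈ κ 0) zs → All (λ z → M z x ≈ κ 0) zs → Chain (x' ∷ zs) → Chain (x ∷ x' ∷ zs)

      -- The first column sum of the product is the continuant, the determinant of the tridiagonal
      -- matrix of the path.
      K : List V → Carrier
      K xs = e₁₁ (Π (map ℓ xs)) + e₂₁ (Π (map ℓ xs))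

      -- The difference of the column sums returns the determinant with one vertex less, so one
      -- matrix product carries both terms of the recurrence.
      K-tail : ∀ x xs → h x * K xs ≈ let A = Π (map ℓ (x ∷ xs)) in (e₁₁ A + e₂₁ A) - (e₁₂ A + e₂₂ A)
      K-tail x xs = solve 6 (λ p r s w F q → F :* (p :+ s) :=
          ((p :* (F :+ q) :+ r :* F) :+ (s :* (F :+ q) :+ w :* F)) :- ((p :* q :+ r :* F) :+ (s :* q :+ w :* F)))
        refl (e₁₁ A) (e₁₂ A) (e₂₁ A) (e₂₂ A) (h x) (y * h x + proj₂ (ℓ x))
        where A = Π (map ℓ xs)

      K-init : ∀ xs z → h z * K xs ≈ e₂₁ (Π (map ℓ (xs ++ [ z ])))
      K-init xs z = sym (trans (reflexive (≡.cong (λ l → e₂₁ (Π l)) (map-++ ℓ xs [ z ])))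
        (trans (_≈ₘ_.q₂₁ (Π-++ (map ℓ xs) [ ℓ z ]))
        (solve 4 (λ p s F q → (k 0 :* (F :+ q) :+ k 1 :* F) :* p :+ (k 0 :* q :+ k 1 :* F) :* s := F :* (p :+ s))
          refl (e₁₁ A) (e₂₁ A) (h z) (y * h z + proj₂ (ℓ z)))))
        where A = Π (map ℓ xs)

      det-chain : ∀ {xs} → Chain xs → det M xs ≈ K xs
      det-chain (end {x} e) = trans (sub-cong (*-congʳ e) refl)
        (solve 3 (λ y F C → ((y :* F :+ C) :+ k 2 :* F) :* k 1 :- k 0 :=
           (k 1 :* (F :+ (y :* F :+ C)) :+ k 0 :* F) :+ (k 0 :* (F :+ (y :* F :+ C)) :+ k 1 :* F)) refl y (h x) (proj₂ (ℓ x)))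
      det-chain (link {x} {x'} {zs} e e₁ e₂ z₁ z₂ ch) = trans (det-pendent M x x' zs z₁ z₂)
        (trans (sub-cong (*-cong e (det-chain ch)) (*-cong e₁ (trans (*-cong e₂ (tail ch)) (K-tail x' zs))))
        (solve 6 (λ p r s w F q → (q :+ k 2 :* F) :* (p :+ s) :- F :* ((p :+ s) :- (r :+ w)) :=
           (p :* (F :+ q) :+ r :* F) :+ (s :* (F :+ q) :+ w :* F))
          refl (e₁₁ A) (e₁₂ A) (e₂₁ A) (e₂₂ A) (h x) (y * h x + proj₂ (ℓ x))))
        where
        A = Π (map ℓ (x' ∷ zs))
        tail : ∀ {x zs} → Chain (x ∷ zs) → det M zs ≈ K zs
        tail (end _) = solve 0 (k 1 := k 1 :+ k 0) refl
        tail (link _ _ _ _ _ ch) = det-chain ch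

      -- Without its first row and last column a tridiagonal matrix is triangular, with one entry
      -- `h` per remaining row on the diagonal; `minor-upper` is the mirror case.
      minor-lower : ∀ v xs z → Chain (v ∷ xs ++ [ z ]) → D M (xs ++ [ z ]) (v ∷ xs) ≈ J (map ℓ (xs ++ [ z ]))
      minor-lower v [] z (link _ _ e₂ _ _ _) = trans (sub-cong (*-congʳ e₂) refl) (solve 1 (λ a → a :* k 1 :- k 0 := k 1 :* a) refl (h z))
      minor-lower v (x ∷ xs) z (link _ _ e₂ _ z₂ ch) = trans (D-column M (x ∷ xs ++ [ z ]) v (x ∷ xs))
        (trans (sub-cong (*-cong e₂ (minor-lower x xs z ch)) (alt-zero _ _ (xs ++ [ z ]) (All.map (λ e rest → 0*-zero _ e) z₂)))
          (solve 2 (λ a b → a :* b :- k 0 := b :* a) refl (h x) (J (map ℓ (xs ++ [ z ])))))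

      minor-upper : ∀ v xs z → Chain (v ∷ xs ++ [ z ]) → D M (v ∷ xs) (xs ++ [ z ]) ≈ J (map ℓ (v ∷ xs))
      minor-upper v [] z (link _ e₁ _ _ _ _) = trans (sub-cong (*-congʳ e₁) refl) (solve 1 (λ a → a :* k 1 :- k 0 := k 1 :* a) refl (h v))
      minor-upper v (x ∷ xs) z (link _ e₁ _ z₁ _ ch) =
        trans (sub-cong (*-cong e₁ (minor-upper x xs z ch)) (alt-zero _ _ (xs ++ [ z ]) (All.map (λ e rest → 0*-zero _ e) z₁)))
          (solve 2 (λ a b → a :* b :- k 0 := b :* a) refl (h v) (J (map ℓ (x ∷ xs))))

      -- An even number of entries precedes the last one, so its sign is +. This is where the
      -- oddness of the cycle enters the determinant.
      alt-last : ∀ f pre xs z j → length xs ≡ j ℕ.+ j → All (λ x → ∀ rest → f x rest ≈ κ 0) xs →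
        alt f pre (xs ++ [ z ]) ≈ f z (pre ++ xs)
      alt-last f pre [] z zero _ _ = solve 1 (λ a → a :- k 0 := a) refl _
      alt-last f pre [] z (suc j) () _
      alt-last f pre (x ∷ []) z (suc j) e _ = ⊥-elim (ℕₚ.0≢1+n (≡.trans (ℕₚ.suc-injective e) (ℕₚ.+-suc j j)))
      alt-last f pre (x ∷ x' ∷ xs) z (suc j) e (z₁ ∷ z₂ ∷ zs) =
        trans (sub-cong (z₁ _) (sub-cong (z₂ _) (alt-last f ((pre ++ [ x ]) ++ [ x' ]) xs z j (ℕₚ.suc-injective (≡.trans (ℕₚ.suc-injective e) (ℕₚ.+-suc j j))) zs)))
          (trans (solve 1 (λ a → k 0 :- (k 0 :- a) := a) refl _)
            (reflexive (≡.cong (f z) (≡.trans (++-assoc (pre ++ [ x ]) [ x' ] xs) (++-assoc pre [ x ] (x' ∷ xs))))))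

      record IsCycle (c v : V) (xs : List V) (z : V) : Set where
        field
          chain : Chain (v ∷ xs ++ [ z ])
          Mcc   : M c c ≈ a c
          Mcv   : M c v ≈ h c
          Mvc   : M v c ≈ h v
          Mcz   : M c z ≈ h c
          Mzc   : M z c ≈ h z
          Mcx   : All (λ x → M c x ≈ κ 0) xs
          Mxc   : All (λ x → M x c ≈ κ 0) xs

      chain-tail : ∀ {v xs z} → Chain (v ∷ xs ++ [ z ]) → Chain (xs ++ [ z ])
      chain-tail {xs = []} (link _ _ _ _ _ ch) = ch
      chain-tail {xs = x ∷ xs} (link _ _ _ _ _ ch) = ch

      chain-init : ∀ v xs z → Chain (v ∷ xs ++ [ z ]) → Chain (v ∷ xs)
      chain-init v [] z (link e _ _ _ _ _) = end e
      chain-init v (x ∷ xs) z (link e e₁ e₂ z₁ z₂ ch) = link e e₁ e₂ (++⁻ˡ xs z₁) (++⁻ˡ xs z₂) (chain-init x xs z ch)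

      -- Row and column of `c` meet only `v` and `z`. Using the same neighbour in both leaves a
      -- path; using different ones leaves the two triangular minors, one per orientation of the
      -- cycle, which make up the term 2J.
      det-cycle : ∀ c v xs z j → length xs ≡ j ℕ.+ j → IsCycle c v xs z → det M (c ∷ v ∷ xs ++ [ z ]) ≈ cyc (map ℓ (c ∷ v ∷ xs ++ [ z ]))
      det-cycle c v xs z j even cy = trans expand
        (trans (solve 7 (λ F q p r s w j → (q :+ k 2 :* F) :* (p :+ s) :- (F :* (((p :+ s) :- (r :+ w)) :- j) :- F :* (j :- s)) :=
            ((p :* (F :+ q) :+ r :* F) :+ (s :* q :+ w :* F)) :+ k 2 :* (j :* F))
          refl (h c) (y * h c + proj₂ (ℓ c)) (e₁₁ A) (e₁₂ A) (e₂₁ A) (e₂₂ A) (J (map ℓ Z)))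
        refl)
        where
        open IsCycle cy
        Z = v ∷ xs ++ [ z ]
        A = Π (map ℓ Z)
        column : ∀ X → D M Z (c ∷ X) ≈ h v * D M (xs ++ [ z ]) X - h z * D M (v ∷ xs) X
        column X = trans (D-column M Z c X) (sub-cong (*-congʳ Mvc)
          (trans (alt-last _ [ v ] xs z j even (All.map (λ e rest → 0*-zero _ e) Mxc)) (*-congʳ Mzc)))
        col₁ : D M Z (c ∷ xs ++ [ z ]) ≈ ((e₁₁ A + e₂₁ A) - (e₁₂ A + e₂₂ A)) - J (map ℓ Z)
        col₁ = trans (column (xs ++ [ z ])) (sub-cong
          (trans (*-congˡ (det-chain (chain-tail chain))) (K-tail v (xs ++ [ z ])))
          (trans (*-congˡ (minor-upper v xs z chain)) (trans
            (solve 2 (λ a b → a :* b := b :* (k 1 :* a)) refl (h z) (J (map ℓ (v ∷ xs))))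
            (trans (sym (J-++ (map ℓ (v ∷ xs)) [ ℓ z ])) (reflexive (≡.cong J (≡.sym (map-++ ℓ (v ∷ xs) [ z ]))))))))
        col₂ : D M Z (c ∷ v ∷ xs) ≈ J (map ℓ Z) - e₂₁ A
        col₂ = trans (column (v ∷ xs)) (sub-cong
          (trans (*-congˡ (minor-lower v xs z chain)) (*-comm _ _))
          (trans (*-congˡ (det-chain (chain-init v xs z chain))) (K-init (v ∷ xs) z)))
        expand : det M (c ∷ Z) ≈ ((y * h c + proj₂ (ℓ c)) + κ 2 * h c) * (e₁₁ A + e₂₁ A)
          - (h c * (((e₁₁ A + e₂₁ A) - (e₁₂ A + e₂₂ A)) - J (map ℓ Z)) - h c * (J (map ℓ Z) - e₂₁ A))
        expand = sub-cong (*-cong Mcc (det-chain chain))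
          (sub-cong (*-cong Mcv col₁)
            (trans (alt-last _ (c ∷ v ∷ []) xs z j even (All.map (λ e rest → 0*-zero _ e) Mcx)) (*-cong Mcz col₂)))

-- The Laplace expansion behind `det`

module LaplaceSum where
  open import Defs
  open import Relation.Binary.PropositionalEquality using (_≡_; refl)

  term : ∀ {n} → (Fin (suc n) → Fin (suc n) → Poly) → Fin (suc n) → Poly
  term M j = scale (sign (toℕ j)) (M fzero j ⊛ det (λ i l → M (fsuc i) (punchIn j l)))

  -- The summation local to det cannot be named directly.  It is recovered as
  -- the solution of a metavariable: once the number of terms and the size of the
  -- matrix are abstracted separately, the last equation of link determines it.
  mutual
    sumFin′ : (n : ℕ) (M : Fin (suc n) → Fin (suc n) → Poly) (k : ℕ) → (Fin k → Poly) → Poly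
    sumFin′ = _

    link : ∀ k (M : Fin (suc (suc k)) → Fin (suc (suc k)) → Poly) →
      det M ≡ term M fzero ⊕ (term M (fsuc fzero) ⊕ sumFin′ (suc k) M k (λ i → term M (fsuc (fsuc i))))
    link k M with term M fzero | term M (fsuc fzero) | (λ i → term M (fsuc (fsuc i)))
    ... | a | b | g with suc k | M
    ... | n | M' = refl

-- From the characteristic polynomial of Q to list determinants

module CharacteristicPolynomials where
  open import Defs
  open LaplaceSum
  open PolynomialRing
  open Cones using (Cone)
  open ListDeterminants using (module Weighted)
  open import Data.Nat using (_≡ᵇ_)
  open import Data.Integer as ℤ using (ℤ; +_; -_)
  open import Relation.Binary.PropositionalEquality as ≡ using (_≡_; _≢_; refl; sym; trans; cong; cong₂; subst)

  -- Polynomials in x whose coefficients in y = −x are nonnegative.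
  polyCone : Cone
  polyCone = record
    { ring = PolyRing ; hom = constHom
    ; N = SignNonneg 0
    ; N-resp = λ {a} {b} e → SignNonneg-resp 0 {a} {b} e
    ; N-+ = λ {a} {b} → SignNonneg-⊕ 0 a b
    ; N-* = λ {a} {b} → SignNonneg-⊛ 0 0 a b
    ; N-κ = λ n → λ { zero → subst (+ 0 ℤ.≤_) (sym (ℤₚ.*-identityˡ (+ n))) (ℤ.+≤+ ℕ.z≤n)
                   ; (suc i) → subst (+ 0 ℤ.≤_) (sym (ℤₚ.*-zeroʳ (sign (suc i)))) ℤₚ.≤-refl }
    ; y = + 0 ∷ ℤ.-1ℤ ∷ []
    ; N-y = λ { zero → ℤ.+≤+ ℕ.z≤n ; (suc zero) → ℤ.+≤+ ℕ.z≤n ; (suc (suc i)) → subst (+ 0 ℤ.≤_) (sym (ℤₚ.*-zeroʳ (sign (suc (suc i))))) ℤₚ.≤-refl }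
    }

  ≡ᵇ-true : ∀ i → (i ≡ᵇ i) ≡ true
  ≡ᵇ-true zero = refl
  ≡ᵇ-true (suc i) = ≡ᵇ-true i

  ≡ᵇ-false : ∀ i j → i ≢ j → (i ≡ᵇ j) ≡ false
  ≡ᵇ-false zero zero ne = ⊥-elim (ne refl)
  ≡ᵇ-false zero (suc j) ne = refl
  ≡ᵇ-false (suc i) zero ne = refl
  ≡ᵇ-false (suc i) (suc j) ne = ≡ᵇ-false i j (λ e → ne (cong suc e))

  module Link {V : Set} (_≟_ : DecidableEquality V) where
    open Weighted polyCone V _≟_ using (alt; D; D-negate; P; matrix; deg; oneD; solve; _:+_; _:*_; _:=_; :-_; k; κ; y) public

    -- `punchIn` needs a nonempty index type while the recursion runs down to the empty one; hence a
    -- hypothesis over all proofs that `k` is a successor. Negating `g` at each step turns explicit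
    -- signs into the subtractions of `alt`.
    signed-sum : ∀ n M k (σ : Fin k → V) (f : V → List V → Poly) pre (g : Fin k → Poly) →
      (∀ k' (e : k ≡ suc k') → ∀ j → g (subst Fin (sym e) j) ≋ scale (sign (toℕ j)) (f (σ (subst Fin (sym e) j)) (pre ++ tabulate (λ l → σ (subst Fin (sym e) (punchIn j l)))))) →
      sumFin′ n M k g ≋ alt f pre (tabulate σ)
    signed-sum n M zero σ f pre g h = ≋-sym 0∷[]≋[]
    signed-sum n M (suc k) σ f pre g h = ⊕-cong
      (≋-trans (h k refl fzero) (scale-one _))
      (≋-trans (sum-negate k (g ∘ fsuc)) (scale-cong ℤ.-1ℤ (signed-sum n M k (σ ∘ fsuc) f (pre ++ [ σ fzero ]) (negate ∘ g ∘ fsuc) (shift k σ g h))))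
      where
      sum-negate : ∀ k (g : Fin k → Poly) → sumFin′ n M k g ≋ negate (sumFin′ n M k (negate ∘ g))
      sum-negate zero g = ≋-refl
      sum-negate (suc k) g = ≋-trans (⊕-cong (≋-sym (≋-trans (scale-scale _ _ (g fzero)) (scale-one (g fzero)))) (sum-negate k (g ∘ fsuc)))
        (≋-sym (scale-⊕ ℤ.-1ℤ (negate (g fzero)) _))
      Hyp : ∀ k → (Fin (suc k) → V) → (Fin (suc k) → Poly) → Set
      Hyp k σ g = ∀ k' (e : suc k ≡ suc k') → ∀ j → g (subst Fin (sym e) j) ≋ scale (sign (toℕ j)) (f (σ (subst Fin (sym e) j)) (pre ++ tabulate (λ l → σ (subst Fin (sym e) (punchIn j l)))))
      shift : ∀ k (σ : Fin (suc k) → V) g → Hyp k σ g → ∀ k' (e : k ≡ suc k') → ∀ j →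
        negate (g (fsuc (subst Fin (sym e) j))) ≋ scale (sign (toℕ j)) (f (σ (fsuc (subst Fin (sym e) j))) ((pre ++ [ σ fzero ]) ++ tabulate (λ l → σ (fsuc (subst Fin (sym e) (punchIn j l))))))
      shift .(suc k') σ g h k' refl j = ≋-trans (scale-cong ℤ.-1ℤ (h (suc k') refl (fsuc j)))
        (≋-trans (scale-scale ℤ.-1ℤ (- sign (toℕ j)) _)
        (mk λ i → cong₂ (λ c l → coeff (scale c (f (σ (fsuc j)) l)) i)
          (trans (ℤₚ.-1*i≡-i (- sign (toℕ j))) (ℤₚ.neg-involutive (sign (toℕ j))))
          (sym (++-assoc pre [ σ fzero ] _))))

    det-tabulate : ∀ n (M : V → V → Poly) (N : Fin n → Fin n → Poly) (ρ σ : Fin n → V) → (∀ i j → N i j ≋ M (ρ i) (σ j)) →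
      det N ≋ D M (tabulate ρ) (tabulate σ)
    det-tabulate zero M N ρ σ h = ≋-refl
    det-tabulate (suc n) M N ρ σ h = signed-sum n N (suc n) σ (λ c rest → M (ρ fzero) c ⊛ D M (tabulate (ρ ∘ fsuc)) rest) [] (term N)
      λ { .n refl j → scale-cong (sign (toℕ j)) (⊛-cong (h fzero j)
          (det-tabulate n M (λ i l → N (fsuc i) (punchIn j l)) (ρ ∘ fsuc) (σ ∘ punchIn j) (λ i l → h (fsuc i) (punchIn j l)))) }

    degree-list : ∀ (G : V → V → Bool) k (ρ : Fin k → V) u → sumℕ (λ v → b2ℕ (G u (ρ v))) ≡ deg G (tabulate ρ) u
    degree-list G zero ρ u = refl
    degree-list G (suc k) ρ u = cong (b2ℕ (G u (ρ fzero)) ℕ.+_) (degree-list G k (ρ ∘ fsuc) u)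

    -- With y = -x each entry of xI - Q is minus the entry of yI + Q, whence the sign.
    charPoly-P : ∀ n (H : Adj n) (G : V → V → Bool) (ρ : Fin n → V) → (∀ i j → ρ i ≡ ρ j → i ≡ j) → (∀ i j → H i j ≡ G (ρ i) (ρ j)) →
      (∀ v → G v v ≡ false) → charPolyQ H ≋ scale (sign n) (P G (λ _ → oneD) (tabulate ρ))
    charPoly-P n H G ρ inj HG loop = ≋-trans (det-tabulate n (λ u v → negate (M u v)) (xI-Q H) ρ ρ entry)
      (≋-trans (≋-trans (D-negate M (tabulate ρ) (tabulate ρ)) (const-⊛ (sign (length (tabulate ρ))) (D M (tabulate ρ) (tabulate ρ)))) (mk λ k → cong (λ l → coeff (scale (sign l) (P G (λ _ → oneD) (tabulate ρ))) k) (length-tabulate ρ)))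
      where
      M = matrix G (λ _ → oneD) (tabulate ρ)
      sum-cong : ∀ k {f g : Fin k → ℕ} → (∀ i → f i ≡ g i) → sumℕ f ≡ sumℕ g
      sum-cong zero e = refl
      sum-cong (suc k) e = cong₂ ℕ._+_ (e fzero) (sum-cong k (λ i → e (fsuc i)))
      degree-eq : ∀ i → degree H i ≡ deg G (tabulate ρ) (ρ i)
      degree-eq i = trans (sum-cong n (λ j → cong b2ℕ (HG i j))) (degree-list G n ρ (ρ i))
      diag-entry : ∀ d → (- (+ d)) ∷ + 1 ∷ [] ≋ negate ((((y ⊛ κ 1) ⊕ κ 0) ⊕ (κ d ⊛ κ 1)) ⊕ (κ 1 ⊛ κ 0))
      diag-entry d = ≋-trans (∷-cong (sym (trans (ℤₚ.+-identityˡ _) (ℤₚ.-1*i≡-i (+ d)))) ≋-refl)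
        (solve 2 (λ y d → (:- y) :+ (:- d) := :- (((y :* k 1 :+ k 0) :+ d :* k 1) :+ k 1 :* k 0)) ≋-refl y (κ d))
      off-entry : ∀ b → (- (+ b)) ∷ [] ≋ negate (κ 0 ⊕ (κ 1 ⊛ κ b))
      off-entry b = ≋-trans (∷-cong (sym (ℤₚ.-1*i≡-i (+ b))) ≋-refl)
        (solve 1 (λ b → :- b := :- (k 0 :+ k 1 :* b)) ≋-refl (κ b))
      entry : ∀ i j → xI-Q H i j ≋ negate (M (ρ i) (ρ j))
      entry i j with ρ i ≟ ρ j
      ... | yes e with inj i j e
      ...   | refl rewrite ≡ᵇ-true (toℕ i) | loop (ρ i) | degree-eq i = diag-entry (deg G (tabulate ρ) (ρ i))
      entry i j | no ne rewrite ≡ᵇ-false (toℕ i) (toℕ j) (λ e → ne (cong ρ (Finₚ.toℕ-injective e))) | HG i j = off-entry (b2ℕ (G (ρ i) (ρ j)))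

-- The determinants of the two candidate graphs

module ExtremalGraphs where
  open import Defs
  open Cones using (Cone)
  open CharacteristicPolynomials using (≡ᵇ-true; ≡ᵇ-false)
  open ListDeterminants using (module Weighted)
  open CycleDeterminants using (module CycleDet)
  open CycleInequalities using (module Cycles)
  open import Data.Nat using (_≡ᵇ_)
  open import Data.List.Relation.Binary.Permutation.Propositional using (_↭_; ↭-sym; ↭-trans; ↭-refl; ↭-prep; ↭-swap)
  open import Relation.Binary.PropositionalEquality as ≡ using (_≡_; _≢_)

  Edges : Set
  Edges = List (ℕ × ℕ)

  adjE : Edges → ℕ → ℕ → Bool
  adjE E a b = memEdge a b E

  adjE-++ : ∀ E E' a b → adjE (E ++ E') a b ≡ adjE E a b ∨ adjE E' a b
  adjE-++ [] E' a b = ≡.refl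
  adjE-++ ((x , z) ∷ E) E' a b rewrite adjE-++ E E' a b =
    ≡.sym (≡.trans (∨-assoc ((a ≡ᵇ x) ∧ (b ≡ᵇ z)) _ _) (≡.cong (((a ≡ᵇ x) ∧ (b ≡ᵇ z)) ∨_) (∨-assoc ((a ≡ᵇ z) ∧ (b ≡ᵇ x)) _ _)))

  adjE-comm : ∀ E E' a b → adjE (E ++ E') a b ≡ adjE (E' ++ E) a b
  adjE-comm E E' a b = ≡.trans (adjE-++ E E' a b) (≡.trans (∨-comm (adjE E a b) _) (≡.sym (adjE-++ E' E a b)))

  adjE-sym : ∀ E a b → adjE E a b ≡ adjE E b a
  adjE-sym [] a b = ≡.refl
  adjE-sym ((x , z) ∷ E) a b rewrite adjE-sym E a b | ∧-comm (a ≡ᵇ x) (b ≡ᵇ z) | ∧-comm (a ≡ᵇ z) (b ≡ᵇ x) =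
    ≡.trans (≡.sym (∨-assoc p q r)) (≡.trans (≡.cong (_∨ r) (∨-comm p q)) (∨-assoc q p r))
    where
    p = (b ≡ᵇ z) ∧ (a ≡ᵇ x)
    q = (b ≡ᵇ x) ∧ (a ≡ᵇ z)
    r = adjE E b a

  LoopFree : Edges → Set
  LoopFree = All (λ e → proj₁ e ≢ proj₂ e)

  Fresh : ℕ → Edges → Set
  Fresh v = All (λ e → v ≢ proj₁ e × v ≢ proj₂ e)

  adjE-loop : ∀ E → LoopFree E → ∀ a → adjE E a a ≡ false
  adjE-loop [] _ a = ≡.refl
  adjE-loop ((x , z) ∷ E) (ne ∷ nes) a with a ℕ.≟ x
  ... | yes ≡.refl rewrite ≡ᵇ-false a z ne | ≡ᵇ-true a = adjE-loop E nes a
  ... | no a≢x rewrite ≡ᵇ-false a x a≢x | ∧-comm (a ≡ᵇ z) false = adjE-loop E nes a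

  adjE-fresh : ∀ E v → Fresh v E → ∀ a → adjE E v a ≡ false
  adjE-fresh [] v _ a = ≡.refl
  adjE-fresh ((x , z) ∷ E) v ((n₁ , n₂) ∷ ns) a rewrite ≡ᵇ-false v x n₁ | ≡ᵇ-false v z n₂ = adjE-fresh E v ns a

  adjE-∷-fresh : ∀ r v E a b → a ≢ v → b ≢ v → adjE ((r , v) ∷ E) a b ≡ adjE E a b
  adjE-∷-fresh r v E a b na nb rewrite ≡ᵇ-false b v nb | ≡ᵇ-false a v na | ∧-comm (a ≡ᵇ r) false = ≡.refl

  adjE-new : ∀ r v E a → Fresh v E → v ≢ r → a ≢ r → adjE ((r , v) ∷ E) v a ≡ false
  adjE-new r v E a fr v≢r a≢r rewrite ≡ᵇ-false v r v≢r | ≡ᵇ-false a r a≢r | ∧-comm (v ≡ᵇ v) false = adjE-fresh E v fr a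

  adjE-edge : ∀ r v E → adjE ((r , v) ∷ E) v r ≡ true
  adjE-edge r v E rewrite ≡ᵇ-true v | ≡ᵇ-true r with (v ≡ᵇ r) ∧ (r ≡ᵇ v)
  ... | true = ≡.refl
  ... | false = ≡.refl

  upFrom : ℕ → ℕ → List ℕ
  upFrom a zero = []
  upFrom a (suc k) = a ∷ upFrom (suc a) k

  Under : ℕ → Edges → Set
  Under b = All (λ e → proj₁ e < b × proj₂ e < b)

  swapE : ∀ e e' E a b → adjE (e ∷ e' ∷ E) a b ≡ adjE (e' ∷ e ∷ E) a b
  swapE e e' E a b = ≡.trans (adjE-++ (e ∷ e' ∷ []) E a b)
    (≡.trans (≡.cong (_∨ adjE E a b) (adjE-comm [ e ] [ e' ] a b)) (≡.sym (adjE-++ (e' ∷ e ∷ []) E a b)))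

  swap-unique : ∀ {a b : ℕ} {xs} → Unique (a ∷ b ∷ xs) → Unique (b ∷ a ∷ xs)
  swap-unique ((a≢b ∷ a∉) ∷ b∉ ∷ u) = ((λ e → a≢b (≡.sym e)) ∷ b∉) ∷ a∉ ∷ u

  rotate-unique : ∀ {a b c : ℕ} {xs} → Unique (a ∷ b ∷ c ∷ xs) → Unique (c ∷ b ∷ a ∷ xs)
  rotate-unique ((a≢b ∷ a≢c ∷ a∉) ∷ (b≢c ∷ b∉) ∷ c∉ ∷ u) =
    ((λ e → b≢c (≡.sym e)) ∷ (λ e → a≢c (≡.sym e)) ∷ c∉) ∷ ((λ e → a≢b (≡.sym e)) ∷ b∉) ∷ a∉ ∷ u

  tail-unique : ∀ {a : ℕ} {xs} → Unique (a ∷ xs) → Unique xs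
  tail-unique (_ ∷ u) = u

  nxt∉ : ∀ {a b c : ℕ} {xs} → Unique (a ∷ b ∷ c ∷ xs) → All (b ≢_) (a ∷ xs)
  nxt∉ ((a≢b ∷ _) ∷ (_ ∷ b∉) ∷ _) = (λ e → a≢b (≡.sym e)) ∷ b∉

  paths2-next : ∀ r s nxt → proj₂ (paths2 r s nxt) ≡ nxt ℕ.+ s ℕ.* 2
  paths2-next r zero nxt = ≡.sym (ℕₚ.+-identityʳ nxt)
  paths2-next r (suc s) nxt = ≡.trans (paths2-next r s (suc (suc nxt))) (≡.sym (≡.trans (ℕₚ.+-suc nxt _) (≡.cong suc (ℕₚ.+-suc nxt _))))

  attach-last : ∀ r s t nxt → attach r ((s , t) ∷ []) nxt ≡ proj₁ (paths2 r s nxt) ++ (proj₁ (edges1 r t (nxt ℕ.+ s ℕ.* 2)) ++ [])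
  attach-last r s t nxt rewrite ≡.sym (paths2-next r s nxt) with paths2 r s nxt
  ... | es , nxt₁ with edges1 r t nxt₁
  ... | es₂ , nxt₂ = ≡.refl

  -- The edges attached last are moved to the front, which is the order in which pendent vertices
  -- are peeled off.
  adjE-attach : ∀ E r s t nxt a b → adjE (E ++ attach r ((s , t) ∷ []) nxt) a b
    ≡ adjE (proj₁ (edges1 r t (nxt ℕ.+ s ℕ.* 2)) ++ (proj₁ (paths2 r s nxt) ++ E)) a b
  adjE-attach E r s t nxt a b = begin
    adjE (E ++ attach r ((s , t) ∷ []) nxt) a b  ≡⟨ ≡.cong (λ l → adjE (E ++ l) a b) (attach-last r s t nxt) ⟩
    adjE (E ++ (Ps ++ (Ls ++ []))) a b           ≡⟨ ≡.cong (λ l → adjE (E ++ (Ps ++ l)) a b) (++-identityʳ Ls) ⟩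
    adjE (E ++ (Ps ++ Ls)) a b                   ≡⟨ ≡.cong (λ l → adjE l a b) (++-assoc E Ps Ls) ⟨
    adjE ((E ++ Ps) ++ Ls) a b                   ≡⟨ adjE-comm (E ++ Ps) Ls a b ⟩
    adjE (Ls ++ (E ++ Ps)) a b                   ≡⟨ adjE-++ Ls (E ++ Ps) a b ⟩
    adjE Ls a b ∨ adjE (E ++ Ps) a b             ≡⟨ ≡.cong (adjE Ls a b ∨_) (adjE-comm E Ps a b) ⟩
    adjE Ls a b ∨ adjE (Ps ++ E) a b             ≡⟨ adjE-++ Ls (Ps ++ E) a b ⟨
    adjE (Ls ++ (Ps ++ E)) a b                   ∎
    where
    open ≡.≡-Reasoning
    Ps = proj₁ (paths2 r s nxt)
    Ls = proj₁ (edges1 r t (nxt ℕ.+ s ℕ.* 2))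

  upFrom-+ : ∀ a k l → upFrom a (k ℕ.+ l) ≡ upFrom a k ++ upFrom (a ℕ.+ k) l
  upFrom-+ a zero l = ≡.cong (λ i → upFrom i l) (≡.sym (ℕₚ.+-identityʳ a))
  upFrom-+ a (suc k) l = ≡.cong (a ∷_) (≡.trans (upFrom-+ (suc a) k l) (≡.cong (λ i → upFrom (suc a) k ++ upFrom i l) (≡.sym (ℕₚ.+-suc a k))))

  module Evaluate (S : Cone) where
    open Weighted S ℕ ℕ._≟_ public

    peel : ∀ {E} E' r v zs {ℓ x} → (∀ a b → adjE E a b ≡ adjE ((r , v) ∷ E') a b) → Fresh v E' → LoopFree E' →
      Unique (v ∷ r ∷ zs) → unD (ℓ v) ⊗ ℓ r ≈₂ x → P (adjE E) ℓ (v ∷ r ∷ zs) ≈ P (adjE E') (update r x ℓ) (r ∷ zs)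
    peel {E} E' r v zs {ℓ} {x} eqE fr lf ((v≢r ∷ v∉zs) ∷ (r∉zs ∷ uq)) ex =
      trans (P-cong {adjE E} {adjE E₁} (v ∷ r ∷ zs) (All.universal (λ u → All.universal (λ w → eqE u w) _) _) (All.universal (λ u → ≈₂-refl) _))
      (trans (eliminate (adjE E₁) ℓ v r zs pen)
      (P-cong {adjE E₁} {adjE E'} {update r (unD (ℓ v) ⊗ ℓ r) ℓ} {update r x ℓ} (r ∷ zs)
        (All.map (λ v≢u → All.map (λ v≢w → adjE-∷-fresh r v E' _ _ (λ e → v≢u (≡.sym e)) (λ e → v≢w (≡.sym e))) (v≢r ∷ v∉zs)) (v≢r ∷ v∉zs))
        (All.universal (λ u → update-cong r {ℓ = ℓ} {ℓ' = ℓ} ex u (λ _ → ≈₂-refl)) (r ∷ zs))))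
      where
      E₁ = (r , v) ∷ E'
      pen : Pendent (adjE E₁) v r zs
      pen = record { w≢u = v≢r ; w∉zs = v∉zs ; u∉zs = r∉zs
        ; loop = adjE-loop E₁ ((λ e → v≢r (≡.sym e)) ∷ lf) ; symm = adjE-sym E₁ ; edge = adjE-edge r v E'
        ; other = All.map (λ r≢z → adjE-new r v E' _ fr v≢r (λ e → r≢z (≡.sym e))) r∉zs }

    record Context (r nxt : ℕ) (zs : List ℕ) (E : Edges) (ℓ : ℕ → Dual) : Set where
      field
        r<    : r < nxt
        zs<   : All (_< nxt) zs
        uniq  : Unique (r ∷ zs)
        under : Under nxt E
        free  : LoopFree E
        ones  : ∀ v → nxt ≤ v → ℓ v ≡ oneD

    context-later : ∀ {r nxt nxt' zs E ℓ x} → nxt ≤ nxt' → Context r nxt zs E ℓ → Context r nxt' zs E (update r x ℓ)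
    context-later {r} {nxt} {ℓ = ℓ} {x} le c = record
      { r< = ℕₚ.<-≤-trans r< le ; zs< = All.map (λ l → ℕₚ.<-≤-trans l le) zs< ; uniq = uniq
      ; under = All.map (λ (a , b) → ℕₚ.<-≤-trans a le , ℕₚ.<-≤-trans b le) under ; free = free
      ; ones = λ v le' → ≡.trans (update-other r x ℓ v (λ { ≡.refl → ℕₚ.<-irrefl ≡.refl (ℕₚ.<-≤-trans r< (ℕₚ.≤-trans le le')) })) (ones v (ℕₚ.≤-trans le le')) }
      where open Context c

    <⇒fresh : ∀ {v E} → Under v E → Fresh v E
    <⇒fresh = All.map λ (a , b) → (λ { ≡.refl → ℕₚ.<-irrefl ≡.refl a }) , (λ { ≡.refl → ℕₚ.<-irrefl ≡.refl b })

    edges1-fresh : ∀ r t nxt v → v ≢ r → v < nxt → Fresh v (proj₁ (edges1 r t nxt))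
    edges1-fresh r zero nxt v ne lt = []
    edges1-fresh r (suc t) nxt v ne lt = (ne , ℕₚ.<⇒≢ lt) ∷ edges1-fresh r t (suc nxt) v ne (ℕₚ.m<n⇒m<1+n lt)

    edges1-free : ∀ r t nxt → r < nxt → LoopFree (proj₁ (edges1 r t nxt))
    edges1-free r zero nxt lt = []
    edges1-free r (suc t) nxt lt = ℕₚ.<⇒≢ lt ∷ edges1-free r t (suc nxt) (ℕₚ.m<n⇒m<1+n lt)

    paths2-fresh : ∀ r s nxt v → v ≢ r → v < nxt → Fresh v (proj₁ (paths2 r s nxt))
    paths2-fresh r zero nxt v ne lt = []
    paths2-fresh r (suc s) nxt v ne lt = (ne , ℕₚ.<⇒≢ lt) ∷ (ℕₚ.<⇒≢ lt , ℕₚ.<⇒≢ (ℕₚ.m<n⇒m<1+n lt)) ∷ paths2-fresh r s (suc (suc nxt)) v ne (ℕₚ.m<n⇒m<1+n (ℕₚ.m<n⇒m<1+n lt))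

    paths2-free : ∀ r s nxt → r < nxt → LoopFree (proj₁ (paths2 r s nxt))
    paths2-free r zero nxt lt = []
    paths2-free r (suc s) nxt lt = ℕₚ.<⇒≢ lt ∷ ℕₚ.<⇒≢ (ℕₚ.n<1+n nxt) ∷ paths2-free r s (suc (suc nxt)) (ℕₚ.m<n⇒m<1+n (ℕₚ.m<n⇒m<1+n lt))

    upFrom-≢ : ∀ k a v → v < a → All (v ≢_) (upFrom a k)
    upFrom-≢ zero a v lt = []
    upFrom-≢ (suc k) a v lt = ℕₚ.<⇒≢ lt ∷ upFrom-≢ k (suc a) v (ℕₚ.m<n⇒m<1+n lt)

    upFrom-unique : ∀ k a {zs} → All (_< a) zs → Unique zs → Unique (upFrom a k ++ zs)
    upFrom-unique zero a lt u = u
    upFrom-unique (suc k) a lt u = Allₚ.++⁺ (upFrom-≢ k (suc a) a (ℕₚ.n<1+n a)) (All.map (λ l e → ℕₚ.<⇒≢ l (≡.sym e)) lt)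
      ∷ upFrom-unique k (suc a) (All.map ℕₚ.m<n⇒m<1+n lt) u

    context-unique : ∀ {r nxt zs E ℓ} k → Context r nxt zs E ℓ → Unique (r ∷ (upFrom nxt k ++ zs))
    context-unique {r} {nxt} k c = head (Context.uniq c)
      where
      open Context c
      head : Unique (r ∷ _) → Unique (r ∷ (upFrom nxt k ++ _))
      head (r∉ ∷ u) = Allₚ.++⁺ (upFrom-≢ k nxt r r<) r∉ ∷ upFrom-unique k nxt zs< u

    front : ∀ G ℓ r v zs → P G ℓ (r ∷ v ∷ zs) ≈ P G ℓ (v ∷ r ∷ zs)
    front G ℓ r v zs = P-↭ G ℓ {r ∷ v ∷ zs} {v ∷ r ∷ zs} (↭-swap r v ↭-refl)

    leaves : ∀ t {r nxt zs E ℓ} → Context r nxt zs E ℓ →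
      P (adjE (proj₁ (edges1 r t nxt) ++ E)) ℓ (r ∷ (upFrom nxt t ++ zs)) ≈ P (adjE E) (update r (Fl 0 t ⊗ ℓ r) ℓ) (r ∷ zs)
    leaves zero {r} {nxt} {zs} {E} {ℓ} c = P-congℓ (adjE E) ℓ (update r (Fl 0 0 ⊗ ℓ r) ℓ) (r ∷ zs) (All.universal (update-self r ℓ (≈₂-sym (⊗-identityˡ (ℓ r)))) _)
    leaves (suc t) {r} {nxt} {zs} {E} {ℓ} c = trans (front (adjE ((r , nxt) ∷ E')) ℓ r nxt (upFrom (suc nxt) t ++ zs))
      (trans (peel {(r , nxt) ∷ E'} E' r nxt (upFrom (suc nxt) t ++ zs) {ℓ = ℓ} {x = leafD ⊗ ℓ r} (λ _ _ → ≡.refl)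
          (Allₚ.++⁺ (edges1-fresh r t (suc nxt) nxt (λ e → ℕₚ.<⇒≢ r< (≡.sym e)) (ℕₚ.n<1+n nxt)) (<⇒fresh under))
          (Allₚ.++⁺ (edges1-free r t (suc nxt) (ℕₚ.m<n⇒m<1+n r<)) free)
          (swap-unique (context-unique (suc t) c))
          (⊗-cong (≈₂-trans (unD-cong (≈₂-reflexive (ones nxt ℕₚ.≤-refl))) unD-one) ≈₂-refl))
      (trans (leaves t (context-later {x = leafD ⊗ ℓ r} (ℕₚ.n≤1+n nxt) c))
        (P-congℓ (adjE E) (update r (Fl 0 t ⊗ ℓ₁ r) ℓ₁) (update r (Fl 0 (suc t) ⊗ ℓ r) ℓ) (r ∷ zs) (All.universal
          (λ u → update-cong r {ℓ = ℓ₁} {ℓ' = ℓ} (≈₂-trans (⊗-cong {Fl 0 t} ≈₂-refl (≈₂-reflexive (update-same r (leafD ⊗ ℓ r) ℓ)))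
            (≈₂-trans (⊗-swap (Fl 0 t) leafD (ℓ r)) (≈₂-sym (⊗-assoc leafD (Fl 0 t) (ℓ r))))) u
            (λ ne → ≈₂-reflexive (update-other r (leafD ⊗ ℓ r) ℓ u ne))) _))))
      where
      open Context c
      ℓ₁ = update r (leafD ⊗ ℓ r) ℓ
      E' = proj₁ (edges1 r t (suc nxt)) ++ E

    paths : ∀ s {r nxt zs E ℓ} → Context r nxt zs E ℓ →
      P (adjE (proj₁ (paths2 r s nxt) ++ E)) ℓ (r ∷ (upFrom nxt (s ℕ.* 2) ++ zs)) ≈ P (adjE E) (update r (Fl s 0 ⊗ ℓ r) ℓ) (r ∷ zs)
    paths zero {r} {nxt} {zs} {E} {ℓ} c = leaves zero c
    paths (suc s) {r} {nxt} {zs} {E} {ℓ} c = trans (P-↭ (adjE ((r , nxt) ∷ (nxt , suc nxt) ∷ E')) ℓ rearrange)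
      -- The far end `suc nxt` of the path goes first and turns the pair of `nxt` into `leafD`;
      -- peeling `nxt` then yields `pathD`.
      (trans (peel {(r , nxt) ∷ (nxt , suc nxt) ∷ E'} ((r , nxt) ∷ E') nxt (suc nxt) (r ∷ (upFrom (suc (suc nxt)) (s ℕ.* 2) ++ zs)) {ℓ = ℓ} {x = leafD} (swapE (r , nxt) (nxt , suc nxt) E')
          (((λ e → ℕₚ.<⇒≢ (ℕₚ.m<n⇒m<1+n r<) (≡.sym e)) , ℕₚ.1+n≢n) ∷ Allₚ.++⁺ (paths2-fresh r s (suc (suc nxt)) (suc nxt) (λ e → ℕₚ.<⇒≢ (ℕₚ.m<n⇒m<1+n r<) (≡.sym e)) (ℕₚ.n<1+n (suc nxt)))
              (<⇒fresh (All.map (λ (a , b) → ℕₚ.m<n⇒m<1+n a , ℕₚ.m<n⇒m<1+n b) under)))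
          (ℕₚ.<⇒≢ r< ∷ E'-free)
          (rotate-unique (context-unique (suc (suc (s ℕ.* 2))) c))
          (≈₂-trans (⊗-cong (≈₂-trans (unD-cong (≈₂-reflexive (ones (suc nxt) (ℕₚ.n≤1+n nxt)))) unD-one) (≈₂-reflexive (ones nxt ℕₚ.≤-refl))) (⊗-identityʳ leafD)))
      (trans (peel {(r , nxt) ∷ E'} E' r nxt (upFrom (suc (suc nxt)) (s ℕ.* 2) ++ zs) {ℓ = update nxt leafD ℓ} {x = pathD ⊗ ℓ r} (λ _ _ → ≡.refl)
          (Allₚ.++⁺ (paths2-fresh r s (suc (suc nxt)) nxt (λ e → ℕₚ.<⇒≢ r< (≡.sym e)) (ℕₚ.m<n⇒m<1+n (ℕₚ.n<1+n nxt))) (<⇒fresh under))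
          E'-free
          (tail-unique (rotate-unique (context-unique (suc (suc (s ℕ.* 2))) c)))
          (⊗-cong (≈₂-trans (unD-cong (≈₂-reflexive (update-same nxt leafD ℓ))) unD-leaf) (≈₂-reflexive (update-other nxt leafD ℓ r (ℕₚ.<⇒≢ r<)))))
      (trans (P-congℓ (adjE E') (update r (pathD ⊗ ℓ r) (update nxt leafD ℓ)) ℓ₁ (r ∷ (upFrom (suc (suc nxt)) (s ℕ.* 2) ++ zs))
          (All.map (λ {u} nxt≢u → update-cong r {ℓ = update nxt leafD ℓ} {ℓ' = ℓ} ≈₂-refl u (λ _ → ≈₂-reflexive (update-other nxt leafD ℓ u (λ e → nxt≢u (≡.sym e))))) (nxt∉ (context-unique (suc (suc (s ℕ.* 2))) c))))
      (trans (paths s (context-later {x = pathD ⊗ ℓ r} (ℕₚ.≤-trans (ℕₚ.n≤1+n nxt) (ℕₚ.n≤1+n (suc nxt))) c))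
        (P-congℓ (adjE E) (update r (Fl s 0 ⊗ ℓ₁ r) ℓ₁) (update r (Fl (suc s) 0 ⊗ ℓ r) ℓ) (r ∷ zs) (All.universal
          (λ u → update-cong r {ℓ = ℓ₁} {ℓ' = ℓ} (≈₂-trans (⊗-cong {Fl s 0} ≈₂-refl (≈₂-reflexive (update-same r (pathD ⊗ ℓ r) ℓ)))
            (≈₂-trans (⊗-swap (Fl s 0) pathD (ℓ r)) (≈₂-sym (⊗-assoc pathD (Fl s 0) (ℓ r))))) u
            (λ ne → ≈₂-reflexive (update-other r (pathD ⊗ ℓ r) ℓ u ne))) _))))))
      where
      open Context c
      ℓ₁ = update r (pathD ⊗ ℓ r) ℓ
      E' = proj₁ (paths2 r s (suc (suc nxt))) ++ E
      E'-free : LoopFree E'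
      E'-free = Allₚ.++⁺ (paths2-free r s (suc (suc nxt)) (ℕₚ.m<n⇒m<1+n (ℕₚ.m<n⇒m<1+n r<))) free
      rearrange : r ∷ nxt ∷ suc nxt ∷ (upFrom (suc (suc nxt)) (s ℕ.* 2) ++ zs) ↭ suc nxt ∷ nxt ∷ r ∷ (upFrom (suc (suc nxt)) (s ℕ.* 2) ++ zs)
      rearrange = ↭-trans (↭-prep r (↭-swap nxt (suc nxt) ↭-refl)) (↭-trans (↭-swap r (suc nxt) ↭-refl) (↭-prep (suc nxt) (↭-swap r nxt ↭-refl)))

    triangleE : Edges
    triangleE = cycleEdges 3

    triangle : ∀ ℓ → P (adjE triangleE) ℓ (2 ∷ 0 ∷ 1 ∷ []) ≈ cyc (ℓ 2 ∷ ℓ 0 ∷ ℓ 1 ∷ [])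
    triangle ℓ = det-cycle ℓ (matrix (adjE triangleE) ℓ (2 ∷ 0 ∷ 1 ∷ [])) 2 0 [] 1 0 ≡.refl (record
      { chain = link (on 0) (off 0) (off 1) [] [] (end (on 1))
      ; Mcc = on 2 ; Mcv = off 2 ; Mvc = off 0 ; Mcz = off 2 ; Mzc = off 1 ; Mcx = [] ; Mxc = [] })
      where
      open CycleDet S ℕ using (det-cycle; link; end)
      on : ∀ v → diag (adjE triangleE) ℓ (2 ∷ 0 ∷ 1 ∷ []) v + proj₁ (ℓ v) * κ 0 ≈ diag (adjE triangleE) ℓ (2 ∷ 0 ∷ 1 ∷ []) v
      on v = solve 2 (λ a b → a :+ b :* k 0 := a) refl _ _
      off : ∀ v → κ 0 + proj₁ (ℓ v) * κ 1 ≈ proj₁ (ℓ v)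
      off v = solve 1 (λ a → k 0 :+ a :* k 1 := a) refl _

    bushes : ∀ s t {r nxt zs E ℓ} → Context r nxt zs E ℓ →
      P (adjE (proj₁ (edges1 r t (nxt ℕ.+ s ℕ.* 2)) ++ (proj₁ (paths2 r s nxt) ++ E))) ℓ (r ∷ (upFrom (nxt ℕ.+ s ℕ.* 2) t ++ (upFrom nxt (s ℕ.* 2) ++ zs)))
      ≈ P (adjE E) (update r (Fl s t ⊗ ℓ r) ℓ) (r ∷ zs)
    bushes s t {r} {nxt} {zs} {E} {ℓ} c = trans (leaves t c₁) (trans (paths s (context-later ℕₚ.≤-refl c))
      (P-congℓ (adjE E) (update r (Fl s 0 ⊗ ℓ₁ r) ℓ₁) (update r (Fl s t ⊗ ℓ r) ℓ) (r ∷ zs) (All.universal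
        (λ u → update-cong r {ℓ = ℓ₁} {ℓ' = ℓ}
          (≈₂-trans (⊗-cong {Fl s 0} ≈₂-refl (≈₂-reflexive (update-same r (Fl 0 t ⊗ ℓ r) ℓ)))
          (≈₂-trans (≈₂-sym (⊗-assoc (Fl s 0) (Fl 0 t) (ℓ r))) (⊗-cong (≈₂-trans (Fl-+ s 0 0 t) (≈₂-reflexive (≡.cong (λ i → Fl i t) (ℕₚ.+-identityʳ s)))) ≈₂-refl)))
          u (λ ne → ≈₂-reflexive (update-other r (Fl 0 t ⊗ ℓ r) ℓ u ne))) _)))
      where
      open Context c
      ℓ₁ = update r (Fl 0 t ⊗ ℓ r) ℓ
      upFrom-< : ∀ k a b → a ℕ.+ k ≤ b → All (_< b) (upFrom a k)
      upFrom-< zero a b le = []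
      upFrom-< (suc k) a b le = ℕₚ.<-≤-trans (ℕₚ.m<m+n a (s≤s z≤n)) le ∷ upFrom-< k (suc a) b (ℕₚ.≤-trans (ℕₚ.≤-reflexive (≡.sym (ℕₚ.+-suc a k))) le)
      paths2-under : ∀ s a → r < a → Under (a ℕ.+ s ℕ.* 2) (proj₁ (paths2 r s a))
      paths2-under zero a lt = []
      paths2-under (suc s) a lt = (ℕₚ.<-trans lt a<b , a<b) ∷ (a<b , sa<b) ∷ ≡.subst (λ b → Under b (proj₁ (paths2 r s (suc (suc a))))) eq (paths2-under s (suc (suc a)) (ℕₚ.m<n⇒m<1+n (ℕₚ.m<n⇒m<1+n lt)))
        where
        eq : suc (suc a) ℕ.+ s ℕ.* 2 ≡ a ℕ.+ suc s ℕ.* 2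
        eq = ≡.sym (≡.trans (ℕₚ.+-suc a _) (≡.cong suc (ℕₚ.+-suc a _)))
        sa<b : suc a < a ℕ.+ suc s ℕ.* 2
        sa<b = ≡.subst (suc a <_) eq (s≤s (s≤s (ℕₚ.m≤m+n a _)))
        a<b = ℕₚ.<-trans (ℕₚ.n<1+n a) sa<b
      le : nxt ≤ nxt ℕ.+ s ℕ.* 2
      le = ℕₚ.m≤m+n nxt _
      c₁ : Context r (nxt ℕ.+ s ℕ.* 2) (upFrom nxt (s ℕ.* 2) ++ zs) (proj₁ (paths2 r s nxt) ++ E) ℓ
      c₁ = record
        { r< = ℕₚ.<-≤-trans r< le
        ; zs< = Allₚ.++⁺ (upFrom-< (s ℕ.* 2) nxt _ ℕₚ.≤-refl) (All.map (λ l → ℕₚ.<-≤-trans l le) zs<)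
        ; uniq = context-unique (s ℕ.* 2) c
        ; under = Allₚ.++⁺ (paths2-under s nxt r<) (All.map (λ (a , b) → ℕₚ.<-≤-trans a le , ℕₚ.<-≤-trans b le) under)
        ; free = Allₚ.++⁺ (paths2-free r s nxt r<) free
        ; ones = λ v l → ones v (ℕₚ.≤-trans le l) }

    open Cycles S using (P₁; P₂)

    G₁-value : ∀ s t → P (adjE (Gedges 3 ((0 , 0) ∷ (0 , 0) ∷ (s , t) ∷ []))) (λ _ → oneD) (upFrom 0 (3 ℕ.+ (s ℕ.* 2 ℕ.+ t))) ≈ P₁ s t
    G₁-value s t = trans (P-cong {adjE (triangleE ++ attach 2 ((s , t) ∷ []) 3)} {adjE E} {ℓ} {ℓ} (upFrom 0 (3 ℕ.+ (s ℕ.* 2 ℕ.+ t)))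
        (All.universal (λ a → All.universal (λ b → adjE-attach triangleE 2 s t 3 a b) _) _) (All.universal (λ _ → ≈₂-refl) _))
      (trans (P-↭ (adjE E) ℓ order) (trans (bushes s t c) (trans (triangle (update 2 (Fl s t ⊗ oneD) ℓ))
        (cyc-cong {Fl s t ⊗ oneD ∷ oneD ∷ oneD ∷ []} {Fl s t ∷ oneD ∷ oneD ∷ []} (⊗-identityʳ (Fl s t) ∷ ≈₂-refl ∷ ≈₂-refl ∷ [])))))
      where
      ℓ : ℕ → Dual
      ℓ _ = oneD
      E = proj₁ (edges1 2 t (3 ℕ.+ s ℕ.* 2)) ++ (proj₁ (paths2 2 s 3) ++ triangleE)
      c : Context 2 3 (0 ∷ 1 ∷ []) triangleE ℓ
      c = record { r< = s≤s (s≤s (s≤s z≤n)) ; zs< = s≤s z≤n ∷ s≤s (s≤s z≤n) ∷ []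
        ; uniq = ((λ ()) ∷ (λ ()) ∷ []) ∷ ((λ ()) ∷ []) ∷ [] ∷ []
        ; under = (s≤s (s≤s (s≤s z≤n)) , s≤s (s≤s z≤n)) ∷ (s≤s (s≤s z≤n) , s≤s z≤n) ∷ (s≤s z≤n , s≤s (s≤s (s≤s z≤n))) ∷ []
        ; free = (λ ()) ∷ (λ ()) ∷ (λ ()) ∷ [] ; ones = λ _ _ → ≡.refl }
      A = upFrom 3 (s ℕ.* 2)
      B = upFrom (3 ℕ.+ s ℕ.* 2) t
      order : 0 ∷ 1 ∷ 2 ∷ upFrom 3 (s ℕ.* 2 ℕ.+ t) ↭ 2 ∷ (B ++ (A ++ 0 ∷ 1 ∷ []))
      order = ↭-trans (Perm.shift 2 (0 ∷ 1 ∷ []) (upFrom 3 (s ℕ.* 2 ℕ.+ t))) (↭-prep 2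
        (↭-trans (Perm.++-comm (0 ∷ 1 ∷ []) (upFrom 3 (s ℕ.* 2 ℕ.+ t))) (≡.subst (λ l → l ++ 0 ∷ 1 ∷ [] ↭ B ++ (A ++ 0 ∷ 1 ∷ [])) (≡.sym (upFrom-+ 3 (s ℕ.* 2) t))
          (≡.subst ((A ++ B) ++ 0 ∷ 1 ∷ [] ↭_) (++-assoc B A (0 ∷ 1 ∷ [])) (Perm.++⁺ʳ (0 ∷ 1 ∷ []) (Perm.++-comm A B))))))

    G₂-value : ∀ s t → P (adjE (Gedges 3 ((0 , 1) ∷ (0 , 1) ∷ (s , t) ∷ []))) (λ _ → oneD) (upFrom 0 (5 ℕ.+ (s ℕ.* 2 ℕ.+ t))) ≈ P₂ s t
    G₂-value s t = trans (P-cong {adjE (triangleE ++ ((0 , 3) ∷ (1 , 4) ∷ attach 2 ((s , t) ∷ []) 5))} {adjE E} {ℓ} {ℓ} (upFrom 0 (5 ℕ.+ (s ℕ.* 2 ℕ.+ t)))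
        (All.universal (λ a → All.universal (λ b → adjE-attach E₅ 2 s t 5 a b) _) _) (All.universal (λ _ → ≈₂-refl) _))
      (trans (P-↭ (adjE E) ℓ order) (trans (bushes s t c)
      -- The bushes at 2 are gone; the pendent vertices 4 at 1 and 3 at 0 are brought to the front
      -- and peeled in turn.
      (trans (P-↭ (adjE E₅) ℓ₁ {2 ∷ 0 ∷ 1 ∷ 3 ∷ 4 ∷ []} {4 ∷ 1 ∷ 3 ∷ 0 ∷ 2 ∷ []}
        (↭-trans (↭-prep 2 (↭-prep 0 (↭-swap 1 3 ↭-refl))) (↭-sym (Perm.↭-reverse (2 ∷ 0 ∷ 3 ∷ 1 ∷ 4 ∷ [])))))
      (trans (peel {E₅} E₄ 1 4 (3 ∷ 0 ∷ 2 ∷ []) {ℓ₁} {leafD}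
        (λ a b → ≡.trans (adjE-comm triangleE ((0 , 3) ∷ (1 , 4) ∷ []) a b) (swapE (0 , 3) (1 , 4) triangleE a b))
        (((λ ()) , (λ ())) ∷ ((λ ()) , (λ ())) ∷ ((λ ()) , (λ ())) ∷ ((λ ()) , (λ ())) ∷ [])
        ((λ ()) ∷ (λ ()) ∷ (λ ()) ∷ (λ ()) ∷ [])
        (((λ ()) ∷ (λ ()) ∷ (λ ()) ∷ (λ ()) ∷ []) ∷ ((λ ()) ∷ (λ ()) ∷ (λ ()) ∷ []) ∷ ((λ ()) ∷ (λ ()) ∷ []) ∷ ((λ ()) ∷ []) ∷ [] ∷ [])
        new-leaf)
      (trans (P-↭ (adjE E₄) ℓ₂ {1 ∷ 3 ∷ 0 ∷ 2 ∷ []} {3 ∷ 0 ∷ 2 ∷ 1 ∷ []} (Perm.++-comm (1 ∷ []) (3 ∷ 0 ∷ 2 ∷ [])))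
      (trans (peel {E₄} triangleE 0 3 (2 ∷ 1 ∷ []) {ℓ₂} {leafD} (λ _ _ → ≡.refl)
        (((λ ()) , (λ ())) ∷ ((λ ()) , (λ ())) ∷ ((λ ()) , (λ ())) ∷ [])
        ((λ ()) ∷ (λ ()) ∷ (λ ()) ∷ [])
        (((λ ()) ∷ (λ ()) ∷ (λ ()) ∷ []) ∷ ((λ ()) ∷ (λ ()) ∷ []) ∷ ((λ ()) ∷ []) ∷ [] ∷ [])
        new-leaf)
      (trans (P-↭ (adjE triangleE) ℓ₃ {0 ∷ 2 ∷ 1 ∷ []} {2 ∷ 0 ∷ 1 ∷ []} (↭-swap 0 2 ↭-refl))
      (trans (triangle ℓ₃)
        (cyc-cong {Fl s t ⊗ oneD ∷ leafD ∷ leafD ∷ []} {Fl s t ∷ leafD ∷ leafD ∷ []} (⊗-identityʳ (Fl s t) ∷ ≈₂-refl ∷ ≈₂-refl ∷ []))))))))))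
      where
      ℓ ℓ₁ ℓ₂ ℓ₃ : ℕ → Dual
      ℓ _ = oneD
      ℓ₁ = update 2 (Fl s t ⊗ oneD) ℓ
      ℓ₂ = update 1 leafD ℓ₁
      ℓ₃ = update 0 leafD ℓ₂
      new-leaf : unD oneD ⊗ oneD ≈₂ leafD
      new-leaf = ≈₂-trans (⊗-identityʳ (unD oneD)) unD-one
      E₅ = triangleE ++ ((0 , 3) ∷ (1 , 4) ∷ [])
      E₄ = (0 , 3) ∷ triangleE
      E = proj₁ (edges1 2 t (5 ℕ.+ s ℕ.* 2)) ++ (proj₁ (paths2 2 s 5) ++ E₅)
      A = upFrom 5 (s ℕ.* 2)
      B = upFrom (5 ℕ.+ s ℕ.* 2) t
      xs = 0 ∷ 1 ∷ 3 ∷ 4 ∷ []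
      order : upFrom 0 (5 ℕ.+ (s ℕ.* 2 ℕ.+ t)) ↭ 2 ∷ (B ++ (A ++ xs))
      order = ↭-trans (Perm.shift 2 (0 ∷ 1 ∷ []) (3 ∷ 4 ∷ upFrom 5 (s ℕ.* 2 ℕ.+ t))) (↭-prep 2
        (↭-trans (Perm.++-comm xs (upFrom 5 (s ℕ.* 2 ℕ.+ t))) (≡.subst (λ l → l ++ xs ↭ B ++ (A ++ xs)) (≡.sym (upFrom-+ 5 (s ℕ.* 2) t))
          (≡.subst ((A ++ B) ++ xs ↭_) (++-assoc B A xs) (Perm.++⁺ʳ xs (Perm.++-comm A B))))))
      1≤ : ∀ {n} → 1 ≤ suc n
      1≤ = s≤s z≤n
      c : Context 2 5 xs E₅ ℓ
      c = record { r< = s≤s (s≤s 1≤) ; zs< = 1≤ ∷ s≤s 1≤ ∷ s≤s (s≤s (s≤s 1≤)) ∷ s≤s (s≤s (s≤s (s≤s 1≤))) ∷ []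
        ; uniq = ((λ ()) ∷ (λ ()) ∷ (λ ()) ∷ (λ ()) ∷ []) ∷ ((λ ()) ∷ (λ ()) ∷ (λ ()) ∷ []) ∷ ((λ ()) ∷ (λ ()) ∷ []) ∷ ((λ ()) ∷ []) ∷ [] ∷ []
        ; under = (s≤s (s≤s 1≤) , s≤s 1≤) ∷ (s≤s 1≤ , 1≤) ∷ (1≤ , s≤s (s≤s 1≤)) ∷ (1≤ , s≤s (s≤s (s≤s 1≤))) ∷ (s≤s 1≤ , s≤s (s≤s (s≤s (s≤s 1≤)))) ∷ []
        ; free = (λ ()) ∷ (λ ()) ∷ (λ ()) ∷ (λ ()) ∷ (λ ()) ∷ [] ; ones = λ _ _ → ≡.refl }

-- Unicyclic graphs: a chordless cycle with pendent vertices added one by one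

module UnicyclicGraphs where
  open import Defs
  open import Data.List.Relation.Binary.Permutation.Propositional using (_↭_)
  open import Relation.Binary.PropositionalEquality using (_≡_; _≢_; refl; sym; trans; cong; subst)

  data SPath {V : Set} (E : V → V → Set) : V → V → List V → Set where
    one  : ∀ {a} → SPath E a a [ a ]
    cons : ∀ {a c b l} → E a c → All (a ≢_) l → SPath E c b l → SPath E a b (a ∷ l)

  module _ {V : Set} {E : V → V → Set} where

    spath-map : ∀ {E' : V → V → Set} → (∀ {a b} → E a b → E' a b) → ∀ {a b l} → SPath E a b l → SPath E' a b l
    spath-map f one = one
    spath-map f (cons e n p) = cons (f e) n (spath-map f p)

    spath-snoc : ∀ {a b l w} → SPath E a b l → E b w → All (w ≢_) l → SPath E a w (l ++ [ w ])
    spath-snoc one e (ne ∷ []) = cons e ((λ q → ne (sym q)) ∷ []) one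
    spath-snoc (cons e' n p) e (ne ∷ nes) = cons e' (Allₚ.++⁺ n ((λ q → ne (sym q)) ∷ [])) (spath-snoc p e nes)

    spath-prefix : ∀ {a b l x} → SPath E a b l → x ∈ l → ∃ λ l' → All (_∈ l) l' × SPath E a x l'
    spath-prefix one (here refl) = _ , here refl ∷ [] , one
    spath-prefix (cons e n p) (here refl) = _ , here refl ∷ [] , one
    spath-prefix (cons e n p) (there x∈) with spath-prefix p x∈
    ... | l' , sub , q = _ , here refl ∷ All.map there sub , cons e (All.map (λ m → All.lookup n m) sub) q

    -- The path is directed and E is not assumed symmetric, so only one of the two directions is
    -- available.
    spath-between : ∀ {a b l x z} → SPath E a b l → x ∈ l → z ∈ l → ∃ λ l' → All (_∈ l) l' × (SPath E x z l' ⊎ SPath E z x l')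
    spath-between p@one (here refl) z∈ with spath-prefix p z∈
    ... | l' , sub , q = l' , sub , inj₁ q
    spath-between p@(cons _ _ _) (here refl) z∈ with spath-prefix p z∈
    ... | l' , sub , q = l' , sub , inj₁ q
    spath-between p@(cons _ _ _) (there x∈) (here refl) with spath-prefix p (there x∈)
    ... | l' , sub , q = l' , sub , inj₂ q
    spath-between (cons e n p) (there x∈) (there z∈) with spath-between p x∈ z∈
    ... | l' , sub , q = l' , All.map there sub , q

    spath-last : ∀ {a b l} → SPath E a b l → ∀ i → suc (toℕ i) ≡ length l → lookup l i ≡ b
    spath-last one fzero e = refl
    spath-last (cons _ n p) fzero e = ⊥-elim (nonempty p (sym (ℕₚ.suc-injective e)))
      where
      nonempty : ∀ {a b l} → SPath E a b l → length l ≢ 0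
      nonempty one ()
      nonempty (cons _ _ _) ()
    spath-last (cons e n p) (fsuc i) q = spath-last p i (ℕₚ.suc-injective q)

    spath-first : ∀ {a b l} → SPath E a b l → ∀ j → toℕ j ≡ 0 → lookup l j ≡ a
    spath-first one fzero _ = refl
    spath-first (cons _ _ _) fzero _ = refl

    spath-consecutive : ∀ {a b l} → SPath E a b l → ∀ i j → suc (toℕ i) ≡ toℕ j → E (lookup l i) (lookup l j)
    spath-consecutive one fzero fzero ()
    spath-consecutive (cons e n p) fzero (fsuc j) q = subst (E _) (sym (spath-first p j (sym (ℕₚ.suc-injective q)))) e
    spath-consecutive (cons e n p) (fsuc i) (fsuc j) q = spath-consecutive p i j (ℕₚ.suc-injective q)

    spath-injective : ∀ {a b l} → SPath E a b l → ∀ i j → lookup l i ≡ lookup l j → i ≡ j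
    spath-injective one fzero fzero _ = refl
    spath-injective (cons e n p) fzero fzero _ = refl
    spath-injective {l = _ ∷ l} (cons e n p) fzero (fsuc j) q = ⊥-elim (All.lookup n (∈-lookup {xs = l} j) q)
    spath-injective {l = _ ∷ l} (cons e n p) (fsuc i) fzero q = ⊥-elim (All.lookup n (∈-lookup {xs = l} i) (sym q))
    spath-injective (cons e n p) (fsuc i) (fsuc j) q = cong fsuc (spath-injective p i j q)

    spath-tabulate : ∀ k (v : Fin (suc k) → V) → (∀ i j → v i ≡ v j → i ≡ j) → (∀ i j → suc (toℕ i) ≡ toℕ j → E (v i) (v j)) →
      ∃ λ z → SPath E (v fzero) z (tabulate v)
    spath-tabulate zero v inj con = _ , one
    spath-tabulate (suc k) v inj con with spath-tabulate k (λ i → v (fsuc i)) (λ i j e → Finₚ.suc-injective (inj (fsuc i) (fsuc j) e)) (λ i j e → con (fsuc i) (fsuc j) (cong suc e))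
    ... | z , p = z , cons (con fzero (fsuc fzero) refl) (Allₚ.tabulate⁺ (λ i e → Finₚ.0≢1+n (inj fzero (fsuc i) e))) p

  module Structure {n : ℕ} (G : Adj n) (simple : IsSimple G) (conn : IsConnected G) (C : Cycle G) (uniq : ∀ D → SameCycle C D) where
    symm : ∀ u v → G u v ≡ G v u
    symm = proj₁ simple

    loop : ∀ u → G u u ≡ false
    loop = proj₂ simple

    Edge : Fin n → Fin n → Set
    Edge u v = G u v ≡ true

    no-loop : ∀ {u} → Edge u u → ⊥
    no-loop {u} e with trans (sym (loop u)) e
    ... | ()

    cs : List (Fin n)
    cs = tabulate (Cycle.vtx C)

    -- A simple path on at least three vertices with adjacent ends is a cycle `D`, and by uniqueness
    -- its closing edge belongs to `C`. The absence of chords and of second neighbours rests on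
    -- this.
    close : ∀ {a b c z l} → SPath Edge a z (a ∷ b ∷ c ∷ l) → Edge z a → CycleEdge C z a
    close {a} {b} {c} {z} {l} p za = proj₂ (uniq D z a) edge
      where
      D : Cycle G
      D = record { k' = length l ; vtx = lookup (a ∷ b ∷ c ∷ l) ; inj = spath-injective p ; adj = adj }
        where
        adj : ∀ i j → Consec i j → G (lookup (a ∷ b ∷ c ∷ l) i) (lookup (a ∷ b ∷ c ∷ l) j) ≡ true
        adj i j (inj₁ e) = spath-consecutive p i j e
        adj i j (inj₂ (e , e')) = subst (λ x → G x (lookup (a ∷ b ∷ c ∷ l) j) ≡ true) (sym (spath-last p i e))
          (subst (λ x → G z x ≡ true) (sym (spath-first p j e')) za)
      lastᶠ : ∀ m → ∃ λ (i : Fin (suc m)) → suc (toℕ i) ≡ suc m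
      lastᶠ m = fromℕ m , cong suc (Finₚ.toℕ-fromℕ m)
      i = proj₁ (lastᶠ (suc (suc (length l))))
      edge : CycleEdge D z a
      edge = i , fzero , inj₂ (proj₂ (lastᶠ (suc (suc (length l)))) , refl) , inj₁ (spath-last p i (proj₂ (lastᶠ (suc (suc (length l))))) , refl)

    cycleEdge-edge : ∀ {u v} → CycleEdge C u v → Edge u v
    cycleEdge-edge (i , j , c , inj₁ (refl , refl)) = Cycle.adj C i j c
    cycleEdge-edge (i , j , c , inj₂ (refl , refl)) = trans (symm _ _) (Cycle.adj C i j c)

    cycleEdge-∈ : ∀ {u v} → CycleEdge C u v → v ∈ cs
    cycleEdge-∈ (i , j , c , inj₁ (refl , refl)) = ∈-tabulate⁺ {f = Cycle.vtx C} j
    cycleEdge-∈ (i , j , c , inj₂ (refl , refl)) = ∈-tabulate⁺ {f = Cycle.vtx C} i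

    cycleEdge-sym : ∀ {u v} → CycleEdge C u v → CycleEdge C v u
    cycleEdge-sym (i , j , c , inj₁ e) = i , j , c , inj₂ e
    cycleEdge-sym (i , j , c , inj₂ e) = i , j , c , inj₁ e

    cycle-path : ∃ λ z → SPath (CycleEdge C) (Cycle.vtx C fzero) z cs
    cycle-path = spath-tabulate _ (Cycle.vtx C) (Cycle.inj C) (λ i j e → i , j , inj₁ e , inj₁ (refl , refl))

    -- A part of the cycle is a path between the two vertices; if it has more than one edge, the
    -- given edge closes it to a cycle.
    chord : ∀ {u v} → u ∈ cs → v ∈ cs → Edge u v → CycleEdge C u v
    chord {u} {v} u∈ v∈ e with spath-between (proj₂ cycle-path) u∈ v∈
    ... | l , _ , inj₁ one = ⊥-elim (no-loop e)
    ... | l , _ , inj₂ one = ⊥-elim (no-loop e)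
    ... | l , _ , inj₁ (cons ce _ one) = ce
    ... | l , _ , inj₂ (cons ce _ one) = cycleEdge-sym ce
    ... | l , _ , inj₁ p@(cons _ _ (cons _ _ one)) = cycleEdge-sym (close (spath-map cycleEdge-edge p) (trans (symm v u) e))
    ... | l , _ , inj₁ p@(cons _ _ (cons _ _ (cons _ _ _))) = cycleEdge-sym (close (spath-map cycleEdge-edge p) (trans (symm v u) e))
    ... | l , _ , inj₂ p@(cons _ _ (cons _ _ one)) = close (spath-map cycleEdge-edge p) e
    ... | l , _ , inj₂ p@(cons _ _ (cons _ _ (cons _ _ _))) = close (spath-map cycleEdge-edge p) e

    -- Each new vertex is pendent in the set built so far, so the list, read from the front, is an
    -- elimination order that ends with the cycle.
    data Grow : List (Fin n) → Set where
      base : Grow cs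
      add  : ∀ {w u vs} → Grow vs → u ∈ vs → All (w ≢_) vs → Edge w u → All (λ z → z ≢ u → G w z ≡ false) vs → Grow (w ∷ vs)

    grow-∈ : ∀ {vs} → Grow vs → ∀ {v} → v ∈ cs → v ∈ vs
    grow-∈ base m = m
    grow-∈ (add g _ _ _ _) m = there (grow-∈ g m)

    Linked : List (Fin n) → Set
    Linked vs = ∀ {x z} → x ∈ vs → z ∈ vs → ∃ λ l → All (_∈ vs) l × (SPath Edge x z l ⊎ SPath Edge z x l)

    extend : ∀ {w u vs z} → Linked vs → u ∈ vs → All (w ≢_) vs → Edge w u → z ∈ vs →
      ∃ λ l → All (_∈ w ∷ vs) l × (SPath Edge w z l ⊎ SPath Edge z w l)
    extend {w} {u} lk u∈ w∉ e z∈ with lk u∈ z∈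
    ... | l , sub , inj₁ p = _ , here refl ∷ All.map there sub , inj₁ (cons e (All.map (All.lookup w∉) sub) p)
    ... | l , sub , inj₂ p = _ , Allₚ.++⁺ (All.map there sub) (here refl ∷ []) , inj₂ (spath-snoc p (trans (symm u w) e) (All.map (All.lookup w∉) sub))

    grow-linked : ∀ {vs} → Grow vs → Linked vs
    grow-linked base x∈ z∈ with spath-between (proj₂ cycle-path) x∈ z∈
    ... | l , sub , p = l , sub , Sum.map (spath-map cycleEdge-edge) (spath-map cycleEdge-edge) p
    grow-linked (add g u∈ w∉ e _) (here refl) (here refl) = _ , here refl ∷ [] , inj₁ one
    grow-linked (add g u∈ w∉ e _) (here refl) (there z∈) = extend (grow-linked g) u∈ w∉ e z∈
    grow-linked (add g u∈ w∉ e _) (there x∈) (here refl) with extend (grow-linked g) u∈ w∉ e x∈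
    ... | l , sub , p = l , sub , Sum.swap p
    grow-linked (add g u∈ w∉ e _) (there x∈) (there z∈) with grow-linked g x∈ z∈
    ... | l , sub , p = l , All.map there sub , p

    -- A path inside the set from `u` to `z` would close to a cycle through `w`; then `w` would lie
    -- on `C` and be in the set already.
    second-neighbour : ∀ {vs w u z} → Grow vs → All (w ≢_) vs → u ∈ vs → z ∈ vs → z ≢ u → Edge w u → G w z ≡ false
    second-neighbour {vs} {w} {u} {z} g w∉ u∈ z∈ z≢u wu with G w z in wz
    ... | false = refl
    ... | true = ⊥-elim (All.lookup w∉ (grow-∈ g w∈cs) refl)
      where
      w∈cs : w ∈ cs
      w∈cs with grow-linked g u∈ z∈
      ... | l , sub , inj₁ one = ⊥-elim (z≢u refl)
      ... | l , sub , inj₂ one = ⊥-elim (z≢u refl)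
      ... | l , sub , inj₁ p@(cons _ _ one) = cycleEdge-∈ (close (cons wu (All.map (All.lookup w∉) sub) p) (trans (symm z w) wz))
      ... | l , sub , inj₁ p@(cons _ _ (cons _ _ _)) = cycleEdge-∈ (close (cons wu (All.map (All.lookup w∉) sub) p) (trans (symm z w) wz))
      ... | l , sub , inj₂ p@(cons _ _ one) = cycleEdge-∈ (close (cons wz (All.map (All.lookup w∉) sub) p) (trans (symm u w) wu))
      ... | l , sub , inj₂ p@(cons _ _ (cons _ _ _)) = cycleEdge-∈ (close (cons wz (All.map (All.lookup w∉) sub) p) (trans (symm u w) wu))

    _∈?_ : ∀ (v : Fin n) vs → Dec (v ∈ vs)
    v ∈? vs = any? (v Finₚ.≟_) vs

    include : ∀ {v c vs} → Reach G v c → c ∈ vs → Grow vs → ∃ λ vs' → Grow vs' × v ∈ vs' × (∀ {x} → x ∈ vs → x ∈ vs')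
    include here c∈ g = _ , g , c∈ , λ m → m
    include {v} (step e r) c∈ g with include r c∈ g
    ... | vs' , g' , m , sub with v ∈? vs'
    ...   | yes v∈ = vs' , g' , v∈ , sub
    ...   | no v∉ = v ∷ vs' , add g' m (Allₚ.¬Any⇒All¬ vs' v∉) e (All.tabulate (λ z∈ ne → second-neighbour g' (Allₚ.¬Any⇒All¬ vs' v∉) m z∈ ne e)) , here refl , λ x∈ → there (sub x∈)

    c₀ : Fin n
    c₀ = Cycle.vtx C fzero

    include-all : ∀ us → ∃ λ vs → Grow vs × All (_∈ vs) us
    include-all [] = cs , base , []
    include-all (u ∷ us) with include-all us
    ... | vs , g , sub with include (conn u c₀) (grow-∈ g (∈-tabulate⁺ {f = Cycle.vtx C} fzero)) g
    ...   | vs' , g' , u∈ , sub' = vs' , g' , u∈ ∷ All.map sub' sub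

    grow-unique : ∀ {vs} → Grow vs → Unique vs
    grow-unique base = tabulate⁺ (Cycle.inj C _ _)
      where open import Data.List.Relation.Unary.Unique.Propositional.Properties using (tabulate⁺)
    grow-unique (add g _ w∉ _ _) = w∉ ∷ grow-unique g

    spanning : ∃ λ vs → Grow vs × vs ↭ allFin n
    spanning with include-all (allFin n)
    ... | vs , g , sub = vs , g , ∼bag⇒↭ (unique∧set⇒bag (grow-unique g) (allFin⁺ n) (mk⇔ (λ _ → ∈-allFin _) (All.lookup sub)))
      where
      open import Data.List.Relation.Binary.BagAndSetEquality using (∼bag⇒↭)
      open import Data.List.Membership.Propositional.Properties.WithK using (unique∧set⇒bag)
      open import Data.List.Relation.Unary.Unique.Propositional.Properties using (allFin⁺)
      open import Function.Bundles using (mk⇔)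

    data PathLike : List (Fin n) → Set where
      end  : ∀ {x} → PathLike [ x ]
      link : ∀ {x x' zs} → Edge x x' → All (λ z → G x z ≡ false) zs → PathLike (x' ∷ zs) → PathLike (x ∷ x' ∷ zs)

    -- The absence of chords is part of the description; `rotateTo` lets any vertex of the cycle
    -- come first.
    data CycleList : List (Fin n) → Set where
      cyclic : ∀ {c v xs z} → Edge c v → Edge c z → All (λ x → G c x ≡ false) xs → PathLike (v ∷ xs ++ [ z ]) → CycleList (c ∷ v ∷ xs ++ [ z ])

    pathLike-snoc : ∀ v xs z c → PathLike (v ∷ xs ++ [ z ]) → Edge z c → G v c ≡ false → All (λ x → G c x ≡ false) xs → PathLike (v ∷ (xs ++ [ z ]) ++ [ c ])
    pathLike-snoc v [] z c (link e _ end) zc vc [] = link e (vc ∷ []) (link zc [] end)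
    pathLike-snoc v (x ∷ xs) z c (link e ns p) zc vc (cx ∷ cxs) = link e (Allₚ.++⁺ ns (vc ∷ [])) (pathLike-snoc x xs z c p zc (trans (symm x c) cx) cxs)

    rotate₁ : ∀ {c l} → CycleList (c ∷ l) → CycleList (l ++ [ c ])
    rotate₁ (cyclic {c} {v} {[]} {z} cv cz [] (link vz _ end)) = cyclic {xs = []} vz (trans (symm v c) cv) [] (link (trans (symm z c) cz) [] end)
    rotate₁ (cyclic {c} {v} {x ∷ xs} {z} cv cz (cx ∷ cxs) (link vx ns p)) =
      cyclic {xs = xs ++ [ z ]} vx (trans (symm v c) cv) ns (pathLike-snoc x xs z c p (trans (symm z c) cz) (trans (symm x c) cx) cxs)

    rotateTo : ∀ ys zs → CycleList (ys ++ zs) → CycleList (zs ++ ys)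
    rotateTo [] zs p = subst CycleList (sym (++-identityʳ zs)) p
    rotateTo (y ∷ ys) zs p = subst CycleList (++-assoc zs [ y ] ys) (rotateTo ys (zs ++ [ y ]) (subst CycleList (++-assoc ys zs [ y ]) (rotate₁ p)))

    notEdge : ∀ {u v} → (Edge u v → ⊥) → G u v ≡ false
    notEdge {u} {v} h with G u v
    ... | true = ⊥-elim (h refl)
    ... | false = refl

    consec : ∀ i j → Edge (Cycle.vtx C i) (Cycle.vtx C j) → Consec i j ⊎ Consec j i
    consec i j e with chord (∈-tabulate⁺ {f = Cycle.vtx C} i) (∈-tabulate⁺ {f = Cycle.vtx C} j) e
    ... | a , b , c , inj₁ (p , q) with Cycle.inj C a i p | Cycle.inj C b j q
    ...   | refl | refl = inj₁ c
    consec i j e | a , b , c , inj₂ (p , q) with Cycle.inj C a j p | Cycle.inj C b i q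
    ...   | refl | refl = inj₂ c

    path-tabulate : ∀ k (f : Fin (suc k) → Fin n) → (∀ i j → suc (toℕ i) ≡ toℕ j → Edge (f i) (f j)) →
      (∀ i j → suc (suc (toℕ i)) ≤ toℕ j → G (f i) (f j) ≡ false) → PathLike (tabulate f)
    path-tabulate zero f h₁ h₂ = end
    path-tabulate (suc k) f h₁ h₂ = link (h₁ fzero (fsuc fzero) refl) (Allₚ.tabulate⁺ (λ i → h₂ fzero (fsuc (fsuc i)) (s≤s (s≤s z≤n))))
      (path-tabulate k (λ i → f (fsuc i)) (λ i j e → h₁ (fsuc i) (fsuc j) (cong suc e)) (λ i j l → h₂ (fsuc i) (fsuc j) (s≤s l)))

    snoc-tabulate : ∀ k (f : Fin (suc k) → Fin n) (Q R : Fin n → Set) → (∀ i → toℕ i < k → Q (f i)) → (∀ i → toℕ i ≡ k → R (f i)) →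
      ∃ λ xs → ∃ λ z → tabulate f ≡ xs ++ [ z ] × length xs ≡ k × All Q xs × R z
    snoc-tabulate zero f Q R h₁ h₂ = [] , _ , refl , refl , [] , h₂ fzero refl
    snoc-tabulate (suc k) f Q R h₁ h₂ with snoc-tabulate k (λ i → f (fsuc i)) Q R (λ i l → h₁ (fsuc i) (s≤s l)) (λ i e → h₂ (fsuc i) (cong suc e))
    ... | xs , z , e , len , qs , r = f fzero ∷ xs , z , cong (f fzero ∷_) e , cong suc len , h₁ fzero (s≤s z≤n) ∷ qs , r

    cycleList : CycleList cs
    cycleList with snoc-tabulate (Cycle.k' C) (λ i → Cycle.vtx C (fsuc (fsuc i))) (λ x → G c₀ x ≡ false) (Edge c₀) inner last
      where
      inner : ∀ i → toℕ i < Cycle.k' C → G c₀ (Cycle.vtx C (fsuc (fsuc i))) ≡ false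
      inner i l = notEdge λ e → bad (consec fzero (fsuc (fsuc i)) e)
        where
        bad : Consec fzero (fsuc (fsuc i)) ⊎ Consec (fsuc (fsuc i)) fzero → ⊥
        bad (inj₁ (inj₁ ()))
        bad (inj₁ (inj₂ (() , _)))
        bad (inj₂ (inj₁ ()))
        bad (inj₂ (inj₂ (e , _))) = ℕₚ.<⇒≢ l (ℕₚ.suc-injective (ℕₚ.suc-injective (ℕₚ.suc-injective e)))
      last : ∀ i → toℕ i ≡ Cycle.k' C → Edge c₀ (Cycle.vtx C (fsuc (fsuc i)))
      last i e = trans (symm _ _) (Cycle.adj C (fsuc (fsuc i)) fzero (inj₂ (cong (λ x → 3 ℕ.+ x) e , refl)))
    ... | xs , z , e , len , qs , r = subst (λ l → CycleList (c₀ ∷ v₁ ∷ l)) (sym e)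
        (cyclic {xs = xs} {z = z} (Cycle.adj C fzero (fsuc fzero) (inj₁ refl)) r qs (subst (λ l → PathLike (v₁ ∷ l)) e path))
      where
      v₁ = Cycle.vtx C (fsuc fzero)
      path : PathLike (tabulate (λ i → Cycle.vtx C (fsuc i)))
      path = path-tabulate _ (λ i → Cycle.vtx C (fsuc i)) (λ i j e → Cycle.adj C (fsuc i) (fsuc j) (inj₁ (cong suc e))) far
        where
        far : ∀ i j → suc (suc (toℕ i)) ≤ toℕ j → G (Cycle.vtx C (fsuc i)) (Cycle.vtx C (fsuc j)) ≡ false
        far i j l = notEdge λ e → bad (consec (fsuc i) (fsuc j) e)
          where
          bad : Consec (fsuc i) (fsuc j) ⊎ Consec (fsuc j) (fsuc i) → ⊥
          bad (inj₁ (inj₁ e)) = ℕₚ.<⇒≢ l (ℕₚ.suc-injective e)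
          bad (inj₁ (inj₂ (_ , ())))
          bad (inj₂ (inj₁ e)) = ℕₚ.<-irrefl (sym (ℕₚ.suc-injective e)) (ℕₚ.<-trans (ℕₚ.<-trans (ℕₚ.n<1+n _) l) (ℕₚ.n<1+n _))
          bad (inj₂ (inj₂ (_ , ())))

  -- Each matching edge uses up a vertex of `K` or two vertices of `L`, and different edges use
  -- different ones. Doubling keeps the count integral when an odd cycle serves as `L`.
  matching-bound : ∀ {n} (M : List (Fin n × Fin n)) (K L : List (Fin n)) → Unique (endpoints M) →
    All (λ e → proj₁ e ∈ K ⊎ proj₂ e ∈ K ⊎ (proj₁ e ∈ L × proj₂ e ∈ L)) M → 2 ℕ.* length M ≤ 2 ℕ.* length K ℕ.+ length L
  matching-bound [] K L _ _ = z≤n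
  matching-bound {n} ((u , v) ∷ M) K L ((u≢v ∷ u∉) ∷ v∉ ∷ uq) (c ∷ cs) = go c
    where
    open import Data.List.Relation.Binary.Permutation.Propositional.Properties using (∈-resp-↭; ↭-length; shift)
    remove : ∀ {x : Fin n} {xs} → x ∈ xs → ∃ λ ys → xs ↭ x ∷ ys
    remove {x} m with ∈-∃++ m
    ... | ys , zs , refl = ys ++ zs , shift x ys zs
    keep : ∀ {x a : Fin n} {xs ys} → xs ↭ x ∷ ys → x ≢ a → a ∈ xs → a ∈ ys
    keep p ne m with ∈-resp-↭ p m
    ... | here e = ⊥-elim (ne (sym e))
    ... | there m' = m'
    Covered : List (Fin n) → List (Fin n) → Fin n × Fin n → Set
    Covered K L e = proj₁ e ∈ K ⊎ proj₂ e ∈ K ⊎ (proj₁ e ∈ L × proj₂ e ∈ L)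
    avoid : ∀ {x : Fin n} M → All (x ≢_) (endpoints M) → All (λ e → x ≢ proj₁ e × x ≢ proj₂ e) M
    avoid [] _ = []
    avoid ((a , b) ∷ M) (p ∷ q ∷ ps) = (p , q) ∷ avoid M ps
    drop : ∀ {x K K'} → K ↭ x ∷ K' → ∀ {M} → All (λ e → x ≢ proj₁ e × x ≢ proj₂ e) M → All (Covered K L) M → All (Covered K' L) M
    drop p ns cs = All.zipWith (λ { ((a , b) , inj₁ m) → inj₁ (keep p a m) ; ((a , b) , inj₂ (inj₁ m)) → inj₂ (inj₁ (keep p b m)) ; (_ , inj₂ (inj₂ m)) → inj₂ (inj₂ m) }) (ns , cs)
    dropL : ∀ {x L L'} → L ↭ x ∷ L' → ∀ {M} → All (λ e → x ≢ proj₁ e × x ≢ proj₂ e) M → All (Covered K L) M → All (Covered K L') M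
    dropL p ns cs = All.zipWith (λ { (_ , inj₁ m) → inj₁ m ; (_ , inj₂ (inj₁ m)) → inj₂ (inj₁ m) ; ((a , b) , inj₂ (inj₂ (m , m'))) → inj₂ (inj₂ (keep p a m , keep p b m')) }) (ns , cs)
    double-suc : ∀ k → 2 ℕ.* suc k ≡ suc (suc (2 ℕ.* k))
    double-suc k = cong suc (ℕₚ.+-suc k (k ℕ.+ 0))
    viaK : ∀ {x} → x ∈ K → All (x ≢_) (endpoints M) → 2 ℕ.* suc (length M) ≤ 2 ℕ.* length K ℕ.+ length L
    viaK m x∉ with remove m
    ... | K' , p = subst (2 ℕ.* suc (length M) ≤_) (cong (λ k → 2 ℕ.* k ℕ.+ length L) (sym (↭-length p)))
        (subst (λ k → 2 ℕ.* suc (length M) ≤ k ℕ.+ length L) (sym (double-suc (length K')))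
          (subst (_≤ suc (suc (2 ℕ.* length K' ℕ.+ length L))) (sym (double-suc (length M))) (s≤s (s≤s (matching-bound M K' L uq (drop p (avoid M x∉) cs))))))
    go : Covered K L (u , v) → 2 ℕ.* suc (length M) ≤ 2 ℕ.* length K ℕ.+ length L
    go (inj₁ m) = viaK m u∉
    go (inj₂ (inj₁ m)) = viaK m v∉
    go (inj₂ (inj₂ (mu , mv))) with remove mu
    ... | L₁ , p₁ with remove (keep p₁ u≢v mv)
    ... | L₂ , p₂ = subst (2 ℕ.* suc (length M) ≤_) (cong (2 ℕ.* length K ℕ.+_) (sym (trans (↭-length p₁) (cong suc (↭-length p₂)))))
        (subst (2 ℕ.* suc (length M) ≤_) (sym (trans (ℕₚ.+-suc _ _) (cong suc (ℕₚ.+-suc _ _))))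
          (subst (_≤ suc (suc (2 ℕ.* length K ℕ.+ length L₂))) (sym (double-suc (length M)))
            (s≤s (s≤s (matching-bound M K L₂ uq (dropL p₂ (avoid M v∉) (dropL p₁ (avoid M u∉) cs)))))))

-- Pruning the trees while matching and covering greedily

module TreePruning where
  open import Defs
  open Cones using (Cone)
  open CycleParsing using (module Parsing)
  open ListDeterminants using (module Weighted)
  open CycleDeterminants using (module CycleDet)
  open UnicyclicGraphs
  open import Data.List.Relation.Binary.Permutation.Propositional using (_↭_; ↭-sym; ↭-prep) renaming (refl to ↭refl; prep to ↭prep; swap to ↭swap; trans to ↭trans)
  open import Relation.Binary.PropositionalEquality as ≡ using (_≡_; _≢_; refl; sym; trans; cong; cong₂; subst)

  middle-fresh : ∀ {A : Set} (ys : List A) {u ys'} → Unique (ys ++ u ∷ ys') → All (u ≢_) (ys ++ ys')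
  middle-fresh [] (u∉ ∷ _) = u∉
  middle-fresh (x ∷ ys) (x∉ ∷ uq) = (λ e → All.lookup x∉ (∈-++⁺ʳ ys (here refl)) (sym e)) ∷ middle-fresh ys uq

  module Merge (S : Cone) where
    open Parsing S public hiding (refl; sym; trans)

    -- The state of u after its pendent neighbour w has been removed.
    merge : State → State → State
    merge (free b) (free c) = joined c b
    merge (free b) (joined c c') = joined (unB b ⊗B c) c'
    merge (joined b b') (free c) = free (maB b b' ⊗B c)
    merge (joined b b') (joined c c') = joined (maB b b' ⊗B c) c'

    data Joined : State → Set where
      is-joined : ∀ {b b'} → Joined (joined b b')

    newEdge : State → State → ℕ
    newEdge (free _) (free _) = 1
    newEdge _ _ = 0

    letter-merge : ∀ w u → unD (letter w) ⊗ letter u ≈₂ letter (merge w u)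
    letter-merge (free b) (free c) = ≈₂-refl
    letter-merge (free b) (joined c c') = ⊗-swap (unD (dual b)) (unD (dual c')) (dual c)
    letter-merge (joined b b') (free c) = ≈₂-refl
    letter-merge (joined b b') (joined c c') = ⊗-swap (unD (unD (dual b') ⊗ dual b)) (unD (dual c')) (dual c)

    size-merge : ∀ w u → size (merge w u) ≡ size w ℕ.+ size u
    size-merge (free b) (free c) = solveℕ 4 (λ sb tb sc tc →
      (# 1) ⊹ ((# 2) ⋆ (sb ⊹ sc) ⊹ ((# 1) ⊹ tb ⊹ tc)) ≐ ((# 1) ⊹ ((# 2) ⋆ sb ⊹ tb)) ⊹ ((# 1) ⊹ ((# 2) ⋆ sc ⊹ tc))) refl (s b) (t b) (s c) (t c)
    size-merge (free b) (joined c c') = solveℕ 6 (λ sb tb sc tc sd td →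
      (# 1) ⊹ ((# 2) ⋆ (sd ⊹ (sb ⊹ sc)) ⊹ ((# 1) ⊹ td ⊹ ((# 1) ⊹ tb ⊹ tc))) ≐ ((# 1) ⊹ ((# 2) ⋆ sb ⊹ tb)) ⊹ ((# 1) ⊹ ((# 2) ⋆ (sd ⊹ sc) ⊹ ((# 1) ⊹ td ⊹ tc)))) refl (s b) (t b) (s c) (t c) (s c') (t c')
    size-merge (joined b b') (free c) = solveℕ 6 (λ sb tb sc tc sd td →
      (# 1) ⊹ ((# 2) ⋆ (((# 1) ⊹ (sb ⊹ sd)) ⊹ sc) ⊹ ((tb ⊹ td) ⊹ tc)) ≐ ((# 1) ⊹ ((# 2) ⋆ (sd ⊹ sb) ⊹ ((# 1) ⊹ td ⊹ tb))) ⊹ ((# 1) ⊹ ((# 2) ⋆ sc ⊹ tc))) refl (s b) (t b) (s c) (t c) (s b') (t b')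
    size-merge (joined b b') (joined c c') = solveℕ 8 (λ sb tb sc tc sd td se te →
      (# 1) ⊹ ((# 2) ⋆ (se ⊹ (((# 1) ⊹ (sb ⊹ sd)) ⊹ sc)) ⊹ ((# 1) ⊹ te ⊹ ((tb ⊹ td) ⊹ tc))) ≐ ((# 1) ⊹ ((# 2) ⋆ (sd ⊹ sb) ⊹ ((# 1) ⊹ td ⊹ tb))) ⊹ ((# 1) ⊹ ((# 2) ⋆ (se ⊹ sc) ⊹ ((# 1) ⊹ te ⊹ tc)))) refl (s b) (t b) (s c) (t c) (s b') (t b') (s c') (t c')

    edges-merge : ∀ w u → edges (merge w u) ≡ newEdge w u ℕ.+ (edges w ℕ.+ edges u)
    edges-merge (free b) (free c) = cong suc (ℕₚ.+-comm (s c) (s b))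
    edges-merge (free b) (joined c c') = solveℕ 3 (λ b c d → (# 1) ⊹ (b ⊹ c ⊹ d) ≐ b ⊹ ((# 1) ⊹ (c ⊹ d))) refl (s b) (s c) (s c')
    edges-merge (joined b b') (free c) = refl
    edges-merge (joined b b') (joined c c') = solveℕ 4 (λ b d c e → (# 1) ⊹ ((# 1) ⊹ (b ⊹ d) ⊹ c ⊹ e) ≐ ((# 1) ⊹ (b ⊹ d)) ⊹ ((# 1) ⊹ (c ⊹ e))) refl (s b) (s b') (s c) (s c')

    sizes-↭ : ∀ {us vs} → us ↭ vs → sizes us ≡ sizes vs
    sizes-↭ ↭refl = refl
    sizes-↭ (↭prep x p) = cong (size x ℕ.+_) (sizes-↭ p)
    sizes-↭ (↭swap x z p) = trans (cong (λ r → size x ℕ.+ (size z ℕ.+ r)) (sizes-↭ p)) (solveℕ 3 (λ a b c → a ⊹ (b ⊹ c) ≐ b ⊹ (a ⊹ c)) refl (size x) (size z) _)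
    sizes-↭ (↭trans p q) = trans (sizes-↭ p) (sizes-↭ q)

    edgess-↭ : ∀ {us vs} → us ↭ vs → edgess us ≡ edgess vs
    edgess-↭ ↭refl = refl
    edgess-↭ (↭prep x p) = cong (edges x ℕ.+_) (edgess-↭ p)
    edgess-↭ (↭swap x z p) = trans (cong (λ r → edges x ℕ.+ (edges z ℕ.+ r)) (edgess-↭ p)) (solveℕ 3 (λ a b c → a ⊹ (b ⊹ c) ≐ b ⊹ (a ⊹ c)) refl (edges x) (edges z) _)
    edgess-↭ (↭trans p q) = trans (edgess-↭ p) (edgess-↭ q)

    below-weaken : ∀ {Q n m m'} → m' ≤ m → Below Q n m → Below Q n m'
    below-weaken le (inj₁ (below₁ s t b o u)) = inj₁ (below₁ s t b o (ℕₚ.≤-trans le u))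
    below-weaken le (inj₂ (below₂ s t b o u)) = inj₂ (below₂ s t b o (ℕₚ.≤-trans le u))

  module Reduction (S : Cone) {n : ℕ} (G : Adj n) (simple : IsSimple G) (conn : IsConnected G) (C : Cycle G) (uniq : ∀ D → SameCycle C D) where
    open Structure G simple conn C uniq
    open Merge S
    open Weighted S (Fin n) Finₚ._≟_ using (P; matrix; matrix-diag; matrix-off; eliminate; update; P-congℓ; P-↭; Pendent; deg; deg-↭; deg-none)
    module R = Parsing S using (refl; sym; trans)

    assign : Fin n → State → (Fin n → State) → Fin n → State
    assign u x σ v = if does (v Finₚ.≟ u) then x else σ v

    assign-same : ∀ u x σ → assign u x σ u ≡ x
    assign-same u x σ with u Finₚ.≟ u
    ... | yes _ = refl
    ... | no ne = ⊥-elim (ne refl)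

    assign-other : ∀ u x σ v → v ≢ u → assign u x σ v ≡ σ v
    assign-other u x σ v ne with v Finₚ.≟ u
    ... | yes e = ⊥-elim (ne e)
    ... | no _ = refl

    -- `K` has one vertex per matching edge chosen so far and covers all edges not inside `vs`.
    -- Thanks to `marked`, an edge at a joined vertex is covered without a new entry.
    record Inv (T : Carrier) (vs : List (Fin n)) (σ : Fin n → State) (K : List (Fin n)) : Set where
      field
        value  : T ≈ P G (letter ∘ σ) vs
        total  : n ≡ sizes (map σ vs)
        count  : length K ≡ edgess (map σ vs)
        cover  : ∀ {a b} → Edge a b → a ∈ K ⊎ b ∈ K ⊎ (a ∈ vs × b ∈ vs)
        marked : ∀ {v} → v ∈ vs → Joined (σ v) → v ∈ K

    -- Of a new matching edge the end `u` enters the cover: it remains in the graph and may have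
    -- further edges to be covered.
    mark : State → State → Fin n → List (Fin n) → List (Fin n)
    mark (free _) (free _) u K = u ∷ K
    mark (free _) (joined _ _) u K = K
    mark (joined _ _) _ u K = K

    mark-length : ∀ x x' u K → length (mark x x' u K) ≡ newEdge x x' ℕ.+ length K
    mark-length (free _) (free _) u K = refl
    mark-length (free _) (joined _ _) u K = refl
    mark-length (joined _ _) _ u K = refl

    mark-keeps : ∀ x x' u K {v} → v ∈ K → v ∈ mark x x' u K
    mark-keeps (free _) (free _) u K m = there m
    mark-keeps (free _) (joined _ _) u K m = m
    mark-keeps (joined _ _) _ u K m = m

    mark-covers : ∀ x x' w u K → (Joined x → w ∈ K) → (Joined x' → u ∈ K) → w ∈ mark x x' u K ⊎ u ∈ mark x x' u K
    mark-covers (free _) (free _) w u K h h' = inj₂ (here refl)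
    mark-covers (free _) (joined _ _) w u K h h' = inj₂ (h' is-joined)
    mark-covers (joined _ _) _ w u K h h' = inj₁ (h is-joined)

    mark-merge : ∀ x x' u K → (Joined x' → u ∈ K) → Joined (merge x x') → u ∈ mark x x' u K
    mark-merge (free _) (free _) u K h j = here refl
    mark-merge (free _) (joined _ _) u K h j = h is-joined
    mark-merge (joined _ _) (joined _ _) u K h j = h is-joined
    mark-merge (joined _ _) (free _) u K h ()

    remove-pendent : ∀ {T w u vs σ K} → u ∈ vs → All (w ≢_) vs → Edge w u → All (λ z → z ≢ u → G w z ≡ false) vs → Unique vs →
      Inv T (w ∷ vs) σ K → ∃ λ σ' → ∃ λ K' → Inv T vs σ' K'
    remove-pendent {T} {w} {u} {vs} {σ} {K} u∈ w∉ wu others uq inv with ∈-∃++ u∈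
    ... | ys , ys' , refl = σ' , K' , record { value = value' ; total = total' ; count = count' ; cover = cover' ; marked = marked' }
      where
      open Inv inv
      x = merge (σ w) (σ u)
      σ' = assign u x σ
      K' = mark (σ w) (σ u) u K
      zs = ys ++ ys'
      p : ys ++ u ∷ ys' ↭ u ∷ zs
      p = Perm.shift u ys ys'
      All-p : ∀ {Q : Fin n → Set} → All Q (ys ++ u ∷ ys') → All Q (u ∷ zs)
      All-p = Perm.All-resp-↭ p
      u∉zs : All (u ≢_) zs
      u∉zs = middle-fresh ys uq
      tail : ∀ {Q : Fin n → Set} {v vs} → All Q (v ∷ vs) → All Q vs
      tail (_ ∷ qs) = qs
      σ'-zs : map σ' zs ≡ map σ zs
      σ'-zs = map-cong-local (All.map (λ {z} ne → assign-other u x σ z (λ e → ne (sym e))) u∉zs)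
      pendent : Pendent G w u zs
      pendent = record { w≢u = All.lookup w∉ u∈ ; w∉zs = tail (All-p w∉) ; u∉zs = u∉zs ; loop = loop ; symm = symm ; edge = wu
        ; other = All.zipWith (λ (ne , h) → h (λ e → ne (sym e))) (u∉zs , tail (All-p others)) }
      value' : T ≈ P G (letter ∘ σ') (ys ++ u ∷ ys')
      value' = R.trans value (R.trans (P-↭ G (letter ∘ σ) (↭-prep w p)) (R.trans (eliminate G (letter ∘ σ) w u zs pendent)
        (R.trans (P-congℓ G (update u (unD (letter (σ w)) ⊗ letter (σ u)) (letter ∘ σ)) (letter ∘ σ') (u ∷ zs) (All.universal same (u ∷ zs)))
          (P-↭ G (letter ∘ σ') (↭-sym p)))))
        where
        same : ∀ v → update u (unD (letter (σ w)) ⊗ letter (σ u)) (letter ∘ σ) v ≈₂ letter (σ' v)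
        same v with v Finₚ.≟ u
        ... | yes _ = letter-merge (σ w) (σ u)
        ... | no _ = ≈₂-refl
      total' : n ≡ sizes (map σ' (ys ++ u ∷ ys'))
      total' = trans total (trans (cong (size (σ w) ℕ.+_) (sizes-↭ (Perm.map⁺ σ p))) (trans (sym (ℕₚ.+-assoc (size (σ w)) (size (σ u)) _))
        (trans (cong₂ ℕ._+_ (trans (sym (size-merge (σ w) (σ u))) (cong size (sym (assign-same u x σ)))) (cong sizes (sym σ'-zs))) (sym (sizes-↭ (Perm.map⁺ σ' p))))))
      count' : length K' ≡ edgess (map σ' (ys ++ u ∷ ys'))
      count' = trans (mark-length (σ w) (σ u) u K) (trans (cong (newEdge (σ w) (σ u) ℕ.+_) (trans count (cong (edges (σ w) ℕ.+_) (edgess-↭ (Perm.map⁺ σ p)))))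
        (trans (solveℕ 4 (λ a b c d → a ⊹ (b ⊹ (c ⊹ d)) ≐ (a ⊹ (b ⊹ c)) ⊹ d) refl (newEdge (σ w) (σ u)) (edges (σ w)) (edges (σ u)) _)
        (trans (cong₂ ℕ._+_ (trans (sym (edges-merge (σ w) (σ u))) (cong edges (sym (assign-same u x σ)))) (cong edgess (sym σ'-zs))) (sym (edgess-↭ (Perm.map⁺ σ' p))))))
      at-w : ∀ {b} → Edge w b → b ∈ ys ++ u ∷ ys' → b ≡ u
      at-w {b} e b∈ with b Finₚ.≟ u
      ... | yes q = q
      ... | no ne with trans (sym (All.lookup others b∈ ne)) e
      ...   | ()
      covered : w ∈ K' ⊎ u ∈ K'
      covered = mark-covers (σ w) (σ u) w u K (marked (here refl)) (marked (there u∈))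
      cover' : ∀ {a b} → Edge a b → a ∈ K' ⊎ b ∈ K' ⊎ (a ∈ ys ++ u ∷ ys' × b ∈ ys ++ u ∷ ys')
      cover' {a} {b} e with cover e
      ... | inj₁ m = inj₁ (mark-keeps (σ w) (σ u) u K m)
      ... | inj₂ (inj₁ m) = inj₂ (inj₁ (mark-keeps (σ w) (σ u) u K m))
      ... | inj₂ (inj₂ (there a∈ , there b∈)) = inj₂ (inj₂ (a∈ , b∈))
      ... | inj₂ (inj₂ (here refl , here refl)) with trans (sym (loop a)) e
      ...   | ()
      cover' {a} {b} e | inj₂ (inj₂ (here refl , there b∈)) with at-w e b∈
      ...   | refl = Sum.map₂ inj₁ covered
      cover' {a} {b} e | inj₂ (inj₂ (there a∈ , here refl)) with at-w (trans (symm b a) e) a∈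
      ...   | refl = Sum.map₂ inj₁ (Sum.swap covered)
      marked' : ∀ {v} → v ∈ ys ++ u ∷ ys' → Joined (σ' v) → v ∈ K'
      marked' {v} v∈ j with v Finₚ.≟ u
      ... | yes refl = mark-merge (σ w) (σ u) u K (marked (there u∈)) j
      ... | no _ = mark-keeps (σ w) (σ u) u K (marked (there v∈) j)

    prune : ∀ {T vs σ K} → Grow vs → Inv T vs σ K → ∃ λ σ' → ∃ λ K' → Inv T cs σ' K'
    prune base inv = _ , _ , inv
    prune (add g u∈ w∉ wu others) inv with remove-pendent u∈ w∉ wu others (grow-unique g) inv
    ... | _ , _ , inv' = prune g inv'

    deg-++ : ∀ xs ys u → deg G (xs ++ ys) u ≡ deg G xs u ℕ.+ deg G ys u
    deg-++ [] ys u = refl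
    deg-++ (x ∷ xs) ys u = trans (cong (b2ℕ (G u x) ℕ.+_) (deg-++ xs ys u)) (sym (ℕₚ.+-assoc (b2ℕ (G u x)) _ _))

    first-degree : ∀ {c l} → CycleList (c ∷ l) → deg G (c ∷ l) c ≡ 2
    first-degree (cyclic {c} {v} {xs} {z} cv cz cx _) rewrite loop c | cv | deg-++ xs [ z ] c | deg-none G c xs cx | cz = refl

    cycle-degree : ∀ {l x} → CycleList l → x ∈ l → deg G l x ≡ 2
    cycle-degree {x = x} cy m with ∈-∃++ m
    ... | ys , zs , refl = trans (deg-↭ G x (Perm.++-comm ys (x ∷ zs))) (first-degree (rotateTo ys (x ∷ zs) cy))

    module _ (ℓ : Fin n → Dual) (l : List (Fin n)) (cy : CycleList l) (uq : Unique l) where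
      open CycleDet S (Fin n) using (Chain; det-cycle; end; link)
      M : Fin n → Fin n → Carrier
      M = matrix G ℓ l

      on : ∀ {x} → x ∈ l → M x x ≈ (y * proj₁ (ℓ x) + proj₂ (ℓ x)) + κ 2 * proj₁ (ℓ x)
      on {x} m = R.trans (matrix-diag G ℓ l x (loop x)) (reflexive (cong (λ d → (y * proj₁ (ℓ x) + proj₂ (ℓ x)) + κ d * proj₁ (ℓ x)) (cycle-degree cy m)))

      distinct : ∀ {x z} → Edge x z → x ≢ z
      distinct e refl = no-loop e

      edge-entry : ∀ {x z} → Edge x z → M x z ≈ proj₁ (ℓ x)
      edge-entry e = R.trans (matrix-off G ℓ l _ _ (distinct e) e) (solve 1 (λ a → a :* k 1 := a) R.refl _)

      zero-entry : ∀ {x z} → x ≢ z → G x z ≡ false → M x z ≈ κ 0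
      zero-entry ne e = R.trans (matrix-off G ℓ l _ _ ne e) (solve 1 (λ a → a :* k 0 := k 0) R.refl _)

      flip : ∀ {x z} → G x z ≡ true → G z x ≡ true
      flip {x} {z} e = trans (symm z x) e

      chain : ∀ {xs} → PathLike xs → Unique xs → All (_∈ l) xs → Chain ℓ M xs
      chain end _ (m ∷ []) = end (on m)
      chain (link {x} {x'} {zs} e ns p) ((_ ∷ x∉) ∷ uq) (m ∷ ms) = link (on m) (edge-entry e) (edge-entry (flip e))
        (All.zipWith (λ (ne , q) → zero-entry ne q) (x∉ , ns))
        (All.zipWith (λ {z} (ne , q) → zero-entry (λ r → ne (sym r)) (trans (symm z x) q)) (x∉ , ns))
        (chain p uq ms)

    cycle-value : ∀ ℓ {l} j → CycleList l → Unique l → length l ≡ 3 ℕ.+ (j ℕ.+ j) → P G ℓ l ≈ cyc (map ℓ l)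
    cycle-value ℓ {l} j cy@(cyclic {c} {v} {xs} {z} cv cz cx path) uq@((_ ∷ c∉) ∷ uq') len = det-cycle ℓ (M ℓ l cy uq) c v xs z j
        (ℕₚ.suc-injective (trans (trans (ℕₚ.+-comm 1 (length xs)) (sym (length-++ xs))) (ℕₚ.suc-injective (ℕₚ.suc-injective len)))) (record
      { chain = chain ℓ l cy uq path uq' (All.tabulate there)
      ; Mcc = on ℓ l cy uq (here refl)
      ; Mcv = edge-entry ℓ l cy uq cv ; Mvc = edge-entry ℓ l cy uq (trans (symm v c) cv)
      ; Mcz = edge-entry ℓ l cy uq cz ; Mzc = edge-entry ℓ l cy uq (trans (symm z c) cz)
      ; Mcx = All.zipWith (λ (ne , q) → zero-entry ℓ l cy uq ne q) (Allₚ.++⁻ˡ xs c∉ , cx)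
      ; Mxc = All.zipWith (λ {x} (ne , q) → zero-entry ℓ l cy uq (λ r → ne (sym r)) (trans (symm x c) q)) (Allₚ.++⁻ˡ xs c∉ , cx) })
      where open CycleDet S (Fin n) using (det-cycle)

    -- A vertex cover of the path w minus the joined vertices, with one vertex
    -- for each of the pairs counted by freePairs.
    mutual
      pathCover : (Fin n → State) → List (Fin n) → List (Fin n)
      pathCover σ [] = []
      pathCover σ (x ∷ w) with σ x
      ... | joined _ _ = pathCover σ w
      ... | free _ = afterFree σ w

      afterFree : (Fin n → State) → List (Fin n) → List (Fin n)
      afterFree σ [] = []
      afterFree σ (x ∷ w) with σ x
      ... | joined _ _ = pathCover σ w
      ... | free _ = x ∷ pathCover σ w

    pathCover-length : ∀ σ w → length (pathCover σ w) ≡ freePairs (map σ w)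
    pathCover-length σ [] = refl
    pathCover-length σ (x ∷ w) with σ x
    pathCover-length σ (x ∷ w) | joined _ _ = pathCover-length σ w
    pathCover-length σ (x ∷ []) | free _ = refl
    pathCover-length σ (x ∷ x' ∷ w) | free _ with σ x'
    ... | joined _ _ = pathCover-length σ w
    ... | free _ = cong suc (pathCover-length σ w)

    Cov : (Fin n → State) → List (Fin n) → Fin n → Set
    Cov σ w v = v ∈ pathCover σ w ⊎ Joined (σ v)

    path-tail : ∀ {x w} → PathLike (x ∷ w) → w ≡ [] ⊎ PathLike w
    path-tail end = inj₁ refl
    path-tail (link _ _ p) = inj₂ p

    non-edge : ∀ {x z} → G x z ≡ false → Edge x z → ⊥
    non-edge e e' with trans (sym e) e'
    ... | ()

    -- Of two paired free vertices the second is in the cover, so the edge behind it and the edge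
    -- ahead are both covered. A free vertex outside the cover has only joined or chosen neighbours
    -- on the path.
    path-cover : ∀ σ w {a b} → (w ≡ [] ⊎ PathLike w) → a ∈ w → b ∈ w → Edge a b → Cov σ w a ⊎ Cov σ w b
    path-cover σ (x ∷ w) (inj₂ p) a∈ b∈ e with σ x in ex
    path-cover σ (x ∷ w) (inj₂ p) (here refl) b∈ e | joined _ _ = inj₁ (inj₂ (subst Joined (sym ex) is-joined))
    path-cover σ (x ∷ w) (inj₂ p) (there a∈) (here refl) e | joined _ _ = inj₂ (inj₂ (subst Joined (sym ex) is-joined))
    path-cover σ (x ∷ w) (inj₂ p) (there a∈) (there b∈) e | joined _ _ = path-cover σ w (path-tail p) a∈ b∈ e
    path-cover σ (x ∷ []) (inj₂ p) (here refl) (here refl) e | free _ = ⊥-elim (no-loop e)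
    path-cover σ (x ∷ x' ∷ w) {a} {b} (inj₂ (link xx' ns p)) a∈ b∈ e | free _ = go a∈ b∈
      where
      Cov' : Fin n → Set
      Cov' v = v ∈ afterFree σ (x' ∷ w) ⊎ Joined (σ v)
      at-x' : Cov' x'
      at-x' with σ x' in ex'
      ... | joined _ _ = inj₂ is-joined
      ... | free _ = inj₁ (here refl)
      later : ∀ {v} → Cov σ w v → Cov' v
      later c with σ x'
      ... | joined _ _ = c
      ... | free _ = Sum.map₁ there c
      go : a ∈ x ∷ x' ∷ w → b ∈ x ∷ x' ∷ w → Cov' a ⊎ Cov' b
      go (there (here refl)) _ = inj₁ at-x'
      go (here refl) (here refl) = ⊥-elim (no-loop e)
      go (here refl) (there (here refl)) = inj₂ at-x'
      go (here refl) (there (there m)) = ⊥-elim (non-edge (All.lookup ns m) e)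
      go (there (there m)) (here refl) = ⊥-elim (non-edge (All.lookup ns m) (trans (symm x a) e))
      go (there (there m)) (there (here refl)) = inj₂ at-x'
      go (there (there ma)) (there (there mb)) = Sum.map later later (path-cover σ w (path-tail p) ma mb e)

    find-joined : ∀ (σ : Fin n → State) l → (∃ λ bs → map σ l ≡ map free bs) ⊎
      (∃ λ ys → ∃ λ c → ∃ λ zs → ∃ λ b → ∃ λ b' → l ≡ ys ++ c ∷ zs × σ c ≡ joined b b')
    find-joined σ [] = inj₁ ([] , refl)
    find-joined σ (x ∷ l) with σ x in ex
    ... | joined b b' = inj₂ ([] , x , l , b , b' , refl , ex)
    ... | free b with find-joined σ l
    ...   | inj₁ (bs , e) = inj₁ (b ∷ bs , cong (free b ∷_) e)
    ...   | inj₂ (ys , c , zs , d , d' , refl , ec) = inj₂ (x ∷ ys , c , zs , d , d' , refl , ec)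

    half-≤ : ∀ a b → 2 ℕ.* a ≤ suc (2 ℕ.* b) → a ≤ b
    half-≤ a b h with a ℕ.≤? b
    ... | yes le = le
    ... | no nle = ⊥-elim (ℕₚ.<-irrefl refl (ℕₚ.<-≤-trans (ℕₚ.≤-reflexive (sym (cong suc (ℕₚ.+-suc b (b ℕ.+ 0)))))
        (ℕₚ.≤-trans (ℕₚ.*-monoʳ-≤ 2 (ℕₚ.≰⇒> nle)) h)))

    below-cycle : ∀ {T σ K} j M → length cs ≡ 3 ℕ.+ (j ℕ.+ j) → Inv T cs σ K → IsMatching G M → Below T n (length M)
    below-cycle {T} {σ} {K} j M len inv (edges-M , unique-M) with find-joined σ cs
    ... | inj₁ ([] , e) = ⊥-elim (ℕₚ.0≢1+n (trans (sym (trans (sym (length-map σ cs)) (cong length e))) len))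
    ... | inj₁ (b ∷ bs , e) = below-weaken bound (below-≽ (≽-refl value') (trans total (cong sizes e)) refl (below-all-free b bs j len'))
      where
      open Inv inv
      value' : T ≈ cyc (letters (map free (b ∷ bs)))
      value' = R.trans value (R.trans (cycle-value (letter ∘ σ) j cycleList (grow-unique base) len)
        (reflexive (cong cyc (trans (map-∘ cs) (cong letters e)))))
      len' : length bs ≡ suc j ℕ.+ suc j
      len' = ℕₚ.suc-injective (trans (sym (length-map free (b ∷ bs))) (trans (cong length (sym e)) (trans (length-map σ cs) (trans len (cong (λ i → suc (suc i)) (sym (ℕₚ.+-suc j j)))))))
      -- The whole cycle serves as `L`, so 2|M| ≤ 2|K| + 2j + 3, and rounding down gives |K| + j +
      -- 1.
      bound : length M ≤ suc j ℕ.+ edgess (map free (b ∷ bs))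
      bound = half-≤ _ _ (subst (2 ℕ.* length M ≤_)
        (trans (cong₂ (λ a b → 2 ℕ.* a ℕ.+ b) (trans count (cong edgess e)) len) (solveℕ 2 (λ a j → (# 2) ⋆ a ⊹ ((# 3) ⊹ (j ⊹ j)) ≐ (# 1) ⊹ (# 2) ⋆ ((# 1) ⊹ j ⊹ a)) refl _ j))
        (matching-bound M K cs unique-M (All.map cover edges-M)))
    ... | inj₂ (ys , c , zs , b , b' , ecs , ec) = below-weaken bound (below-≽ (≽-refl value') total' refl (below-joined b b' (map σ w) j len'))
      where
      open Inv inv
      w = zs ++ ys
      p : cs ↭ c ∷ w
      p = subst (_↭ c ∷ w) (sym ecs) (Perm.++-comm ys (c ∷ zs))
      split : map σ cs ≡ map σ ys ++ (joined b b' ∷ map σ zs)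
      split = trans (cong (map σ) ecs) (trans (map-++ σ ys (c ∷ zs)) (cong (λ x → map σ ys ++ (x ∷ map σ zs)) ec))
      value' : T ≈ cyc (letters (joined b b' ∷ map σ w))
      value' = R.trans value (R.trans (cycle-value (letter ∘ σ) j cycleList (grow-unique base) len)
        (R.trans (reflexive (cong cyc (trans (map-∘ cs) (cong letters split))))
        (R.trans (cyc-rotate-states (map σ ys) (joined b b' ∷ map σ zs)) (reflexive (cong (λ l → cyc (letters (joined b b' ∷ l))) (sym (map-++ σ zs ys)))))))
      joined-w : map σ (c ∷ w) ≡ joined b b' ∷ map σ w
      joined-w = cong (_∷ map σ w) ec
      total' : n ≡ sizes (joined b b' ∷ map σ w)
      total' = trans total (trans (sizes-↭ (Perm.map⁺ σ p)) (cong sizes joined-w))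
      len' : length (map σ w) ≡ suc j ℕ.+ suc j
      len' = trans (length-map σ w) (ℕₚ.suc-injective (trans (sym (Perm.↭-length p)) (trans len (cong (λ i → suc (suc i)) (sym (ℕₚ.+-suc j j))))))
      path : ∀ {l} → CycleList (c ∷ l) → PathLike l
      path (cyclic _ _ _ p) = p
      w-path : PathLike w
      w-path = path (rotateTo ys (c ∷ zs) (subst CycleList ecs cycleList))
      c∈cs : c ∈ cs
      c∈cs = Perm.∈-resp-↭ (↭-sym p) (here refl)
      c∈K : c ∈ K
      c∈K = marked c∈cs (subst Joined (sym ec) is-joined)
      -- `c` is joined and hence in `K`, so its edges are covered and only the path `w` through the
      -- other cycle vertices is left.
      L' = pathCover σ w
      K' = K ++ L'
      in-K' : ∀ {v} → v ∈ cs → Cov σ w v → v ∈ K'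
      in-K' m (inj₁ l) = ∈-++⁺ʳ K l
      in-K' m (inj₂ jn) = ∈-++⁺ˡ (marked m jn)
      cover' : ∀ {a d} → Edge a d → a ∈ K' ⊎ d ∈ K' ⊎ (a ∈ [] × d ∈ [])
      cover' {a} {d} e with cover e
      ... | inj₁ m = inj₁ (∈-++⁺ˡ m)
      ... | inj₂ (inj₁ m) = inj₂ (inj₁ (∈-++⁺ˡ m))
      ... | inj₂ (inj₂ (ma , md)) with Perm.∈-resp-↭ p ma | Perm.∈-resp-↭ p md
      ...   | here refl | _ = inj₁ (∈-++⁺ˡ c∈K)
      ...   | there _ | here refl = inj₂ (inj₁ (∈-++⁺ˡ c∈K))
      ...   | there a∈ | there d∈ with path-cover σ w (inj₂ w-path) a∈ d∈ e
      ...     | inj₁ x = inj₁ (in-K' ma x)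
      ...     | inj₂ x = inj₂ (inj₁ (in-K' md x))
      bound : length M ≤ freePairs (map σ w) ℕ.+ edgess (joined b b' ∷ map σ w)
      bound = ℕₚ.≤-trans (half-≤ (length M) (length K') (ℕₚ.m≤n⇒m≤1+n (subst (2 ℕ.* length M ≤_) (ℕₚ.+-identityʳ _) (matching-bound M K' [] unique-M (All.map cover' edges-M)))))
        (ℕₚ.≤-reflexive (trans (length-++ K) (trans (ℕₚ.+-comm (length K) (length L')) (cong₂ ℕ._+_ (pathCover-length σ w)
          (trans count (trans (edgess-↭ (Perm.map⁺ σ p)) (cong edgess joined-w)))))))

    start : Fin n → State
    start _ = free emptyB

    sizes-start : ∀ l → sizes (map start l) ≡ length l
    sizes-start [] = refl
    sizes-start (x ∷ l) = cong suc (sizes-start l)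

    edgess-start : ∀ l → edgess (map start l) ≡ 0
    edgess-start [] = refl
    edgess-start (x ∷ l) = edgess-start l

    below : ∀ M → IsMatching G M → Odd (cycleLength C) → Below (P G (λ _ → oneD) (allFin n)) n (length M)
    below M isM (zero , ())
    below M isM (suc i , odd) with spanning
    ... | vs , g , p = go (prune g initial)
      where
      T = P G (λ _ → oneD) (allFin n)
      initial : Inv T vs start []
      initial = record { value = P-↭ G (λ _ → oneD) (↭-sym p)
        ; total = trans (sym (length-tabulate (λ i → i))) (trans (sym (Perm.↭-length p)) (sym (sizes-start vs)))
        ; count = sym (edgess-start vs)
        ; cover = λ _ → inj₂ (inj₂ (Perm.∈-resp-↭ (↭-sym p) (∈-allFin _) , Perm.∈-resp-↭ (↭-sym p) (∈-allFin _)))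
        ; marked = λ _ () }
        where open import Data.List.Membership.Propositional.Properties using (∈-allFin)
      go : (∃ λ σ → ∃ λ K → Inv T cs σ K) → Below T n (length M)
      go (σ , K , inv) = below-cycle i M len inv isM
        where
        len : length cs ≡ 3 ℕ.+ (i ℕ.+ i)
        len = trans (length-tabulate (Cycle.vtx C)) (trans odd (solveℕ 1 (λ i → (# 1) ⊹ (# 2) ⋆ ((# 1) ⊹ i) ≐ (# 3) ⊹ (i ⊹ i)) refl i))

-- Trading surplus paths for edges, and comparing the two triangles

module Candidates where
  open Cones using (Cone)
  open CycleWords using (module Words)
  open import Data.Nat using (_∸_; _*_)
  open import Relation.Binary.PropositionalEquality as ≡ using (_≡_; refl; sym; trans; cong; subst)

  module Compare (S : Cone) where
    open Words S hiding (refl; sym; trans; _*_) public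
    open Words S using () renaming (_*_ to _ℝ*_)
    module R = Words S using (refl; sym; trans)

    -- Each of `d` surplus pendent paths is split into two pendent edges, which keeps the order and
    -- gives up one matching edge.
    lower : (P' : ℕ → ℕ → Carrier) → (∀ s t → P' (suc s) t ≽ P' s (suc (suc t))) → ∀ d s t → P' (d ℕ.+ s) t ≽ P' s (d * 2 ℕ.+ t)
    lower P' h zero s t = ≽-refl R.refl
    lower P' h (suc d) s t = ≽-trans (h (d ℕ.+ s) t) (subst (λ i → P' (d ℕ.+ s) (suc (suc t)) ≽ P' s i) (trans (ℕₚ.+-suc (d * 2) (suc t)) (cong suc (ℕₚ.+-suc (d * 2) t))) (lower P' h d s (suc (suc t))))

    lower₁ : ∀ d s t → P₁ (d ℕ.+ s) t ≽ P₁ s (d * 2 ℕ.+ t)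
    lower₁ = lower P₁ (λ s t → flatten₁ (flattens-unmatch s t))

    lower₂ : ∀ d s t → P₂ (d ℕ.+ s) t ≽ P₂ s (d * 2 ℕ.+ t)
    lower₂ = lower P₂ (λ s t → flatten₂ (flattens-unmatch s t))

    P₂≽P₁ : ∀ s t → P₂ s t ≽ P₁ s (suc (suc t))
    P₂≽P₁ s t = ≽-respʳ (triangle-free {Fl s t} {leafD} {leafD} (N-Fl s t) N-leaf N-leaf)
      (cyc-cong {Fl s t ⊗ (leafD ⊗ leafD) ∷ oneD ∷ oneD ∷ []} {Fl s (suc (suc t)) ∷ oneD ∷ oneD ∷ []}
        (≈₂-trans (⊗-comm (Fl s t) (leafD ⊗ leafD)) (≈₂-trans (⊗-assoc leafD leafD (Fl s t))
          (≈₂-sym (≈₂-trans (Fl-leaf s (suc t)) (⊗-cong ≈₂-refl (Fl-leaf s t))))) ∷ ≈₂-refl ∷ ≈₂-refl ∷ []))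

    below₁-at : ∀ {Q n m} s r → Below₁ Q n m → n ≡ 2 * (2 ℕ.+ s) ℕ.+ r → 2 ℕ.+ s ≤ m → Q ≽ P₁ s (suc r)
    below₁-at {Q} {n} {m} s r (below₁ s' t' b o u) en le = ≽-trans b (subst₂ (λ i j → P₁ i t' ≽ P₁ s j) (ℕₚ.m∸n+n≡m s≤s') eq (lower₁ (s' ∸ s) s t'))
      where
      open ≡ using (subst₂)
      s≤s' : s ≤ s'
      s≤s' = ℕₚ.+-cancelˡ-≤ 2 s s' (ℕₚ.≤-trans le u)
      d = s' ∸ s
      eq : d * 2 ℕ.+ t' ≡ suc r
      eq = ℕₚ.+-cancelˡ-≡ (3 ℕ.+ 2 * s) _ _ (trans
        (trans (solveℕ 3 (λ s d t → (# 3) ⊹ (# 2) ⋆ s ⊹ (d ⋆ (# 2) ⊹ t) ≐ (# 3) ⊹ ((# 2) ⋆ (d ⊹ s) ⊹ t)) refl s d t') (cong (λ i → 3 ℕ.+ (2 * i ℕ.+ t')) (ℕₚ.m∸n+n≡m s≤s')))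
        (trans (sym o) (trans en (solveℕ 2 (λ s r → (# 2) ⋆ ((# 2) ⊹ s) ⊹ r ≐ (# 3) ⊹ (# 2) ⋆ s ⊹ ((# 1) ⊹ r)) refl s r))))

    below₂-at : ∀ {Q n m} s r → Below₂ Q n m → n ≡ 2 * (3 ℕ.+ s) ℕ.+ r → 3 ℕ.+ s ≤ m → Q ≽ P₂ s (suc r)
    below₂-at {Q} {n} {m} s r (below₂ s' t' b o u) en le = ≽-trans b (subst₂ (λ i j → P₂ i t' ≽ P₂ s j) (ℕₚ.m∸n+n≡m s≤s') eq (lower₂ (s' ∸ s) s t'))
      where
      open ≡ using (subst₂)
      s≤s' : s ≤ s'
      s≤s' = ℕₚ.+-cancelˡ-≤ 3 s s' (ℕₚ.≤-trans le u)
      d = s' ∸ s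
      eq : d * 2 ℕ.+ t' ≡ suc r
      eq = ℕₚ.+-cancelˡ-≡ (5 ℕ.+ 2 * s) _ _ (trans
        (trans (solveℕ 3 (λ s d t → (# 5) ⊹ (# 2) ⋆ s ⊹ (d ⋆ (# 2) ⊹ t) ≐ (# 5) ⊹ ((# 2) ⋆ (d ⊹ s) ⊹ t)) refl s d t') (cong (λ i → 5 ℕ.+ (2 * i ℕ.+ t')) (ℕₚ.m∸n+n≡m s≤s')))
        (trans (sym o) (trans en (solveℕ 2 (λ s r → (# 2) ⋆ ((# 3) ⊹ s) ⊹ r ≐ (# 5) ⊹ (# 2) ⋆ s ⊹ ((# 1) ⊹ r)) refl s r))))

    -- Moving the two outer pendent edges to the centre costs a matching edge, which is harmless
    -- when only two are required.
    below₂⇒₁ : ∀ {Q n m} → Below₂ Q n m → Below₁ Q n 2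
    below₂⇒₁ (below₂ s t b o u) = below₁ s (suc (suc t)) (≽-trans b (P₂≽P₁ s t))
      (trans o (solveℕ 2 (λ s t → (# 5) ⊹ ((# 2) ⋆ s ⊹ t) ≐ (# 3) ⊹ ((# 2) ⋆ s ⊹ ((# 2) ⊹ t))) refl s t)) (s≤s (s≤s z≤n))

    Δ : ℕ → ℕ → Carrier
    Δ s t = (y + κ 2) ℝ* ((y + κ 2) ℝ* proj₁ (Fl s t)) - (y ℝ* y + κ 3 ℝ* y + κ 1) ℝ* proj₂ (Fl s t)

    difference : ∀ s t → P₁ (suc s) t - P₂ s t ≈ y ℝ* Δ s t
    difference s t = R.trans (+-cong (triangle-val₁ (Fl (suc s) t)) (-‿cong (triangle-val₂ (Fl s t))))
      (solve 3 (λ F C y →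
        let α = k 1 :+ y ; β = y :* y :+ k 3 :* y :+ k 1 ; δ = y :* y :+ k 2 :* y
            X = y :* y :+ k 4 :* y :+ k 3 ; V = k 2 :* (y :* y) :+ k 6 :* y :+ k 4
            X' = k 3 :* (α :* α) :+ k 4 :* (δ :* α) :+ δ :* δ ; V' = k 4 :* (α :* α) :+ k 6 :* (δ :* α) :+ k 2 :* (δ :* δ) in
        ((β :* F) :* (y :* X :+ V) :+ (β :* C :+ δ :* F) :* X) :- (F :* (y :* X' :+ V') :+ C :* X')
        := y :* ((y :+ k 2) :* ((y :+ k 2) :* F) :- β :* C)) R.refl (proj₁ (Fl s t)) (proj₂ (Fl s t)) y)

    -- The case n = 6, m = 3, where `Δ` is 2y² + 7y + 4.
    P₁≽P₂ : P₁ 1 1 ≽ P₂ 0 1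
    P₁≽P₂ = N-resp (R.sym (R.trans (difference 0 1) (solve 1 (λ y →
        y :* ((y :+ k 2) :* ((y :+ k 2) :* ((k 1 :+ y) :* k 1)) :- (y :* y :+ k 3 :* y :+ k 1) :* ((k 1 :+ y) :* k 0 :+ y :* k 1))
        := k 2 :* (y :* (y :* y)) :+ k 7 :* (y :* y) :+ k 4 :* y) R.refl y)))
      (N-κ 2 ⊠ (N-y ⊠ (N-y ⊠ N-y)) ⊞ N-κ 7 ⊠ (N-y ⊠ N-y) ⊞ N-κ 4 ⊠ N-y)

-- From the order on polynomials to the coefficients φᵢ

open import Defs
open PolynomialRing
open Candidates using (module Compare)
open CharacteristicPolynomials using (polyCone; module Link)
open ExtremalGraphs using (upFrom; adjE; adjE-loop; LoopFree; attach-last; module Evaluate)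
open TreePruning using (module Reduction)
open import Data.Nat using (_∸_; _*_)
open import Data.Integer as ℤ using (ℤ; +_; -_)
import Data.Integer.Solver as ℤS
open import Relation.Binary.PropositionalEquality as ≡ using (_≡_; refl; sym; trans; cong; cong₂; subst)

open Compare polyCone using (P₁; P₂; Fl; _≽_; ≽-trans; leafD; oneD; Below; below₁-at; below₂-at; below₂⇒₁; P₁≽P₂; Δ; difference; pathD; val; X₁; V₁; X₂; V₂; triangle-val₁; triangle-val₂; y; κ; Dual; _⊗_)

module Z = ℤS.+-*-Solver

sign-square : ∀ i → sign i ℤ.* sign i ≡ + 1
sign-square zero = refl
sign-square (suc i) = trans (Z.solve 1 (λ a → (Z.:- a) Z.:* (Z.:- a) Z.:= a Z.:* a) refl (sign i)) (sign-square i)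

-- The signs of i and n combine to that of n - i, so φᵢ is the coefficient of y to the power n - i
-- in `Q`, where y = -x.
φ-value : ∀ {n} (H : Adj n) Q → charPolyQ H ≋ scale (sign n) Q → ∀ i → i ≤ n → φ H i ≡ sign (n ∸ i) ℤ.* coeff Q (n ∸ i)
φ-value {n} H Q e i i≤n = begin
  sign i ℤ.* coeff (charPolyQ H) (n ∸ i)        ≡⟨ cong (sign i ℤ.*_) (trans (at e (n ∸ i)) (coeff-scale (sign n) Q (n ∸ i))) ⟩
  sign i ℤ.* (sign n ℤ.* c)                     ≡⟨ cong (λ j → sign i ℤ.* (sign j ℤ.* c)) (sym (ℕₚ.m+[n∸m]≡n i≤n)) ⟩
  sign i ℤ.* (sign (i ℕ.+ (n ∸ i)) ℤ.* c)       ≡⟨ cong (λ z → sign i ℤ.* (z ℤ.* c)) (sign-+ i (n ∸ i)) ⟩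
  sign i ℤ.* (sign i ℤ.* sign (n ∸ i) ℤ.* c)    ≡⟨ Z.solve 3 (λ a b c → a Z.:* (a Z.:* b Z.:* c) Z.:= (a Z.:* a) Z.:* (b Z.:* c)) refl (sign i) (sign (n ∸ i)) c ⟩
  sign i ℤ.* sign i ℤ.* (sign (n ∸ i) ℤ.* c)    ≡⟨ cong (ℤ._* (sign (n ∸ i) ℤ.* c)) (sign-square i) ⟩
  + 1 ℤ.* (sign (n ∸ i) ℤ.* c)                  ≡⟨ ℤₚ.*-identityˡ _ ⟩
  sign (n ∸ i) ℤ.* c                            ∎
  where
  open ≡.≡-Reasoning
  c = coeff Q (n ∸ i)

signed-difference : ∀ p q k → sign k ℤ.* coeff (p ⊕ negate q) k ≡ sign k ℤ.* coeff p k ℤ.- sign k ℤ.* coeff q k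
signed-difference p q k = trans (cong (sign k ℤ.*_) (trans (coeff-⊕ p (negate q) k) (cong (ℤ._+_ (coeff p k)) (coeff-negate q k))))
  (Z.solve 3 (λ s a b → s Z.:* (a Z.:+ Z.:- b) Z.:= s Z.:* a Z.:+ Z.:- (s Z.:* b)) refl (sign k) (coeff p k) (coeff q k))

coeffGE : ∀ {n} (G H : Adj n) {Q Q'} → charPolyQ G ≋ scale (sign n) Q → charPolyQ H ≋ scale (sign n) Q' → Q ≽ Q' → CoeffGE G H
coeffGE {n} G H {Q} {Q'} eG eH ge i i≤n = ≡.subst₂ ℤ._≤_ (sym (φ-value H Q' eH i i≤n)) (sym (φ-value G Q eG i i≤n))
  (ℤₚ.0≤i-j⇒j≤i (subst (+ 0 ℤ.≤_) (signed-difference Q Q' (n ∸ i)) (ge (n ∸ i))))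

tabulate-upFrom : ∀ n a (f : Fin n → ℕ) → (∀ i → f i ≡ a ℕ.+ toℕ i) → tabulate f ≡ upFrom a n
tabulate-upFrom zero a f h = refl
tabulate-upFrom (suc n) a f h = cong₂ _∷_ (trans (h fzero) (ℕₚ.+-identityʳ a))
  (tabulate-upFrom n (suc a) (f ∘ fsuc) (λ i → trans (h (fsuc i)) (ℕₚ.+-suc a (toℕ i))))

G-graph-value : ∀ n st → LoopFree (Gedges 3 st) →
  charPolyQ (G-graph n 3 st) ≋ scale (sign n) (Link.P ℕ._≟_ (adjE (Gedges 3 st)) (λ _ → oneD) (upFrom 0 n))
G-graph-value n st lf = subst (λ l → charPolyQ (G-graph n 3 st) ≋ scale (sign n) (P (adjE (Gedges 3 st)) (λ _ → oneD) l))
  (tabulate-upFrom n 0 toℕ (λ _ → refl))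
  (charPoly-P n (G-graph n 3 st) (adjE (Gedges 3 st)) toℕ (λ i j → Finₚ.toℕ-injective) (λ i j → refl) (adjE-loop (Gedges 3 st) lf))
  where open Link ℕ._≟_ using (P; charPoly-P)

attach-free : ∀ s t nxt → 2 < nxt → LoopFree (attach 2 ((s , t) ∷ []) nxt)
attach-free s t nxt lt = subst LoopFree (sym (attach-last 2 s t nxt))
  (Allₚ.++⁺ (paths2-free 2 s nxt lt) (Allₚ.++⁺ (edges1-free 2 t (nxt ℕ.+ s * 2) (ℕₚ.<-≤-trans lt (ℕₚ.m≤m+n nxt _))) []))
  where open Evaluate polyCone using (paths2-free; edges1-free)

G₁-poly : ∀ n s t → n ≡ 3 ℕ.+ (s * 2 ℕ.+ t) → charPolyQ (G-graph n 3 ((0 , 0) ∷ (0 , 0) ∷ (s , t) ∷ [])) ≋ scale (sign n) (P₁ s t)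
G₁-poly n s t refl = ≋-trans (G-graph-value n ((0 , 0) ∷ (0 , 0) ∷ (s , t) ∷ []) ((λ ()) ∷ (λ ()) ∷ (λ ()) ∷ attach-free s t 3 ℕₚ.≤-refl))
  (scale-cong (sign n) (Evaluate.G₁-value polyCone s t))

G₂-poly : ∀ n s t → n ≡ 5 ℕ.+ (s * 2 ℕ.+ t) → charPolyQ (G-graph n 3 ((0 , 1) ∷ (0 , 1) ∷ (s , t) ∷ [])) ≋ scale (sign n) (P₂ s t)
G₂-poly n s t refl = ≋-trans (G-graph-value n ((0 , 1) ∷ (0 , 1) ∷ (s , t) ∷ []) ((λ ()) ∷ (λ ()) ∷ (λ ()) ∷ (λ ()) ∷ (λ ()) ∷ attach-free s t 5 (s≤s (s≤s (s≤s z≤n)))))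
  (scale-cong (sign n) (Evaluate.G₂-value polyCone s t))

class-poly : ∀ {n m} (G : Adj n) → InClass n m G → ∃ λ Q → charPolyQ G ≋ scale (sign n) Q × Below Q n m
class-poly {n} G ((simple , conn , C₀ , same) , ((M , isM , refl) , _) , (g , (C , len , _) , odd)) =
  P G (λ _ → oneD) (tabulate (λ i → i)) ,
  charPoly-P n G G (λ i → i) (λ i j e → e) (λ i j → refl) (proj₂ simple) ,
  Reduction.below polyCone G simple conn C uniq M isM (subst Odd (sym len) odd)
  where
  open Link (Finₚ._≟_ {n}) using (P; charPoly-P)
  -- The cycle known to be odd is the witness of the girth; uniqueness, stated for `C₀`, is
  -- transferred to it.
  uniq : ∀ D → SameCycle C D
  uniq D u v = (λ e → proj₁ (same D u v) (proj₂ (same C u v) e)) , (λ e → proj₁ (same C u v) (proj₂ (same D u v) e))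

-- Values and degrees, and the incomparability of the candidates

ev : ℤ → Poly → ℤ
ev a [] = + 0
ev a (c ∷ p) = c ℤ.+ a ℤ.* ev a p

ev-⊕ : ∀ a p q → ev a (p ⊕ q) ≡ ev a p ℤ.+ ev a q
ev-⊕ a [] q = sym (ℤₚ.+-identityˡ _)
ev-⊕ a (c ∷ p) [] = sym (ℤₚ.+-identityʳ _)
ev-⊕ a (c ∷ p) (d ∷ q) = trans (cong (λ e → c ℤ.+ d ℤ.+ a ℤ.* e) (ev-⊕ a p q))
  (Z.solve 5 (λ a c d p q → c Z.:+ d Z.:+ a Z.:* (p Z.:+ q) Z.:= (c Z.:+ a Z.:* p) Z.:+ (d Z.:+ a Z.:* q)) refl a c d (ev a p) (ev a q))

ev-scale : ∀ a c p → ev a (scale c p) ≡ c ℤ.* ev a p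
ev-scale a c [] = sym (ℤₚ.*-zeroʳ c)
ev-scale a c (d ∷ p) = trans (cong (λ e → c ℤ.* d ℤ.+ a ℤ.* e) (ev-scale a c p))
  (Z.solve 4 (λ a c d p → c Z.:* d Z.:+ a Z.:* (c Z.:* p) Z.:= c Z.:* (d Z.:+ a Z.:* p)) refl a c d (ev a p))

ev-⊛ : ∀ a p q → ev a (p ⊛ q) ≡ ev a p ℤ.* ev a q
ev-⊛ a [] q = refl
ev-⊛ a (c ∷ p) q = trans (ev-⊕ a (scale c q) _) (trans (cong₂ (λ e f → e ℤ.+ (+ 0 ℤ.+ a ℤ.* f)) (ev-scale a c q) (ev-⊛ a p q))
  (Z.solve 4 (λ a c p q → c Z.:* q Z.:+ (Z.con (+ 0) Z.:+ a Z.:* (p Z.:* q)) Z.:= (c Z.:+ a Z.:* p) Z.:* q) refl a c (ev a p) (ev a q)))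

ev-zero : ∀ a p → (∀ k → coeff p k ≡ + 0) → ev a p ≡ + 0
ev-zero a [] h = refl
ev-zero a (c ∷ p) h = trans (cong₂ (λ c e → c ℤ.+ a ℤ.* e) (h 0) (ev-zero a p (h ∘ suc))) (trans (ℤₚ.+-identityˡ _) (ℤₚ.*-zeroʳ a))

ev-cong : ∀ a {p q} → p ≋ q → ev a p ≡ ev a q
ev-cong a {[]} {q} e = sym (ev-zero a q (λ k → sym (at e k)))
ev-cong a {c ∷ p} {[]} e = ev-zero a (c ∷ p) (at e)
ev-cong a {c ∷ p} {d ∷ q} e = cong₂ (λ c x → c ℤ.+ a ℤ.* x) (at e 0) (ev-cong a {p} {q} (mk (λ k → at e (suc k))))

-- x = -b means y = b ≥ 0, where nonnegative coefficients in y give a nonnegative value; so one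
-- negative value refutes membership in the cone.
ev-nonneg : ∀ b e p → SignNonneg e p → + 0 ℤ.≤ sign e ℤ.* ev (- (+ b)) p
ev-nonneg b e [] h = subst (+ 0 ℤ.≤_) (sym (ℤₚ.*-zeroʳ (sign e))) ℤₚ.≤-refl
ev-nonneg b e (c ∷ p) h = subst (+ 0 ℤ.≤_)
  (Z.solve 4 (λ s c b p → s Z.:* c Z.:+ b Z.:* ((Z.:- s) Z.:* p) Z.:= s Z.:* (c Z.:+ (Z.:- b) Z.:* p)) refl (sign e) c (+ b) (ev (- (+ b)) p))
  (0≤-+ (subst (λ i → + 0 ℤ.≤ sign i ℤ.* c) (ℕₚ.+-identityʳ e) (h 0))
    (0≤-* {+ b} (ℤ.+≤+ z≤n) (ev-nonneg b (suc e) p (λ k → subst (λ i → + 0 ℤ.≤ sign i ℤ.* coeff p k) (ℕₚ.+-suc e k) (h (suc k))))))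

-- `CoeffGE` controls coefficients up to n only. With degree bounds on both polynomials it controls
-- the whole difference, which can then be evaluated.
Degree≤ : ℕ → Poly → Set
Degree≤ d p = ∀ k → d < k → coeff p k ≡ + 0

degree-weaken : ∀ {d e p} → d ≤ e → Degree≤ d p → Degree≤ e p
degree-weaken le h k lt = h k (ℕₚ.≤-<-trans le lt)

degree-⊕ : ∀ {d} p q → Degree≤ d p → Degree≤ d q → Degree≤ d (p ⊕ q)
degree-⊕ p q hp hq k lt = trans (coeff-⊕ p q k) (cong₂ ℤ._+_ (hp k lt) (hq k lt))

degree-⊛ : ∀ {d e} p q → Degree≤ d p → Degree≤ e q → Degree≤ (d ℕ.+ e) (p ⊛ q)
degree-⊛ [] q hp hq k lt = refl
degree-⊛ {d} {e} (c ∷ p) q hp hq k lt = trans (coeff-⊕ (scale c q) (+ 0 ∷ (p ⊛ q)) k)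
  (cong₂ ℤ._+_ (trans (coeff-scale c q k) (trans (cong (c ℤ.*_) (hq k (ℕₚ.≤-<-trans (ℕₚ.m≤n+m e d) lt))) (ℤₚ.*-zeroʳ c))) (rest d k hp lt))
  where
  rest : ∀ d k → Degree≤ d (c ∷ p) → d ℕ.+ e < k → coeff (+ 0 ∷ (p ⊛ q)) k ≡ + 0
  rest d zero hp lt = refl
  rest zero (suc k) hp lt = at (⊛-cong {p} {[]} {q} {q} (mk λ i → hp (suc i) (s≤s z≤n)) ≋-refl) k
  rest (suc d) (suc k) hp (s≤s lt) = degree-⊛ {d} {e} p q (λ i l → hp (suc i) (s≤s l)) hq k lt

degree-const : ∀ c → Degree≤ 0 (const c)
degree-const c (suc k) _ = refl

degree-y : Degree≤ 1 y
degree-y (suc (suc k)) _ = refl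
degree-y (suc zero) (s≤s ())

degree-κ* : ∀ {d} c p → Degree≤ d p → Degree≤ d (κ c ⊛ p)
degree-κ* c p = degree-⊛ {0} (κ c) p (degree-const (+ c))

DegreeD : ℕ → Dual → Set
DegreeD d (F , C) = Degree≤ d F × Degree≤ d C

degree-⊗ : ∀ {d e} a b → DegreeD d a → DegreeD e b → DegreeD (d ℕ.+ e) (a ⊗ b)
degree-⊗ (F , C) (F' , C') (f , c) (f' , c') = degree-⊛ F F' f f' , degree-⊕ (F ⊛ C') (C ⊛ F') (degree-⊛ F C' f c') (degree-⊛ C F' c f')

degree-leaf : DegreeD 1 leafD
degree-leaf = degree-⊕ (κ 1) y (degree-weaken {p = κ 1} z≤n (degree-const (+ 1))) degree-y , degree-y

degree-yy : Degree≤ 2 (y ⊛ y)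
degree-yy = degree-⊛ y y degree-y degree-y

degree-path : DegreeD 2 pathD
degree-path = degree-⊕ ((y ⊛ y) ⊕ (κ 3 ⊛ y)) (κ 1) (degree-⊕ (y ⊛ y) (κ 3 ⊛ y) degree-yy (degree-weaken {p = κ 3 ⊛ y} (s≤s z≤n) (degree-κ* 3 y degree-y))) (degree-weaken {p = κ 1} z≤n (degree-const (+ 1))) ,
  degree-⊕ (y ⊛ y) (κ 2 ⊛ y) degree-yy (degree-weaken {p = κ 2 ⊛ y} (s≤s z≤n) (degree-κ* 2 y degree-y))

degree-Fl : ∀ s t → DegreeD (s * 2 ℕ.+ t) (Fl s t)
degree-Fl zero zero = degree-const (+ 1) , degree-const (+ 0)
degree-Fl zero (suc t) = degree-⊗ leafD (Fl 0 t) degree-leaf (degree-Fl zero t)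
degree-Fl (suc s) t = degree-⊗ pathD (Fl s t) degree-path (degree-Fl s t)

degree-val : ∀ {d e} X V a → Degree≤ e X → Degree≤ (suc e) V → DegreeD d a → Degree≤ (suc e ℕ.+ d) (val X V a)
degree-val {d} {e} X V (F , C) x v (f , c) = degree-⊕ (F ⊛ ((y ⊛ X) ⊕ V)) (C ⊛ X)
  (subst (λ i → Degree≤ i (F ⊛ ((y ⊛ X) ⊕ V))) (ℕₚ.+-comm d (suc e)) (degree-⊛ F ((y ⊛ X) ⊕ V) f (degree-⊕ (y ⊛ X) V (degree-⊛ y X degree-y x) v)))
  (degree-weaken {p = C ⊛ X} (ℕₚ.≤-trans (ℕₚ.≤-reflexive (ℕₚ.+-comm d e)) (ℕₚ.n≤1+n _)) (degree-⊛ C X c x))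

degree-X₁ : Degree≤ 2 X₁
degree-X₁ (suc (suc (suc k))) _ = refl
degree-X₁ (suc (suc zero)) (s≤s (s≤s ()))
degree-X₁ (suc zero) (s≤s ())

degree-V₁ : Degree≤ 3 V₁
degree-V₁ (suc (suc (suc (suc k)))) _ = refl
degree-V₁ (suc (suc (suc zero))) (s≤s (s≤s (s≤s ())))
degree-V₁ (suc (suc zero)) (s≤s (s≤s ()))
degree-V₁ (suc zero) (s≤s ())

degree-X₂ : Degree≤ 4 X₂
degree-X₂ (suc (suc (suc (suc (suc k))))) _ = refl
degree-X₂ (suc (suc (suc (suc zero)))) (s≤s (s≤s (s≤s (s≤s ()))))
degree-X₂ (suc (suc (suc zero))) (s≤s (s≤s (s≤s ())))
degree-X₂ (suc (suc zero)) (s≤s (s≤s ()))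
degree-X₂ (suc zero) (s≤s ())

degree-V₂ : Degree≤ 5 V₂
degree-V₂ (suc (suc (suc (suc (suc (suc k)))))) _ = refl
degree-V₂ (suc (suc (suc (suc (suc zero))))) (s≤s (s≤s (s≤s (s≤s (s≤s ())))))
degree-V₂ (suc (suc (suc (suc zero)))) (s≤s (s≤s (s≤s (s≤s ()))))
degree-V₂ (suc (suc (suc zero))) (s≤s (s≤s (s≤s ())))
degree-V₂ (suc (suc zero)) (s≤s (s≤s ()))
degree-V₂ (suc zero) (s≤s ())

degree-resp : ∀ {d p q} → p ≋ q → Degree≤ d q → Degree≤ d p
degree-resp e h k lt = trans (at e k) (h k lt)

degree-P₁ : ∀ s t → Degree≤ (3 ℕ.+ (s * 2 ℕ.+ t)) (P₁ s t)
degree-P₁ s t = degree-resp (triangle-val₁ (Fl s t)) (degree-val X₁ V₁ (Fl s t) degree-X₁ degree-V₁ (degree-Fl s t))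

degree-P₂ : ∀ s t → Degree≤ (5 ℕ.+ (s * 2 ℕ.+ t)) (P₂ s t)
degree-P₂ s t = degree-resp (triangle-val₂ (Fl s t)) (degree-val X₂ V₂ (Fl s t) degree-X₂ degree-V₂ (degree-Fl s t))

signed-≤ : ∀ {n} (G H : Adj n) {Q Q'} → charPolyQ G ≋ scale (sign n) Q → charPolyQ H ≋ scale (sign n) Q' → CoeffGE G H →
  ∀ k → k ≤ n → sign k ℤ.* coeff Q' k ℤ.≤ sign k ℤ.* coeff Q k
signed-≤ {n} G H {Q} {Q'} eG eH h k k≤n = subst (λ i → sign i ℤ.* coeff Q' i ℤ.≤ sign i ℤ.* coeff Q i) (ℕₚ.m∸[m∸n]≡n k≤n)
  (≡.subst₂ ℤ._≤_ (φ-value H Q' eH (n ∸ k) (ℕₚ.m∸n≤m n k)) (φ-value G Q eG (n ∸ k) (ℕₚ.m∸n≤m n k)) (h (n ∸ k) (ℕₚ.m∸n≤m n k)))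

difference-nonneg : ∀ {n} (G H : Adj n) {Q Q'} → charPolyQ G ≋ scale (sign n) Q → charPolyQ H ≋ scale (sign n) Q' →
  Degree≤ n Q → Degree≤ n Q' → CoeffGE G H → SignNonneg 0 (Q ⊕ negate Q')
difference-nonneg {n} G H {Q} {Q'} eG eH dQ dQ' h k with k ℕ.≤? n
... | yes k≤n = subst (+ 0 ℤ.≤_) (sym (signed-difference Q Q' k)) (ℤₚ.i≤j⇒0≤j-i (signed-≤ G H eG eH h k k≤n))
... | no k≰n = subst (+ 0 ℤ.≤_) (sym (trans (signed-difference Q Q' k) (cong₂ (λ a b → sign k ℤ.* a ℤ.- sign k ℤ.* b) (dQ k (ℕₚ.≰⇒> k≰n)) (dQ' k (ℕₚ.≰⇒> k≰n)))))
    (subst (+ 0 ℤ.≤_) (sym (ℤₚ.+-inverseʳ (sign k ℤ.* + 0))) ℤₚ.≤-refl)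

evD : ℤ → Dual → ℤ × ℤ
evD a (F , C) = ev a F , ev a C

_⊗ℤ_ : ℤ × ℤ → ℤ × ℤ → ℤ × ℤ
(F , C) ⊗ℤ (F' , C') = F ℤ.* F' , F ℤ.* C' ℤ.+ C ℤ.* F'

evD-⊗ : ∀ a x z → evD a (x ⊗ z) ≡ evD a x ⊗ℤ evD a z
evD-⊗ a (F , C) (F' , C') = cong₂ _,_ (ev-⊛ a F F') (trans (ev-⊕ a (F ⊛ C') (C ⊛ F')) (cong₂ ℤ._+_ (ev-⊛ a F C') (ev-⊛ a C F')))

-- The values of `Fl` at y = 3, where `leafD` is (4 , 3) and `pathD` is (19 , 15).
ev₃ : ℕ → ℕ → ℕ × ℕ
ev₃ zero zero = 1 , 0
ev₃ zero (suc t) = let (f , c) = ev₃ zero t in 4 * f , 4 * c ℕ.+ 3 * f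
ev₃ (suc s) t = let (f , c) = ev₃ s t in 19 * f , 19 * c ℕ.+ 15 * f

pos₂ : ℕ × ℕ → ℤ × ℤ
pos₂ (a , b) = + a , + b

⊗ℤ-pos : ∀ a b f c → (+ a , + b) ⊗ℤ (+ f , + c) ≡ pos₂ (a * f , a * c ℕ.+ b * f)
⊗ℤ-pos a b f c = cong₂ _,_ (sym (ℤₚ.pos-* a f)) (cong₂ ℤ._+_ (sym (ℤₚ.pos-* a c)) (sym (ℤₚ.pos-* b f)))

evD-Fl : ∀ s t → evD (- (+ 3)) (Fl s t) ≡ pos₂ (ev₃ s t)
evD-Fl zero zero = refl
evD-Fl zero (suc t) = trans (evD-⊗ (- (+ 3)) leafD (Fl 0 t)) (trans (cong ((+ 4 , + 3) ⊗ℤ_) (evD-Fl zero t)) (⊗ℤ-pos 4 3 (proj₁ (ev₃ 0 t)) (proj₂ (ev₃ 0 t))))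
evD-Fl (suc s) t = trans (evD-⊗ (- (+ 3)) pathD (Fl s t)) (trans (cong ((+ 19 , + 15) ⊗ℤ_) (evD-Fl s t)) (⊗ℤ-pos 19 15 (proj₁ (ev₃ s t)) (proj₂ (ev₃ s t))))

evD₀-Fl : ∀ s t → evD (+ 0) (Fl s t) ≡ (+ 1 , + 0)
evD₀-Fl zero zero = refl
evD₀-Fl zero (suc t) = trans (evD-⊗ (+ 0) leafD (Fl 0 t)) (cong ((+ 1 , + 0) ⊗ℤ_) (evD₀-Fl zero t))
evD₀-Fl (suc s) t = trans (evD-⊗ (+ 0) pathD (Fl s t)) (cong ((+ 1 , + 0) ⊗ℤ_) (evD₀-Fl s t))

ev-Δ : ∀ a s t → ev a (Δ s t) ≡ ev a (y ⊕ κ 2) ℤ.* (ev a (y ⊕ κ 2) ℤ.* proj₁ (evD a (Fl s t))) ℤ.+ ℤ.-1ℤ ℤ.* (ev a (proj₁ pathD) ℤ.* proj₂ (evD a (Fl s t)))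
ev-Δ a s t = trans (ev-⊕ a A (negate B)) (cong₂ ℤ._+_
  (trans (ev-⊛ a (y ⊕ κ 2) ((y ⊕ κ 2) ⊛ F)) (cong (ev a (y ⊕ κ 2) ℤ.*_) (ev-⊛ a (y ⊕ κ 2) F)))
  (trans (ev-scale a ℤ.-1ℤ B) (cong (ℤ.-1ℤ ℤ.*_) (ev-⊛ a (proj₁ pathD) C))))
  where
  F = proj₁ (Fl s t)
  C = proj₂ (Fl s t)
  A = (y ⊕ κ 2) ⊛ ((y ⊕ κ 2) ⊛ F)
  B = proj₁ pathD ⊛ C

-- C/F grows by 3/4 with each pendent edge and by 15/19, which is larger, with each path.
ev₃-ratio : ∀ s t → 3 * (s ℕ.+ t) * proj₁ (ev₃ s t) ≤ 4 * proj₂ (ev₃ s t)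
ev₃-ratio zero zero = z≤n
ev₃-ratio zero (suc t) = ℕₚ.≤-trans (ℕₚ.≤-reflexive (solveℕ 2 (λ t f → (# 3) ⋆ ((# 1) ⊹ t) ⋆ ((# 4) ⋆ f) ≐ (# 4) ⋆ ((# 3) ⋆ t ⋆ f) ⊹ (# 12) ⋆ f) refl t f))
  (ℕₚ.≤-trans (ℕₚ.+-monoˡ-≤ (12 * f) (ℕₚ.*-monoʳ-≤ 4 (ev₃-ratio zero t))) (ℕₚ.≤-reflexive (solveℕ 2 (λ c f → (# 4) ⋆ ((# 4) ⋆ c) ⊹ (# 12) ⋆ f ≐ (# 4) ⋆ ((# 4) ⋆ c ⊹ (# 3) ⋆ f)) refl c f)))
  where
  f = proj₁ (ev₃ zero t)
  c = proj₂ (ev₃ zero t)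
ev₃-ratio (suc s) t = ℕₚ.≤-trans (ℕₚ.≤-reflexive (solveℕ 3 (λ s t f → (# 3) ⋆ ((# 1) ⊹ s ⊹ t) ⋆ ((# 19) ⋆ f) ≐ (# 19) ⋆ ((# 3) ⋆ (s ⊹ t) ⋆ f) ⊹ (# 57) ⋆ f) refl s t f))
  (ℕₚ.≤-trans (ℕₚ.+-mono-≤ (ℕₚ.*-monoʳ-≤ 19 (ev₃-ratio s t)) (ℕₚ.*-monoˡ-≤ f (ℕₚ.m≤n+m 57 3)))
    (ℕₚ.≤-reflexive (solveℕ 2 (λ c f → (# 19) ⋆ ((# 4) ⋆ c) ⊹ (# 60) ⋆ f ≐ (# 4) ⋆ ((# 19) ⋆ c ⊹ (# 15) ⋆ f)) refl c f)))
  where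
  f = proj₁ (ev₃ s t)
  c = proj₂ (ev₃ s t)

ev₃-positive : ∀ s t → 1 ≤ proj₁ (ev₃ s t)
ev₃-positive zero zero = ℕₚ.≤-refl
ev₃-positive zero (suc t) = ℕₚ.≤-trans (ev₃-positive zero t) (ℕₚ.m≤m+n _ _)
ev₃-positive (suc s) t = ℕₚ.≤-trans (ev₃-positive s t) (ℕₚ.m≤m+n _ _)

-- At y = 3 the sign of `Δ` is that of 25F - 19C, and C/F ≥ 3/2 > 25/19 by `ev₃-ratio`. At y = 2
-- this fails: for s = 0, t = 2 the value there is 16 · 9 - 11 · 12 > 0.
Δ-negative : ∀ s t → 2 ≤ s ℕ.+ t → ¬ SignNonneg 0 (y ⊛ Δ s t)
Δ-negative s t two h = ℕₚ.<-irrefl refl (ℕₚ.<-≤-trans (ℕₚ.*-monoˡ-< f {{ℕ.>-nonZero (ev₃-positive s t)}} {100} {114} (ℕₚ.m≤m+n 101 13)) 114f≤100f)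
  where
  f = proj₁ (ev₃ s t)
  c = proj₂ (ev₃ s t)
  value : ev (- (+ 3)) (y ⊛ Δ s t) ≡ + (75 * f) ℤ.- + (57 * c)
  value = trans (ev-⊛ (- (+ 3)) y (Δ s t)) (trans (cong (+ 3 ℤ.*_) (trans (ev-Δ (- (+ 3)) s t)
      (cong (λ x → + 5 ℤ.* (+ 5 ℤ.* proj₁ x) ℤ.+ ℤ.-1ℤ ℤ.* (+ 19 ℤ.* proj₂ x)) (evD-Fl s t))))
    (trans (Z.solve 2 (λ f c → Z.con (+ 3) Z.:* (Z.con (+ 5) Z.:* (Z.con (+ 5) Z.:* f) Z.:+ Z.con ℤ.-1ℤ Z.:* (Z.con (+ 19) Z.:* c)) Z.:= Z.con (+ 75) Z.:* f Z.:- Z.con (+ 57) Z.:* c) refl (+ f) (+ c))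
      (cong₂ ℤ._-_ (sym (ℤₚ.pos-* 75 f)) (sym (ℤₚ.pos-* 57 c)))))
  57c≤75f : 57 * c ≤ 75 * f
  57c≤75f = ℤₚ.drop‿+≤+ (ℤₚ.0≤i-j⇒j≤i (subst (+ 0 ℤ.≤_) (trans (ℤₚ.*-identityˡ _) value) (ev-nonneg 3 0 (y ⊛ Δ s t) h)))
  6f≤4c : 6 * f ≤ 4 * c
  6f≤4c = ℕₚ.≤-trans (ℕₚ.*-monoˡ-≤ f (ℕₚ.*-monoʳ-≤ 3 two)) (ev₃-ratio s t)
  114f≤100f : 114 * f ≤ 100 * f
  114f≤100f = ℕₚ.*-cancelˡ-≤ 3 (ℕₚ.≤-trans (ℕₚ.≤-reflexive (solveℕ 1 (λ f → (# 3) ⋆ ((# 114) ⋆ f) ≐ (# 57) ⋆ ((# 6) ⋆ f)) refl f))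
    (ℕₚ.≤-trans (ℕₚ.*-monoʳ-≤ 57 6f≤4c) (ℕₚ.≤-trans (ℕₚ.≤-reflexive (solveℕ 1 (λ c → (# 57) ⋆ ((# 4) ⋆ c) ≐ (# 4) ⋆ ((# 57) ⋆ c)) refl c))
    (ℕₚ.≤-trans (ℕₚ.*-monoʳ-≤ 4 57c≤75f) (ℕₚ.≤-reflexive (solveℕ 1 (λ f → (# 4) ⋆ ((# 75) ⋆ f) ≐ (# 3) ⋆ ((# 100) ⋆ f)) refl f))))))

coeff₀ : ∀ p → coeff p 0 ≡ ev (+ 0) p
coeff₀ [] = refl
coeff₀ (c ∷ p) = sym (ℤₚ.+-identityʳ c)

-- At y = 0 every `Fl` is (1 , 0), so the constant term of `Δ` is 2² = 4; multiplying by y makes it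
-- the linear one.
Δ-linear : ∀ s t → sign 1 ℤ.* coeff (y ⊛ Δ s t) 1 ≡ + 4
Δ-linear s t = trans (cong (sign 1 ℤ.*_) (trans (coeff-⊕ (scale (+ 0) (Δ s t)) _ 1)
    (cong₂ ℤ._+_ (coeff-scale (+ 0) (Δ s t) 1) (trans (coeff-⊕ (scale ℤ.-1ℤ (Δ s t)) (+ 0 ∷ []) 0) (cong (ℤ._+ + 0) (coeff-scale ℤ.-1ℤ (Δ s t) 0))))))
  (trans (cong (λ d → ℤ.-1ℤ ℤ.* (+ 0 ℤ.+ (ℤ.-1ℤ ℤ.* d ℤ.+ + 0))) (trans (coeff₀ (Δ s t)) (trans (ev-Δ (+ 0) s t)
      (cong (λ x → + 2 ℤ.* (+ 2 ℤ.* proj₁ x) ℤ.+ ℤ.-1ℤ ℤ.* (+ 1 ℤ.* proj₂ x)) (evD₀-Fl s t))))) refl)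

module Incomparable {n : ℕ} (G H : Adj n) (s t : ℕ) (eG : charPolyQ G ≋ scale (sign n) (P₁ (suc s) t)) (eH : charPolyQ H ≋ scale (sign n) (P₂ s t)) (en : n ≡ 5 ℕ.+ (s * 2 ℕ.+ t)) where

  not-≥ : 2 ≤ s ℕ.+ t → ¬ CoeffGE G H
  not-≥ two h = Δ-negative s t two (SignNonneg-resp 0 {P₁ (suc s) t ⊕ negate (P₂ s t)} {y ⊛ Δ s t} (difference s t)
    (difference-nonneg G H {P₁ (suc s) t} {P₂ s t} eG eH (subst (λ i → Degree≤ i (P₁ (suc s) t)) (sym en) (degree-P₁ (suc s) t)) (subst (λ i → Degree≤ i (P₂ s t)) (sym en) (degree-P₂ s t)) h))

  not-≤ : ¬ CoeffGE H G
  not-≤ h = absurd (subst (ℤ._≤ + 0) (trans (sym (signed-difference (P₁ (suc s) t) (P₂ s t) 1)) (trans (cong (sign 1 ℤ.*_) (at (difference s t) 1)) (Δ-linear s t)))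
      (ℤₚ.i≤j⇒i-j≤0 (signed-≤ H G {P₂ s t} {P₁ (suc s) t} eH eG h 1 (subst (1 ≤_) (sym en) (s≤s z≤n)))))
    where
    absurd : + 4 ℤ.≤ + 0 → ⊥
    absurd (ℤ.+≤+ ())

-- Minimality and incomparability for given n and m

theorem4p1 : (n m : ℕ) → 5 ≤ n → 2 * m ≤ n →
    (m ≡ 2 → ∀ G → InClass n m G → CoeffGE G (G31 n m)) ×
    (n ∸ m ≤ 3 → 6 ≤ n → n ≤ 12 → 3 ≤ m → ∀ G → InClass n m G → CoeffGE G (G32 n m)) ×
    (3 ≤ m → (3 < n ∸ m ⊎ 12 < n) →
    (∀ G → InClass n m G → CoeffGE G (G31 n m) ⊎ CoeffGE G (G32 n m)) ×
    ¬ CoeffGE (G31 n m) (G32 n m) × ¬ CoeffGE (G32 n m) (G31 n m))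
theorem4p1 n m 5≤n 2m≤n = part₁ , part₂ , part₃
  where
  -- The number of vertices missed by a matching of m edges; both candidates have r + 1 pendent
  -- edges at the centre.
  r = n ∸ 2 * m
  n≡ : n ≡ 2 * m ℕ.+ r
  n≡ = sym (ℕₚ.m+[n∸m]≡n 2m≤n)

  poly₁ : ∀ s → m ≡ 2 ℕ.+ s → charPolyQ (G31 n m) ≋ scale (sign n) (P₁ s (suc r))
  poly₁ s refl = subst (λ i → charPolyQ (G-graph n 3 ((0 , 0) ∷ (0 , 0) ∷ (s , i) ∷ [])) ≋ scale (sign n) (P₁ s (suc r))) (ℕₚ.+-comm 1 r)
    (G₁-poly n s (suc r) (trans n≡ (solveℕ 2 (λ s r → (# 2) ⋆ ((# 2) ⊹ s) ⊹ r ≐ (# 3) ⊹ (s ⋆ (# 2) ⊹ ((# 1) ⊹ r))) refl s r)))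

  poly₂ : ∀ s → m ≡ 3 ℕ.+ s → charPolyQ (G32 n m) ≋ scale (sign n) (P₂ s (suc r))
  poly₂ s refl = subst (λ i → charPolyQ (G-graph n 3 ((0 , 1) ∷ (0 , 1) ∷ (s , i) ∷ [])) ≋ scale (sign n) (P₂ s (suc r))) (ℕₚ.+-comm 1 r)
    (G₂-poly n s (suc r) (trans n≡ (solveℕ 2 (λ s r → (# 2) ⋆ ((# 3) ⊹ s) ⊹ r ≐ (# 5) ⊹ (s ⋆ (# 2) ⊹ ((# 1) ⊹ r))) refl s r)))

  part₁ : m ≡ 2 → ∀ G → InClass n m G → CoeffGE G (G31 n m)
  part₁ refl G cl with class-poly G cl
  ... | Q , eQ , inj₁ b = coeffGE G (G31 n m) {Q} {P₁ 0 (suc r)} eQ (poly₁ 0 refl) (below₁-at 0 r b n≡ ℕₚ.≤-refl)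
  ... | Q , eQ , inj₂ b = coeffGE G (G31 n m) {Q} {P₁ 0 (suc r)} eQ (poly₁ 0 refl) (below₁-at 0 r (below₂⇒₁ b) n≡ ℕₚ.≤-refl)

  either : ∀ s → m ≡ 3 ℕ.+ s → ∀ G → InClass n m G → CoeffGE G (G31 n m) ⊎ CoeffGE G (G32 n m)
  either s refl G cl with class-poly G cl
  ... | Q , eQ , inj₁ b = inj₁ (coeffGE G (G31 n m) {Q} {P₁ (suc s) (suc r)} eQ (poly₁ (suc s) refl) (below₁-at (suc s) r b n≡ ℕₚ.≤-refl))
  ... | Q , eQ , inj₂ b = inj₂ (coeffGE G (G32 n m) {Q} {P₂ s (suc r)} eQ (poly₂ s refl) (below₂-at s r b n≡ ℕₚ.≤-refl))

  ≥3 : 3 ≤ m → ∃ λ s → m ≡ 3 ℕ.+ s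
  ≥3 le = m ∸ 3 , sym (ℕₚ.m+[n∸m]≡n le)

  rest-eq : n ∸ m ≡ m ℕ.+ r
  rest-eq = trans (cong (_∸ m) (trans n≡ (trans (cong (λ i → m ℕ.+ i ℕ.+ r) (ℕₚ.+-identityʳ m)) (ℕₚ.+-assoc m m r)))) (ℕₚ.m+n∸m≡n m (m ℕ.+ r))

  part₂ : n ∸ m ≤ 3 → 6 ≤ n → n ≤ 12 → 3 ≤ m → ∀ G → InClass n m G → CoeffGE G (G32 n m)
  part₂ le _ _ 3≤m G cl with ≥3 3≤m
  ... | s , em = go s em (class-poly G cl)
    where
    -- n - m = m + r with m = 3 + s, so n - m ≤ 3 leaves only s = r = 0, that is n = 6 and m = 3.
    small : ∀ s r → s ℕ.+ r ≡ 0 → P₁ (suc s) (suc r) ≽ P₂ s (suc r)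
    small zero zero _ = P₁≽P₂
    go : ∀ s → m ≡ 3 ℕ.+ s → (∃ λ Q → charPolyQ G ≋ scale (sign n) Q × Below Q n m) → CoeffGE G (G32 n m)
    go s refl (Q , eQ , inj₂ b) = coeffGE G (G32 n m) {Q} {P₂ s (suc r)} eQ (poly₂ s refl) (below₂-at s r b n≡ ℕₚ.≤-refl)
    go s refl (Q , eQ , inj₁ b) = coeffGE G (G32 n m) {Q} {P₂ s (suc r)} eQ (poly₂ s refl)
      (≽-trans {Q} {P₁ (suc s) (suc r)} {P₂ s (suc r)} (below₁-at (suc s) r b n≡ ℕₚ.≤-refl) (small s r (ℕₚ.n≤0⇒n≡0 (ℕₚ.+-cancelˡ-≤ 3 (s ℕ.+ r) 0 (subst (_≤ 3) rest-eq le)))))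

  part₃ : 3 ≤ m → (3 < n ∸ m ⊎ 12 < n) →
    (∀ G → InClass n m G → CoeffGE G (G31 n m) ⊎ CoeffGE G (G32 n m)) × ¬ CoeffGE (G31 n m) (G32 n m) × ¬ CoeffGE (G32 n m) (G31 n m)
  part₃ 3≤m large with ≥3 3≤m
  ... | s , em = either s em , not-≥ two , not-≤
    where
    open Incomparable (G31 n m) (G32 n m) s (suc r) (poly₁ (suc s) em) (poly₂ s em)
      (trans n≡ (trans (cong (λ i → 2 * i ℕ.+ r) em) (solveℕ 2 (λ s r → (# 2) ⋆ ((# 3) ⊹ s) ⊹ r ≐ (# 5) ⊹ (s ⋆ (# 2) ⊹ ((# 1) ⊹ r))) refl s r)))
    -- Both alternatives exclude s = r = 0: in that case n - m = 3 + s + r would be 3 and n = 6 + 2s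
    -- + r would be 6.
    two : 2 ≤ s ℕ.+ suc r
    two = ℕₚ.≤-trans (s≤s (positive (s ℕ.+ r) refl large)) (ℕₚ.≤-reflexive (sym (ℕₚ.+-suc s r)))
      where
      positive : ∀ x → x ≡ s ℕ.+ r → 3 < n ∸ m ⊎ 12 < n → 1 ≤ x
      positive (suc x) _ _ = s≤s z≤n
      positive zero e (inj₁ lt) = ⊥-elim (ℕₚ.<-irrefl (sym (trans rest-eq (trans (cong (ℕ._+ r) em) (cong (3 ℕ.+_) (sym e))))) lt)
      positive zero e (inj₂ lt) = ⊥-elim (ℕₚ.<⇒≱ lt (ℕₚ.≤-trans (ℕₚ.≤-reflexive (trans n≡ (trans (cong (λ i → 2 * i ℕ.+ r) em)
          (trans (solveℕ 2 (λ s r → (# 2) ⋆ ((# 3) ⊹ s) ⊹ r ≐ (# 6) ⊹ ((s ⊹ r) ⊹ s)) refl s r) (cong₂ (λ a b → 6 ℕ.+ (a ℕ.+ b)) (sym e) (ℕₚ.m+n≡0⇒m≡0 s (sym e))))))) (ℕₚ.m≤m+n 6 6)))
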